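{- Let $m\in\mathbb{N}$ and $n=mp$, where $p$ is an odd prime. Then the circulant graph $\mathrm{Cay}(\mathbb{Z}_n,S)$ does not exhibit pretty good state transfer (between any pair of distinct vertices) if $p\nmid s$ for all $s\in S$.
   Context: All graphs are simple, undirected and finite; $\mathbb{N}$ is the set of positive integers. For a graph $G$ with adjacency matrix $A$, the transition matrix is $H(t)=\exp(-itA)$, $t\in\mathbb{R}$. Let $\mathbf{e}_u$ denote the characteristic vector of the vertex $u$. The graph $G$ exhibits pretty good state transfer between a pair of distinct vertices $u$ and $v$ if there is a sequence $\{t_j\}$ of real numbers such that $\lim_{j\to\infty}H(t_j)\mathbf{e}_u=\gamma\mathbf{e}_v$ for some $\gamma\in\mathbb{C}$ with $|\gamma|=1$. $\mathbb{Z}_n$ is the cyclic group of integers modulo $n$. For $S\subseteq\mathbb{Z}_n\setminus\{0\}$ with $\{ -s:s\in S\}=S$, the circulant graph $\mathrm{Cay}(\mathbb{Z}_n,S)$ has vertex set $\mathbb{Z}_n$, with $a,b$ adjacent if and only if $a-b\in S$. Since $p\mid n$, the condition $p\nmid s$ for $s\in\mathbb{Z}_n$ does not depend on the integer representative of $s$. -}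

module Defs where

open import Data.Bool using (Bool; if_then_else_)
open import Data.Fin using (Fin; toℕ; _≟_)
open import Data.Fin.Properties using (toℕ-injective; toℕ<n; toℕ-fromℕ<)
open import Data.Fin.Subset using (Subset; _∈_; _∉_)
open import Data.Fin.Subset.Properties using (_∈?_)
open import Data.Integer as ℤ using (+_; -[1+_])
import Data.Integer.Properties as ℤ
open import Data.Nat as ℕ using (ℕ; zero; suc; NonZero; _!)
open import Data.Nat.Coprimality using (1-coprimeTo)
open import Data.Nat.DivMod using (_%_; _mod_; n%n≡0; m%n%n≡m%n; m%n<n; m%n≤n; m<n⇒m%n≡m; %-distribˡ-+; [m+n]%n≡m%n)
import Data.Nat.Properties as ℕ
open import Data.Nat.Properties using (_!≢0)
open import Data.Product using (_×_; _,_; proj₁; proj₂; Σ-syntax; ∃-syntax)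
open import Data.Rational
  using (ℚ; mkℚ; 0ℚ; 1ℚ; ½; _+_; _-_; _*_; -_; _/_; 1/_; ∣_∣; _<_; _≤_; *<*; *≤*; positive; nonNegative; Positive; toℚᵘ; fromℚᵘ)
open import Data.Rational.Properties hiding (_≟_)
open import Data.Rational.Solver using (module +-*-Solver)
import Data.Rational.Unnormalised as ℚᵘ
import Data.Rational.Unnormalised.Properties as ℚᵘ
open import Data.Sum using (inj₁; inj₂)
open import Data.Vec.Functional using (Vector; foldr)
open import Function using (_∘_; _⇔_; Equivalence)
open import Level using (0ℓ)
open import Relation.Binary using (Rel; Decidable; Symmetric; Irreflexive)
open import Relation.Binary.PropositionalEquality using (_≡_; _≢_; refl; sym; trans; cong; cong₂; subst; subst₂; module ≡-Reasoning)
open import Relation.Nullary using (does)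

open +-*-Solver using (solve; _:+_; _:*_; _:-_; :-_; con; _:=_)

∣-∣-sym : ∀ p q → ∣ p - q ∣ ≡ ∣ q - p ∣
∣-∣-sym p q = trans (sym (∣-p∣≡∣p∣ (p - q)))
  (cong ∣_∣ (solve 2 (λ p q → :- (p :- q) := q :- p) refl p q))

∣-∣-tri : ∀ p q r → ∣ p - r ∣ ≤ ∣ p - q ∣ + ∣ q - r ∣
∣-∣-tri p q r = subst (λ x → ∣ x ∣ ≤ ∣ p - q ∣ + ∣ q - r ∣)
  (solve 3 (λ p q r → (p :- q) :+ (q :- r) := p :- r) refl p q r)
  (∣p+q∣≤∣p∣+∣q∣ (p - q) (q - r))

∣∣-∣∣≤ : ∀ p q → ∣ (∣ p ∣ - ∣ q ∣) ∣ ≤ ∣ p - q ∣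
∣∣-∣∣≤ p q with ∣p∣≡p∨∣p∣≡-p (∣ p ∣ - ∣ q ∣)
... | inj₁ e = subst (_≤ ∣ p - q ∣) (sym e) (lemma p q)
  where
  lemma : ∀ p q → ∣ p ∣ - ∣ q ∣ ≤ ∣ p - q ∣
  lemma p q = subst (∣ p ∣ - ∣ q ∣ ≤_)
    (solve 2 (λ x y → (x :+ y) :- y := x) refl ∣ p - q ∣ ∣ q ∣)
    (+-monoˡ-≤ (- ∣ q ∣)
      (subst (λ x → ∣ x ∣ ≤ ∣ p - q ∣ + ∣ q ∣)
        (solve 2 (λ p q → (p :- q) :+ q := p) refl p q)
        (∣p+q∣≤∣p∣+∣q∣ (p - q) q)))
... | inj₂ e = subst₂ _≤_
    (trans (solve 2 (λ x y → y :- x := :- (x :- y)) refl ∣ p ∣ ∣ q ∣) (sym e))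
    (∣-∣-sym q p)
    (lemma q p)
  where
  lemma : ∀ p q → ∣ p ∣ - ∣ q ∣ ≤ ∣ p - q ∣
  lemma p q = subst (∣ p ∣ - ∣ q ∣ ≤_)
    (solve 2 (λ x y → (x :+ y) :- y := x) refl ∣ p - q ∣ ∣ q ∣)
    (+-monoˡ-≤ (- ∣ q ∣)
      (subst (λ x → ∣ x ∣ ≤ ∣ p - q ∣ + ∣ q ∣)
        (solve 2 (λ p q → (p :- q) :+ q := p) refl p q)
        (∣p+q∣≤∣p∣+∣q∣ (p - q) q)))

*-pos : ∀ {p q} → 0ℚ < p → 0ℚ < q → 0ℚ < p * q
*-pos {p} {q} 0<p 0<q =
  positive⁻¹ (p * q) {{pos*pos⇒pos p {{positive 0<p}} q {{positive 0<q}}}}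

*-nonNeg : ∀ {p q} → 0ℚ ≤ p → 0ℚ ≤ q → 0ℚ ≤ p * q
*-nonNeg {p} {q} 0≤p 0≤q =
  nonNegative⁻¹ (p * q) {{nonNeg*nonNeg⇒nonNeg p {{nonNegative 0≤p}} q {{nonNegative 0≤q}}}}

*-mono-≤ : ∀ {p q r s} → 0ℚ ≤ p → p ≤ q → 0ℚ ≤ r → r ≤ s → p * r ≤ q * s
*-mono-≤ {p} {q} {r} {s} 0≤p p≤q 0≤r r≤s = ≤-trans
  (*-monoʳ-≤-nonNeg r {{nonNegative 0≤r}} p≤q)
  (*-monoˡ-≤-nonNeg q {{nonNegative (≤-trans 0≤p p≤q)}} r≤s)

*-monoˡ-< : ∀ {p q r} → 0ℚ < p → q < r → p * q < p * r
*-monoˡ-< {p} 0<p = *-monoʳ-<-pos p {{positive 0<p}}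

0<½ : 0ℚ < ½
0<½ = *<* (ℤ.+<+ (ℕ.s≤s ℕ.z≤n))

0<1 : 0ℚ < 1ℚ
0<1 = *<* (ℤ.+<+ (ℕ.s≤s ℕ.z≤n))

half : ℚ → ℚ
half ε = ½ * ε

half-pos : ∀ {ε} → 0ℚ < ε → 0ℚ < half ε
half-pos = *-pos 0<½

half+half : ∀ ε → half ε + half ε ≡ ε
half+half = solve 1 (λ ε → con ½ :* ε :+ con ½ :* ε := ε) refl

shrink : ∀ {c ε} → 0ℚ < c → 0ℚ < ε → ∃[ δ ] 0ℚ < δ × c * δ ≡ ε
shrink {c} {ε} 0<c 0<ε = δ , *-pos 0<ε (positive⁻¹ _ {{1/pos⇒pos c}}) , eq
  where
  instance
    c-pos : Positive c
    c-pos = positive 0<c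
    c-nz = pos⇒nonZero c
  δ = ε * 1/ c
  eq : c * δ ≡ ε
  eq = begin
    c * (ε * 1/ c)  ≡⟨ solve 3 (λ c ε d → c :* (ε :* d) := ε :* (c :* d)) refl c ε (1/ c) ⟩
    ε * (c * 1/ c)  ≡⟨ cong (ε *_) (*-inverseʳ c) ⟩
    ε * 1ℚ          ≡⟨ *-identityʳ ε ⟩
    ε               ∎
    where open ≡-Reasoning

-- 1/(k+1)
inv : ℕ → ℚ
inv k = mkℚ (+ 1) k (1-coprimeTo (suc k))

0<inv : ∀ k → 0ℚ < inv k
0<inv k = *<* (ℤ.+<+ (ℕ.s≤s ℕ.z≤n))

inv-small : ∀ {ε} → 0ℚ < ε → ∃[ N ] ∀ k → N ℕ.≤ k → inv k < ε
inv-small {mkℚ (+ zero) q c} (*<* (ℤ.+<+ ()))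
inv-small {mkℚ -[1+ p ] q c} (*<* ())
inv-small {mkℚ (+ suc p) q c} _ = suc q , λ k q<k →
  *<* (ℤ.+<+ (subst (ℕ._< suc p ℕ.* suc k) (sym (ℕ.+-identityʳ (suc q)))
    (ℕ.<-≤-trans (ℕ.s≤s q<k) (ℕ.m≤m+n (suc k) (p ℕ.* suc k)))))

archimedean : ∀ {c ε} → 0ℚ < c → 0ℚ < ε → ∃[ N ] ∀ k → N ℕ.≤ k → c * inv k < ε
archimedean {c} {ε} 0<c 0<ε =
  let δ , 0<δ , cδ≡ε = shrink 0<c 0<ε
      N , small      = inv-small 0<δ
  in N , λ k N≤k → subst (c * inv k <_) cδ≡ε (*-monoˡ-< 0<c (small k N≤k))

1/! : ℕ → ℚ
1/! k = (+ 1 / (k !)) {{k !≢0}}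

1/-* : ∀ m n .{{_ : NonZero m}} .{{_ : NonZero n}} .{{_ : NonZero (m ℕ.* n)}} →
       + 1 / (m ℕ.* n) ≡ (+ 1 / m) * (+ 1 / n)
1/-* (suc m) (suc n) = toℚᵘ-injective (begin
  toℚᵘ (fromℚᵘ (ℚᵘ.mkℚᵘ (+ 1) (n ℕ.+ m ℕ.* suc n)))   ≈⟨ toℚᵘ-fromℚᵘ _ ⟩
  ℚᵘ.mkℚᵘ (+ 1) m ℚᵘ.* ℚᵘ.mkℚᵘ (+ 1) n                ≈⟨ ℚᵘ.*-cong (toℚᵘ-fromℚᵘ (ℚᵘ.mkℚᵘ (+ 1) m)) (toℚᵘ-fromℚᵘ (ℚᵘ.mkℚᵘ (+ 1) n)) ⟨
  toℚᵘ (+ 1 / suc m) ℚᵘ.* toℚᵘ (+ 1 / suc n)          ≈⟨ toℚᵘ-homo-* (+ 1 / suc m) (+ 1 / suc n) ⟨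
  toℚᵘ ((+ 1 / suc m) * (+ 1 / suc n))                ∎)
  where open ℚᵘ.≃-Reasoning

inv≡ : ∀ k → + 1 / suc k ≡ inv k
inv≡ k = toℚᵘ-injective (toℚᵘ-fromℚᵘ (ℚᵘ.mkℚᵘ (+ 1) k))

1/!-suc : ∀ k → 1/! (suc k) ≡ inv k * 1/! k
1/!-suc k = trans (1/-* (suc k) (k !) {{_}} {{k !≢0}} {{suc k !≢0}})
  (cong (_* 1/! k) (inv≡ k))

0≤1/! : ∀ k → 0ℚ ≤ 1/! k
0≤1/! zero    = *≤* (ℤ.+≤+ ℕ.z≤n)
0≤1/! (suc k) = subst (0ℚ ≤_) (sym (1/!-suc k)) (*-nonNeg (<⇒≤ (0<inv k)) (0≤1/! k))

-- Real numbers are Cauchy sequences of rationals, compared by _≈ᴿ_.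

Eventually : (ℕ → Set) → Set
Eventually P = ∃[ N ] ∀ i → N ℕ.≤ i → P i

record ℝ : Set where
  constructor mkℝ
  field
    seq    : ℕ → ℚ
    cauchy : ∀ ε → 0ℚ < ε → ∃[ N ] ∀ i j → N ℕ.≤ i → N ℕ.≤ j → ∣ seq i - seq j ∣ < ε

open ℝ public

infix 4 _≈ᴿ_ _<ᴿ_

_≈ᴿ_ : ℝ → ℝ → Set
x ≈ᴿ y = ∀ ε → 0ℚ < ε → Eventually λ i → ∣ seq x i - seq y i ∣ < ε

_<ᴿ_ : ℝ → ℝ → Set
x <ᴿ y = ∃[ δ ] 0ℚ < δ × Eventually λ i → seq x i + δ ≤ seq y i

fromℚ : ℚ → ℝ
fromℚ q .seq _ = q
fromℚ q .cauchy ε 0<ε = 0 , λ _ _ _ _ →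
  subst (_< ε) (sym (cong ∣_∣ (+-inverseʳ q))) 0<ε

0ᴿ 1ᴿ : ℝ
0ᴿ = fromℚ 0ℚ
1ᴿ = fromℚ 1ℚ

infixl 6 _+ᴿ_ _-ᴿ_
infixl 7 _*ᴿ_
infix  8 -ᴿ_

_+ᴿ_ : ℝ → ℝ → ℝ
(x +ᴿ y) .seq i = seq x i + seq y i
(x +ᴿ y) .cauchy ε 0<ε =
  let M , hx = cauchy x (half ε) (half-pos 0<ε)
      N , hy = cauchy y (half ε) (half-pos 0<ε)
  in M ℕ.⊔ N , λ i j p q →
  let a = seq x i; b = seq y i; c = seq x j; d = seq y j in
  ≤-<-trans
    (subst (λ z → ∣ z ∣ ≤ ∣ a - c ∣ + ∣ b - d ∣)
      (solve 4 (λ a b c d → (a :- c) :+ (b :- d) := (a :+ b) :- (c :+ d)) refl a b c d)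
      (∣p+q∣≤∣p∣+∣q∣ (a - c) (b - d)))
    (subst (∣ a - c ∣ + ∣ b - d ∣ <_) (half+half ε)
      (+-mono-< (hx i j (ℕ.m⊔n≤o⇒m≤o M N p) (ℕ.m⊔n≤o⇒m≤o M N q))
                (hy i j (ℕ.m⊔n≤o⇒n≤o M N p) (ℕ.m⊔n≤o⇒n≤o M N q))))

-ᴿ_ : ℝ → ℝ
(-ᴿ x) .seq i = - seq x i
(-ᴿ x) .cauchy ε 0<ε = let N , h = cauchy x ε 0<ε in N , λ i j p q → subst (_< ε)
  (trans (∣-∣-sym (seq x i) (seq x j))
    (cong ∣_∣ (solve 2 (λ a b → b :- a := (:- a) :- (:- b)) refl (seq x i) (seq x j))))
  (h i j p q)

_-ᴿ_ : ℝ → ℝ → ℝ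
x -ᴿ y = x +ᴿ (-ᴿ y)

∣_∣ᴿ : ℝ → ℝ
∣ x ∣ᴿ .seq i = ∣ seq x i ∣
∣ x ∣ᴿ .cauchy ε 0<ε = let N , h = cauchy x ε 0<ε in N , λ i j p q → ≤-<-trans (∣∣-∣∣≤ (seq x i) (seq x j)) (h i j p q)

sumAbs : (ℕ → ℚ) → ℕ → ℚ
sumAbs f zero    = ∣ f zero ∣
sumAbs f (suc N) = sumAbs f N + ∣ f (suc N) ∣

sumAbs-nonNeg : ∀ f N → 0ℚ ≤ sumAbs f N
sumAbs-nonNeg f zero    = 0≤∣p∣ _
sumAbs-nonNeg f (suc N) = +-mono-≤ (sumAbs-nonNeg f N) (0≤∣p∣ _)

≤-+ʳ : ∀ {p q r} → p ≤ q → 0ℚ ≤ r → p ≤ q + r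
≤-+ʳ {p} p≤q 0≤r = subst (_≤ _) (+-identityʳ p) (+-mono-≤ p≤q 0≤r)

≤-+ˡ : ∀ {p q r} → p ≤ q → 0ℚ ≤ r → p ≤ r + q
≤-+ˡ {p} p≤q 0≤r = subst (_≤ _) (+-identityˡ p) (+-mono-≤ 0≤r p≤q)

sumAbs-bound : ∀ f N i → i ℕ.≤ N → ∣ f i ∣ ≤ sumAbs f N
sumAbs-bound f zero    zero ℕ.z≤n = ≤-refl
sumAbs-bound f (suc N) i    i≤    with ℕ.m≤n⇒m<n∨m≡n i≤
... | inj₁ (ℕ.s≤s i≤N) = ≤-+ʳ (sumAbs-bound f N i i≤N) (0≤∣p∣ _)
... | inj₂ refl        = ≤-+ˡ ≤-refl (sumAbs-nonNeg f N)

bounded : ∀ x → ∃[ B ] 0ℚ < B × (∀ i → ∣ seq x i ∣ ≤ B)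
bounded x with cauchy x 1ℚ 0<1
... | N , h = m + 1ℚ , <-≤-trans 0<1 (≤-+ˡ ≤-refl (sumAbs-nonNeg (seq x) N)) , bound
  where
  m = sumAbs (seq x) N
  bound : ∀ i → ∣ seq x i ∣ ≤ m + 1ℚ
  bound i with ℕ.≤-total i N
  ... | inj₁ i≤N = ≤-+ʳ (sumAbs-bound (seq x) N i i≤N) (<⇒≤ 0<1)
  ... | inj₂ N≤i = ≤-trans
    (subst (λ z → ∣ z ∣ ≤ ∣ seq x N ∣ + ∣ seq x i - seq x N ∣)
      (solve 2 (λ a b → b :+ (a :- b) := a) refl (seq x i) (seq x N))
      (∣p+q∣≤∣p∣+∣q∣ (seq x N) (seq x i - seq x N)))
    (+-mono-≤ (sumAbs-bound (seq x) N N ℕ.≤-refl) (<⇒≤ (h i N N≤i ℕ.≤-refl)))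

_*ᴿ_ : ℝ → ℝ → ℝ
(x *ᴿ y) .seq i = seq x i * seq y i
(x *ᴿ y) .cauchy ε 0<ε =
  let B , 0<B , hB = bounded x
      C , 0<C , hC = bounded y
      δ , 0<δ , Bδ = shrink 0<B (half-pos 0<ε)
      η , 0<η , Cη = shrink 0<C (half-pos 0<ε)
      M , hx       = cauchy x η 0<η
      N , hy       = cauchy y δ 0<δ
  in M ℕ.⊔ N , λ i j p q →
  let a = seq x i; b = seq y i; c = seq x j; d = seq y j in
  ≤-<-trans
    (subst₂ (λ z w → ∣ z ∣ ≤ w)
      (solve 4 (λ a b c d → a :* (b :- d) :+ d :* (a :- c) := a :* b :- c :* d) refl a b c d)
      (cong₂ _+_ (∣p*q∣≡∣p∣*∣q∣ a (b - d)) (∣p*q∣≡∣p∣*∣q∣ d (a - c)))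
      (∣p+q∣≤∣p∣+∣q∣ (a * (b - d)) (d * (a - c))))
    (subst (∣ a ∣ * ∣ b - d ∣ + ∣ d ∣ * ∣ a - c ∣ <_) (half+half ε)
      (+-mono-<
        (subst (∣ a ∣ * ∣ b - d ∣ <_) Bδ
          (≤-<-trans (*-mono-≤ (0≤∣p∣ a) (hB i) (0≤∣p∣ (b - d)) ≤-refl)
            (*-monoˡ-< 0<B (hy i j (ℕ.m⊔n≤o⇒n≤o M N p) (ℕ.m⊔n≤o⇒n≤o M N q)))))
        (subst (∣ d ∣ * ∣ a - c ∣ <_) Cη
          (≤-<-trans (*-mono-≤ (0≤∣p∣ d) (hC j) (0≤∣p∣ (a - c)) ≤-refl)
            (*-monoˡ-< 0<C (hx i j (ℕ.m⊔n≤o⇒m≤o M N p) (ℕ.m⊔n≤o⇒m≤o M N q)))))))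

-- Since every positive real exceeds a positive rational, rational
-- tolerances suffice in the two definitions below.

infix 4 _⟶ᴿ_

_⟶ᴿ_ : (ℕ → ℝ) → ℝ → Set
x ⟶ᴿ l = ∀ ε → 0ℚ < ε → Eventually λ n → ∣ x n -ᴿ l ∣ᴿ <ᴿ fromℚ ε

Cauchyᴿ : (ℕ → ℝ) → Set
Cauchyᴿ x = ∀ ε → 0ℚ < ε →
  ∃[ N ] ∀ m n → N ℕ.≤ m → N ℕ.≤ n → ∣ x m -ᴿ x n ∣ᴿ <ᴿ fromℚ ε

<ᴿ-eventually : ∀ {x q} → x <ᴿ fromℚ q → Eventually λ i → seq x i < q
<ᴿ-eventually {x} {q} (δ , 0<δ , N , h) = N , λ i N≤i →
  <-≤-trans (subst (_< seq x i + δ) (+-identityʳ (seq x i)) (+-monoʳ-< (seq x i) 0<δ)) (h i N≤i)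

complete : ∀ x → Cauchyᴿ x → ∃[ l ] x ⟶ᴿ l
complete x cau = l , conv
  where
  modulus : ℕ → ℕ
  modulus k = proj₁ (cauchy (x k) (inv k) (0<inv k))

  near : ∀ k i → modulus k ℕ.≤ i → ∣ seq (x k) i - seq (x k) (modulus k) ∣ < inv k
  near k i p = proj₂ (cauchy (x k) (inv k) (0<inv k)) i (modulus k) p ℕ.≤-refl

  diag : ℕ → ℚ
  diag k = seq (x k) (modulus k)

  diag-cauchy : ∀ ε → 0ℚ < ε → ∃[ N ] ∀ i j → N ℕ.≤ i → N ℕ.≤ j → ∣ diag i - diag j ∣ < ε
  diag-cauchy ε 0<ε = K₀ ℕ.⊔ N , go
    where
    K₀ N : ℕ
    K₀ = proj₁ (inv-small (half-pos (half-pos 0<ε)))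
    N  = proj₁ (cau (half ε) (half-pos 0<ε))
    hK : ∀ k → K₀ ℕ.≤ k → inv k < half (half ε)
    hK = proj₂ (inv-small (half-pos (half-pos 0<ε)))
    go : ∀ i j → K₀ ℕ.⊔ N ℕ.≤ i → K₀ ℕ.⊔ N ℕ.≤ j → ∣ diag i - diag j ∣ < ε
    go i j p q = ≤-<-trans
        (≤-trans (∣-∣-tri (diag i) (seq (x i) r) (diag j))
          (+-monoʳ-≤ ∣ diag i - seq (x i) r ∣ (∣-∣-tri (seq (x i) r) (seq (x j) r) (diag j))))
        (subst (∣ diag i - seq (x i) r ∣ + (∣ seq (x i) r - seq (x j) r ∣ + ∣ seq (x j) r - diag j ∣) <_)
          (solve 1 (λ ε → con ½ :* (con ½ :* ε) :+ (con ½ :* ε :+ con ½ :* (con ½ :* ε)) := ε) refl ε)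
          (+-mono-<
            (<-trans (subst (_< inv i) (∣-∣-sym (seq (x i) r) (diag i)) (near i r i≤r))
                     (hK i (ℕ.m⊔n≤o⇒m≤o K₀ N p)))
            (+-mono-<
              (hR r R≤r)
              (<-trans (near j r j≤r) (hK j (ℕ.m⊔n≤o⇒m≤o K₀ N q))))))
      where
      close : Eventually λ k → ∣ seq (x i) k - seq (x j) k ∣ < half ε
      close = <ᴿ-eventually {∣ x i -ᴿ x j ∣ᴿ} {half ε}
        (proj₂ (cau (half ε) (half-pos 0<ε)) i j (ℕ.m⊔n≤o⇒n≤o K₀ N p) (ℕ.m⊔n≤o⇒n≤o K₀ N q))
      R = proj₁ close
      hR = proj₂ close
      r = modulus i ℕ.+ modulus j ℕ.+ R
      i≤r : modulus i ℕ.≤ r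
      i≤r = ℕ.≤-trans (ℕ.m≤m+n (modulus i) (modulus j)) (ℕ.m≤m+n _ R)
      j≤r : modulus j ℕ.≤ r
      j≤r = ℕ.≤-trans (ℕ.m≤n+m (modulus j) (modulus i)) (ℕ.m≤m+n _ R)
      R≤r : R ℕ.≤ r
      R≤r = ℕ.m≤n+m R _

  l : ℝ
  l = mkℝ diag diag-cauchy

  conv : x ⟶ᴿ l
  conv ε 0<ε =
    let K , hK = inv-small (half-pos (half-pos 0<ε))
        N , hN = diag-cauchy (half (half ε)) (half-pos (half-pos 0<ε))
    in K ℕ.⊔ N , λ n p →
    half ε , half-pos 0<ε , modulus n ℕ.+ N , λ i q →
    subst (∣ seq (x n) i - diag i ∣ + half ε ≤_)
      (solve 1 (λ ε → (con ½ :* (con ½ :* ε) :+ con ½ :* (con ½ :* ε)) :+ con ½ :* ε := ε) refl ε)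
      (+-monoˡ-≤ (half ε)
        (≤-trans (∣-∣-tri (seq (x n) i) (diag n) (diag i))
          (<⇒≤ (+-mono-<
            (<-trans (near n i (ℕ.≤-trans (ℕ.m≤m+n (modulus n) N) q)) (hK n (ℕ.m⊔n≤o⇒m≤o K N p)))
            (hN n i (ℕ.m⊔n≤o⇒n≤o K N p) (ℕ.≤-trans (ℕ.m≤n+m N (modulus n)) q))))))

record ℂ : Set where
  constructor _+i_
  field
    re im : ℝ

open ℂ public

infix 4 _≈ᶜ_ _⟶ᶜ_
infixl 6 _+ᶜ_
infixl 7 _*ᶜ_
infix  8 -ᶜ_

_≈ᶜ_ : ℂ → ℂ → Set
z ≈ᶜ w = (re z ≈ᴿ re w) × (im z ≈ᴿ im w)

fromℝ : ℝ → ℂ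
fromℝ x = x +i 0ᴿ

0ᶜ 1ᶜ 𝕚 : ℂ
0ᶜ = fromℝ 0ᴿ
1ᶜ = fromℝ 1ᴿ
𝕚  = 0ᴿ +i 1ᴿ

_+ᶜ_ _*ᶜ_ : ℂ → ℂ → ℂ
z +ᶜ w = (re z +ᴿ re w) +i (im z +ᴿ im w)
z *ᶜ w = (re z *ᴿ re w -ᴿ im z *ᴿ im w) +i (re z *ᴿ im w +ᴿ im z *ᴿ re w)

-ᶜ_ : ℂ → ℂ
-ᶜ z = (-ᴿ re z) +i (-ᴿ im z)

-- |z|². No square root is needed: |z| = 1 is the equation |z|² = 1.
normSq : ℂ → ℝ
normSq z = re z *ᴿ re z +ᴿ im z *ᴿ im z

_⟶ᶜ_ : (ℕ → ℂ) → ℂ → Set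
z ⟶ᶜ w = ((λ n → re (z n)) ⟶ᴿ re w) × ((λ n → im (z n)) ⟶ᴿ im w)

∑ : ∀ {n} → Vector ℂ n → ℂ
∑ = foldr _+ᶜ_ 0ᶜ

Matrix : ℕ → Set
Matrix n = Fin n → Fin n → ℂ

infixl 7 _*ᴹ_ _•ᴹ_ _*ᵛ_ _•ᵛ_
infixr 8 _^ᴹ_
infix  4 _⟶ᵛ_

δ : ∀ {n} → Fin n → Fin n → ℂ
δ a b = if does (a ≟ b) then 1ᶜ else 0ᶜ

𝐞 : ∀ {n} → Fin n → Vector ℂ n
𝐞 u a = δ a u

_*ᴹ_ : ∀ {n} → Matrix n → Matrix n → Matrix n
(M *ᴹ N) a b = ∑ λ c → M a c *ᶜ N c b

_^ᴹ_ : ∀ {n} → Matrix n → ℕ → Matrix n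
M ^ᴹ zero  = δ
M ^ᴹ suc k = M *ᴹ (M ^ᴹ k)

_•ᴹ_ : ∀ {n} → ℂ → Matrix n → Matrix n
(z •ᴹ M) a b = z *ᶜ M a b

_*ᵛ_ : ∀ {n} → Matrix n → Vector ℂ n → Vector ℂ n
(M *ᵛ x) a = ∑ λ c → M a c *ᶜ x c

_•ᵛ_ : ∀ {n} → ℂ → Vector ℂ n → Vector ℂ n
(z •ᵛ x) a = z *ᶜ x a

_⟶ᵛ_ : ∀ {n} → (ℕ → Vector ℂ n) → Vector ℂ n → Set
x ⟶ᵛ y = ∀ a → (λ j → x j a) ⟶ᶜ y a

-- f 0 + ⋯ + f (N - 1)
∑[<_] : ℕ → (ℕ → ℂ) → ℂ
∑[< zero  ] f = 0ᶜ
∑[< suc N ] f = ∑[< N ] f +ᶜ f N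

expTerm : ∀ {n} → Matrix n → ℕ → Matrix n
expTerm M k = fromℝ (fromℚ (1/! k)) •ᴹ (M ^ᴹ k)

expPartial : ∀ {n} → Matrix n → ℕ → Matrix n
expPartial M N a b = ∑[< N ] λ k → expTerm M k a b

Bounded : ℂ → ℚ → Set
Bounded z c = ∀ i → (∣ seq (re z) i ∣ ≤ c) × (∣ seq (im z) i ∣ ≤ c)

Bounded-weaken : ∀ {z c d} → c ≤ d → Bounded z c → Bounded z d
Bounded-weaken c≤d h i = ≤-trans (proj₁ (h i)) c≤d , ≤-trans (proj₂ (h i)) c≤d

Bounded-+ : ∀ {z w c d} → Bounded z c → Bounded w d → Bounded (z +ᶜ w) (c + d)
Bounded-+ {z} {w} h k i =
  ≤-trans (∣p+q∣≤∣p∣+∣q∣ (seq (re z) i) (seq (re w) i)) (+-mono-≤ (proj₁ (h i)) (proj₁ (k i))) ,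
  ≤-trans (∣p+q∣≤∣p∣+∣q∣ (seq (im z) i) (seq (im w) i)) (+-mono-≤ (proj₂ (h i)) (proj₂ (k i)))

∣*∣≤ : ∀ p q {c d} → ∣ p ∣ ≤ c → ∣ q ∣ ≤ d → ∣ p * q ∣ ≤ c * d
∣*∣≤ p q hp hq = subst (_≤ _) (sym (∣p*q∣≡∣p∣*∣q∣ p q)) (*-mono-≤ (0≤∣p∣ p) hp (0≤∣p∣ q) hq)

Bounded-* : ∀ {z w c d} → Bounded z c → Bounded w d → Bounded (z *ᶜ w) (c * d + c * d)
Bounded-* {z} {w} h k i =
  ≤-trans (∣p-q∣≤∣p∣+∣q∣ (seq (re z) i * seq (re w) i) (seq (im z) i * seq (im w) i))
    (+-mono-≤ (∣*∣≤ (seq (re z) i) (seq (re w) i) (proj₁ (h i)) (proj₁ (k i)))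
              (∣*∣≤ (seq (im z) i) (seq (im w) i) (proj₂ (h i)) (proj₂ (k i)))) ,
  ≤-trans (∣p+q∣≤∣p∣+∣q∣ (seq (re z) i * seq (im w) i) (seq (im z) i * seq (re w) i))
    (+-mono-≤ (∣*∣≤ (seq (re z) i) (seq (im w) i) (proj₁ (h i)) (proj₂ (k i)))
              (∣*∣≤ (seq (im z) i) (seq (re w) i) (proj₂ (h i)) (proj₁ (k i))))

Bounded-scale : ∀ {q z c} → 0ℚ ≤ q → Bounded z c → Bounded (fromℝ (fromℚ q) *ᶜ z) (q * c)
Bounded-scale {q} {z} {c} 0≤q h i =
  subst (_≤ q * c)
    (cong ∣_∣ (solve 3 (λ q x y → q :* x := q :* x :- con 0ℚ :* y) refl q (seq (re z) i) (seq (im z) i)))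
    (∣*∣≤ q (seq (re z) i) q≤ (proj₁ (h i))) ,
  subst (_≤ q * c)
    (cong ∣_∣ (solve 3 (λ q x y → q :* y := q :* y :+ con 0ℚ :* x) refl q (seq (re z) i) (seq (im z) i)))
    (∣*∣≤ q (seq (im z) i) q≤ (proj₂ (h i)))
  where
  q≤ : ∣ q ∣ ≤ q
  q≤ = ≤-reflexive (0≤p⇒∣p∣≡p 0≤q)

_×ℚ_ : ℕ → ℚ → ℚ
zero  ×ℚ c = 0ℚ
suc n ×ℚ c = c + n ×ℚ c

×ℚ-* : ∀ n c d → n ×ℚ (c * d) ≡ (n ×ℚ c) * d
×ℚ-* zero    c d = sym (*-zeroˡ d)
×ℚ-* (suc n) c d = trans (cong (λ e → c * d + e) (×ℚ-* n c d)) (sym (*-distribʳ-+ d c (n ×ℚ c)))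

×ℚ-nonNeg : ∀ n {c} → 0ℚ ≤ c → 0ℚ ≤ n ×ℚ c
×ℚ-nonNeg zero    0≤c = ≤-refl
×ℚ-nonNeg (suc n) 0≤c = +-mono-≤ 0≤c (×ℚ-nonNeg n 0≤c)

Bounded-0 : Bounded 0ᶜ 0ℚ
Bounded-0 i = ≤-refl , ≤-refl

Bounded-∑ : ∀ {n} (x : Vector ℂ n) {c} → (∀ a → Bounded (x a) c) → Bounded (∑ x) (n ×ℚ c)
Bounded-∑ {zero}  x h = Bounded-0
Bounded-∑ {suc n} x h =
  Bounded-+ {x Fin.zero} {∑ (x ∘ Fin.suc)} (h Fin.zero) (Bounded-∑ (x ∘ Fin.suc) (h ∘ Fin.suc))

Bounded-δ : ∀ {n} (a b : Fin n) → Bounded (δ a b) 1ℚ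
Bounded-δ a b i with does (a ≟ b)
... | Bool.true  = ≤-refl , <⇒≤ 0<1
... | Bool.false = <⇒≤ 0<1 , <⇒≤ 0<1

bound : ∀ z → ∃[ c ] 0ℚ ≤ c × Bounded z c
bound z with bounded (re z) | bounded (im z)
... | B , 0<B , hB | C , 0<C , hC =
  B + C , +-mono-≤ (<⇒≤ 0<B) (<⇒≤ 0<C) ,
  λ i → ≤-+ʳ (hB i) (<⇒≤ 0<C) , ≤-+ˡ (hC i) (<⇒≤ 0<B)

bound-vec : ∀ {n} (x : Vector ℂ n) → ∃[ c ] 0ℚ ≤ c × (∀ a → Bounded (x a) c)
bound-vec {zero}  x = 0ℚ , ≤-refl , λ ()
bound-vec {suc n} x with bound (x Fin.zero) | bound-vec (x ∘ Fin.suc)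
... | c , 0≤c , h | d , 0≤d , k = c + d , +-mono-≤ 0≤c 0≤d , λ where
  Fin.zero    → Bounded-weaken {x Fin.zero} (≤-+ʳ ≤-refl 0≤d) h
  (Fin.suc a) → Bounded-weaken {x (Fin.suc a)} (≤-+ˡ ≤-refl 0≤c) (k a)

bound-mat : ∀ {m n} (M : Fin m → Fin n → ℂ) → ∃[ c ] 0ℚ ≤ c × (∀ a b → Bounded (M a b) c)
bound-mat {zero}  M = 0ℚ , ≤-refl , λ ()
bound-mat {suc n} M with bound-vec (M Fin.zero) | bound-mat (M ∘ Fin.suc)
... | c , 0≤c , h | d , 0≤d , k = c + d , +-mono-≤ 0≤c 0≤d , λ where
  Fin.zero    b → Bounded-weaken {M Fin.zero b} (≤-+ʳ ≤-refl 0≤d) (h b)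
  (Fin.suc a) b → Bounded-weaken {M (Fin.suc a) b} (≤-+ˡ ≤-refl 0≤c) (k a b)

pow : ℚ → ℕ → ℚ
pow D zero    = 1ℚ
pow D (suc k) = D * pow D k

pow-pos : ∀ {D} → 0ℚ < D → ∀ k → 0ℚ < pow D k
pow-pos 0<D zero    = 0<1
pow-pos 0<D (suc k) = *-pos 0<D (pow-pos 0<D k)

growth : ∀ {n} (M : Matrix n) → ∃[ D ] 0ℚ < D × (∀ k a b → Bounded ((M ^ᴹ k) a b) (pow D k))
growth {n} M with bound-mat M
... | c , 0≤c , h = D , 0<D , go
  where
  E = n ×ℚ (c + c)
  D = E + 1ℚ
  0≤E : 0ℚ ≤ E
  0≤E = ×ℚ-nonNeg n (+-mono-≤ 0≤c 0≤c)
  0<D : 0ℚ < D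
  0<D = <-≤-trans 0<1 (≤-+ˡ ≤-refl 0≤E)
  le : ∀ k → n ×ℚ (c * pow D k + c * pow D k) ≤ D * pow D k
  le k = subst (_≤ D * pow D k)
    (trans (sym (×ℚ-* n (c + c) (pow D k))) (cong (n ×ℚ_) (*-distribʳ-+ (pow D k) c c)))
    (*-mono-≤ 0≤E (≤-+ʳ ≤-refl (<⇒≤ 0<1)) (<⇒≤ (pow-pos 0<D k)) ≤-refl)
  go : ∀ k a b → Bounded ((M ^ᴹ k) a b) (pow D k)
  go zero    a b = Bounded-δ a b
  go (suc k) a b = Bounded-weaken {(M ^ᴹ suc k) a b} (le k)
    (Bounded-∑ (λ e → M a e *ᶜ (M ^ᴹ k) e b)
      (λ e → Bounded-* {M a e} {(M ^ᴹ k) e b} (h a e) (go k e b)))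

majorant : ℚ → ℕ → ℚ
majorant D k = 1/! k * pow D k

majorant-nonNeg : ∀ {D} → 0ℚ < D → ∀ k → 0ℚ ≤ majorant D k
majorant-nonNeg 0<D k = *-nonNeg (0≤1/! k) (<⇒≤ (pow-pos 0<D k))

majorant-suc : ∀ D k → majorant D (suc k) ≡ (D * inv k) * majorant D k
majorant-suc D k = trans (cong (_* (D * pow D k)) (1/!-suc k))
  (solve 4 (λ D v f p → (v :* f) :* (D :* p) := (D :* v) :* (f :* p)) refl D (inv k) (1/! k) (pow D k))

-- A sequence of reals whose k-th increment is at most μ k is Cauchy, for
-- any μ satisfying the recurrence of Dᵏ/k!.
module Majorised {D : ℚ} (0<D : 0ℚ < D) (μ : ℕ → ℚ) (μ-nonNeg : ∀ k → 0ℚ ≤ μ k)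
  (μ-suc : ∀ k → μ (suc k) ≡ (D * inv k) * μ k)
  (K : ℕ) (K-large : ∀ k → K ℕ.≤ k → D * inv k < ½) where

  halving : ∀ k → K ℕ.≤ k → μ (suc k) + μ (suc k) ≤ μ k
  halving k K≤k = subst₂ _≤_
    (sym (cong₂ _+_ (μ-suc k) (μ-suc k)))
    (trans (sym (*-distribʳ-+ (μ k) ½ ½)) (*-identityˡ (μ k)))
    (+-mono-≤ le le)
    where
    le : (D * inv k) * μ k ≤ ½ * μ k
    le = *-mono-≤ (<⇒≤ (*-pos 0<D (0<inv k))) (<⇒≤ (K-large k K≤k))
                  (μ-nonNeg k) ≤-refl

  μ-decr : ∀ d → μ (d ℕ.+ K) ≤ μ K
  μ-decr zero    = ≤-refl
  μ-decr (suc d) = ≤-trans (≤-+ʳ ≤-refl (μ-nonNeg (suc d ℕ.+ K)))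
    (≤-trans (halving (d ℕ.+ K) (ℕ.m≤n+m K d)) (μ-decr d))

  μ-small : ∀ {ε} → 0ℚ < ε → ∃[ N ] K ℕ.≤ N × μ N < ε
  μ-small {ε} 0<ε = suc k , ℕ.m≤n⇒m≤1+n (ℕ.m≤n+m K N) ,
      ≤-<-trans (subst (_≤ C * inv k) (sym (μ-suc k)) le) (h k (ℕ.m≤m+n N K))
    where
    C = D * (μ K + 1ℚ)
    0<C : 0ℚ < C
    0<C = *-pos 0<D (<-≤-trans 0<1 (≤-+ˡ ≤-refl (μ-nonNeg K)))
    N = proj₁ (archimedean 0<C 0<ε)
    h = proj₂ (archimedean 0<C 0<ε)
    k = N ℕ.+ K
    le : (D * inv k) * μ k ≤ C * inv k
    le = subst ((D * inv k) * μ k ≤_)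
      (solve 3 (λ D v m → (D :* v) :* m := (D :* m) :* v) refl D (inv k) (μ K + 1ℚ))
      (*-mono-≤ (<⇒≤ (*-pos 0<D (0<inv k))) ≤-refl (μ-nonNeg k)
        (≤-trans (μ-decr N) (≤-+ʳ ≤-refl (<⇒≤ 0<1))))

  module _ (S : ℕ → ℝ) (step : ∀ k i → ∣ seq (S (suc k)) i - seq (S k) i ∣ ≤ μ k) where

    tail : ∀ N d i → K ℕ.≤ N →
           ∣ seq (S (d ℕ.+ N)) i - seq (S N) i ∣ + (μ (d ℕ.+ N) + μ (d ℕ.+ N))
           ≤ μ N + μ N
    tail N zero    i K≤N = ≤-reflexive (trans
      (cong (_+ (μ N + μ N)) (cong ∣_∣ (+-inverseʳ (seq (S N) i))))
      (+-identityˡ _))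
    tail N (suc d) i K≤N = ≤-trans
      (+-mono-≤
        (≤-trans (∣-∣-tri (seq (S (suc d ℕ.+ N)) i) (seq (S (d ℕ.+ N)) i) (seq (S N) i))
          (+-monoˡ-≤ ∣ seq (S (d ℕ.+ N)) i - seq (S N) i ∣ (step (d ℕ.+ N) i)))
        (halving (d ℕ.+ N) (ℕ.≤-trans K≤N (ℕ.m≤n+m N d))))
      (subst (_≤ μ N + μ N)
        (solve 2 (λ x m → x :+ (m :+ m) := (m :+ x) :+ m) refl
          ∣ seq (S (d ℕ.+ N)) i - seq (S N) i ∣ (μ (d ℕ.+ N)))
        (tail N d i K≤N))

    tail′ : ∀ N m i → K ℕ.≤ N → N ℕ.≤ m → ∣ seq (S m) i - seq (S N) i ∣ ≤ μ N + μ N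
    tail′ N m i K≤N N≤m = subst (λ m → ∣ seq (S m) i - seq (S N) i ∣ ≤ μ N + μ N)
      (ℕ.m∸n+n≡m N≤m)
      (≤-trans (≤-+ʳ ≤-refl (+-mono-≤ (μ-nonNeg (d ℕ.+ N)) (μ-nonNeg (d ℕ.+ N))))
               (tail N d i K≤N))
      where d = m ℕ.∸ N

    steps-cauchy : Cauchyᴿ S
    steps-cauchy ε 0<ε =
      let N , K≤N , small = μ-small (half-pos (half-pos (half-pos 0<ε)))
      in N , λ m n N≤m N≤n → half ε , half-pos 0<ε , 0 , λ i _ →
      subst (∣ seq (S m) i - seq (S n) i ∣ + half ε ≤_) (half+half ε)
        (+-monoˡ-≤ (half ε)
          (≤-trans (∣-∣-tri (seq (S m) i) (seq (S N) i) (seq (S n) i))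
            (≤-trans
              (+-mono-≤ (tail′ N m i K≤N N≤m)
                (subst (_≤ μ N + μ N) (∣-∣-sym (seq (S n) i) (seq (S N) i)) (tail′ N n i K≤N N≤n)))
              (subst ((μ N + μ N) + (μ N + μ N) ≤_)
                (solve 1 (λ ε → let e = con ½ :* (con ½ :* (con ½ :* ε)) in (e :+ e) :+ (e :+ e) := con ½ :* ε) refl ε)
                (+-mono-≤ (+-mono-≤ (<⇒≤ small) (<⇒≤ small)) (+-mono-≤ (<⇒≤ small) (<⇒≤ small)))))))

module _ {n} (M : Matrix n) (a b : Fin n) where

  private
    D   = proj₁ (growth M)
    0<D = proj₁ (proj₂ (growth M))

    module Exp = Majorised 0<D (majorant D) (majorant-nonNeg 0<D) (majorant-suc D)
      (proj₁ (archimedean 0<D 0<½)) (proj₂ (archimedean 0<D 0<½))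

    term-bound : ∀ k → Bounded (expTerm M k a b) (majorant D k)
    term-bound k = Bounded-scale {1/! k} {(M ^ᴹ k) a b} (0≤1/! k) (proj₂ (proj₂ (growth M)) k a b)

    increment : ∀ p q → q ≡ (p + q) - p
    increment = solve 2 (λ p q → q := (p :+ q) :- p) refl

    z : ℕ → ℂ
    z N = expPartial M N a b

  -- Limits are unique up to _≈ᶜ_, so only the convergence statement matters,
  -- not which limit is constructed.
  opaque
    exp-converges : ∃[ w ] (λ N → expPartial M N a b) ⟶ᶜ w
    exp-converges =
      let x , hx = complete (re ∘ z) (Exp.steps-cauchy (re ∘ z) λ k i →
            subst (_≤ majorant D k)
              (cong ∣_∣ (increment (seq (re (z k)) i) (seq (re (expTerm M k a b)) i))) (proj₁ (term-bound k i)))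
          y , hy = complete (im ∘ z) (Exp.steps-cauchy (im ∘ z) λ k i →
            subst (_≤ majorant D k)
              (cong ∣_∣ (increment (seq (im (z k)) i) (seq (im (expTerm M k a b)) i))) (proj₂ (term-bound k i)))
      in (x +i y) , hx , hy

exp : ∀ {n} → Matrix n → Matrix n
exp M a b = proj₁ (exp-converges M a b)

exp-limit : ∀ {n} (M : Matrix n) a b → (λ N → expPartial M N a b) ⟶ᶜ exp M a b
exp-limit M a b = proj₂ (exp-converges M a b)

record Graph (n : ℕ) : Set₁ where
  field
    _~_      : Rel (Fin n) 0ℓ
    _~?_     : Decidable _~_
    ~-sym    : Symmetric _~_
    ~-irrefl : Irreflexive _≡_ _~_

module _ {n} (G : Graph n) where
  open Graph G

  adjacency : Matrix n
  adjacency a b = if does (a ~? b) then 1ᶜ else 0ᶜ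

  H : ℝ → Matrix n
  H t = exp ((-ᶜ (𝕚 *ᶜ fromℝ t)) •ᴹ adjacency)

  PrettyGoodStateTransfer : Fin n → Fin n → Set
  PrettyGoodStateTransfer u v =
    Σ[ t ∈ (ℕ → ℝ) ] Σ[ γ ∈ ℂ ]
      normSq γ ≈ᴿ 1ᴿ × ((λ j → H (t j) *ᵛ 𝐞 u) ⟶ᵛ γ •ᵛ 𝐞 v)

-- ℤₙ is represented by Fin n, with negation and subtraction modulo n.

infix  8 ⊖_
infixl 6 _⊖_

⊖_ : ∀ {n} → Fin n → Fin n
⊖_ {suc k} a = (suc k ℕ.∸ toℕ a) mod suc k

_⊖_ : ∀ {n} → Fin n → Fin n → Fin n
_⊖_ {suc k} a b = (toℕ a ℕ.+ (suc k ℕ.∸ toℕ b)) mod suc k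

-- { -s : s ∈ S } = S
NegationClosed : ∀ {n} → Subset n → Set
NegationClosed S = ∀ x → (∃[ s ] s ∈ S × x ≡ ⊖ s) ⇔ x ∈ S

⊖-self : ∀ {n} (a : Fin n) → toℕ (a ⊖ a) ≡ 0
⊖-self {suc k} a = trans (toℕ-fromℕ< (m%n<n (toℕ a ℕ.+ (suc k ℕ.∸ toℕ a)) (suc k)))
  (trans (cong (_% suc k) (ℕ.m+[n∸m]≡n (ℕ.<⇒≤ (toℕ<n a)))) (n%n≡0 (suc k)))

⊖-swap : ∀ {n} (a b : Fin n) → b ⊖ a ≡ ⊖ (a ⊖ b)
⊖-swap {suc k} a b = toℕ-injective (begin
  toℕ (b ⊖ a)                      ≡⟨ toℕ-fromℕ< (m%n<n X n) ⟩
  X % n                            ≡⟨ [m+n]%n≡m%n X n ⟨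
  (X ℕ.+ n) % n                    ≡⟨ cong (λ y → (X ℕ.+ y) % n) (ℕ.m+[n∸m]≡n r≤n) ⟨
  (X ℕ.+ (r ℕ.+ (n ℕ.∸ r))) % n    ≡⟨ cong (_% n) (ℕ.+-assoc X r (n ℕ.∸ r)) ⟨
  (X ℕ.+ r ℕ.+ (n ℕ.∸ r)) % n      ≡⟨ %-distribˡ-+ (X ℕ.+ r) (n ℕ.∸ r) n ⟩
  ((X ℕ.+ r) % n ℕ.+ (n ℕ.∸ r) % n) % n  ≡⟨ cong (λ y → (y ℕ.+ (n ℕ.∸ r) % n) % n) X+r≡0 ⟩
  (n ℕ.∸ r) % n % n                ≡⟨ m%n%n≡m%n (n ℕ.∸ r) n ⟩
  (n ℕ.∸ r) % n                    ≡⟨ cong (λ y → (n ℕ.∸ y) % n) (toℕ-fromℕ< (m%n<n Y n)) ⟨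
  (n ℕ.∸ toℕ (a ⊖ b)) % n          ≡⟨ toℕ-fromℕ< (m%n<n (n ℕ.∸ toℕ (a ⊖ b)) n) ⟨
  toℕ (⊖ (a ⊖ b))                  ∎)
  where
  open ≡-Reasoning
  n = suc k
  X = toℕ b ℕ.+ (n ℕ.∸ toℕ a)
  Y = toℕ a ℕ.+ (n ℕ.∸ toℕ b)
  r = Y % n
  r≤n : r ℕ.≤ n
  r≤n = m%n≤n Y n
  swap : ∀ a a′ b b′ → (b ℕ.+ a′) ℕ.+ (a ℕ.+ b′) ≡ (a ℕ.+ a′) ℕ.+ (b ℕ.+ b′)
  swap a a′ b b′ = begin
    (b ℕ.+ a′) ℕ.+ (a ℕ.+ b′)  ≡⟨ ℕ.+-comm (b ℕ.+ a′) (a ℕ.+ b′) ⟩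
    (a ℕ.+ b′) ℕ.+ (b ℕ.+ a′)  ≡⟨ cong ((a ℕ.+ b′) ℕ.+_) (ℕ.+-comm b a′) ⟩
    (a ℕ.+ b′) ℕ.+ (a′ ℕ.+ b)  ≡⟨ ℕ.+-assoc a b′ (a′ ℕ.+ b) ⟩
    a ℕ.+ (b′ ℕ.+ (a′ ℕ.+ b))  ≡⟨ cong (a ℕ.+_) (ℕ.+-comm b′ (a′ ℕ.+ b)) ⟩
    a ℕ.+ (a′ ℕ.+ b ℕ.+ b′)    ≡⟨ cong (a ℕ.+_) (ℕ.+-assoc a′ b b′) ⟩
    a ℕ.+ (a′ ℕ.+ (b ℕ.+ b′))  ≡⟨ ℕ.+-assoc a a′ (b ℕ.+ b′) ⟨
    (a ℕ.+ a′) ℕ.+ (b ℕ.+ b′)  ∎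
  X+r≡0 : (X ℕ.+ r) % n ≡ 0
  X+r≡0 = begin
    (X ℕ.+ r) % n              ≡⟨ %-distribˡ-+ X r n ⟩
    (X % n ℕ.+ r % n) % n      ≡⟨ cong (λ y → (X % n ℕ.+ y) % n) (m%n%n≡m%n Y n) ⟩
    (X % n ℕ.+ Y % n) % n      ≡⟨ %-distribˡ-+ X Y n ⟨
    (X ℕ.+ Y) % n              ≡⟨ cong (_% n) (swap (toℕ a) (n ℕ.∸ toℕ a) (toℕ b) (n ℕ.∸ toℕ b)) ⟩
    ((toℕ a ℕ.+ (n ℕ.∸ toℕ a)) ℕ.+ (toℕ b ℕ.+ (n ℕ.∸ toℕ b))) % n
                               ≡⟨ cong₂ (λ y z → (y ℕ.+ z) % n) (ℕ.m+[n∸m]≡n (ℕ.<⇒≤ (toℕ<n a))) (ℕ.m+[n∸m]≡n (ℕ.<⇒≤ (toℕ<n b))) ⟩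
    (n ℕ.+ n) % n              ≡⟨ [m+n]%n≡m%n n n ⟩
    n % n                      ≡⟨ n%n≡0 n ⟩
    0                          ∎

Cay : ∀ {n} (S : Subset n) → (∀ {s} → s ∈ S → toℕ s ≢ 0) → NegationClosed S → Graph n
Cay S 0∉S -S=S = record
  { _~_      = λ a b → a ⊖ b ∈ S
  ; _~?_     = λ a b → a ⊖ b ∈? S
  ; ~-sym    = λ {a} {b} ab → Equivalence.to (-S=S (b ⊖ a)) (a ⊖ b , ab , ⊖-swap a b)
  ; ~-irrefl = λ { {a} refl aa → 0∉S aa (⊖-self a) }
  }

{-# OPTIONS --safe #-}
-- Let A be the adjacency matrix and T the translation operators of ℤₙ. Twist
-- A by the characters of the quotient ℤₚ: A_k = Σ_{s ∈ S} ζ^{ks} T^s, with ζ a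
-- primitive p-th root of unity. As p ∤ s for all s ∈ S, Σ_k A_k = 0, so the
-- product over k < p of the twisted matrices exp(-itA_k) is the identity. If
-- exp(-itA) 𝐞ᵤ is close to γ 𝐞ᵥ, then exp(-itA) is close to γ T^{v-u} and the
-- product is close to γᵖ ζ^{(v-u)p(p-1)/2} T^{p(v-u)} = γᵖ T^{p(v-u)}, as p is
-- odd; hence p(v - u) = 0 in ℤₙ. Since A is symmetric, also
-- T^{v-u} = T^{u-v}, so 2(v - u) = 0, and u = v.
--
-- At a fixed index of the Cauchy sequences and a fixed truncation of the
-- exponential series this is an approximate identity over ℚ(i), where ζ is
-- replaced by a translation of ℤₚ acting on functions with vanishing coset
-- sums.
module Submission where

open import Defs
open import Algebra.Bundles using (CommutativeSemiring; CommutativeRing)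
open import Algebra.Structures using (IsCommutativeSemiring)
open import Algebra.Structures.Biased using (isCommutativeSemiringˡ)
open import Data.Bool using (if_then_else_; true; false)
open import Data.Fin as Fin using (Fin; toℕ)
open import Data.Fin.Properties using (toℕ<n; toℕ-injective; toℕ-fromℕ<)
open import Data.Fin.Subset using (Subset; _∈_)
open import Data.Fin.Subset.Properties using (_∈?_)
import Data.Integer as ℤ
import Data.Integer.Properties as ℤ
open import Data.Nat as ℕ using (ℕ; zero; suc; NonZero)
open import Data.Nat.Coprimality using (Coprime; coprime-Bézout)
open import Data.Nat.Divisibility using (_∣_; _∣?_; divides; ∣m+n∣m⇒∣n; ∣m∣n⇒∣m+n; ∣n⇒∣m*n; n∣m*n; ∣-refl; _∣0; ∣1⇒≡1; %-presˡ-∣; m%n≡0⇒n∣m)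
open import Data.Nat.DivMod using (_%_; _/_; _mod_; [m+n]%n≡m%n; [m+kn]%n≡m%n; m<n⇒m%n≡m; m%n<n; m≡m%n+[m/n]*n)
open import Data.Nat.GCD using (module Bézout)
open import Data.Nat.Primality using (Prime; prime⇒irreducible)
import Data.Nat.Properties as ℕ
import Data.Nat.Tactic.RingSolver as ℕ-Solver
open import Data.Product using (_×_; _,_; proj₁; proj₂; ∃-syntax)
open import Data.Rational as ℚ using (ℚ; 0ℚ; 1ℚ; ½)
import Data.Rational.Properties as ℚ
import Data.Rational.Solver as ℚ-Solver
import Data.Rational.Unnormalised as ℚᵘ
import Data.Rational.Unnormalised.Properties as ℚᵘ
open import Data.Sum using (_⊎_; inj₁; inj₂)
open import Data.Vec.Functional using (Vector; foldr; head; tail)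
open import Function using (_∘_; mk⇔; Equivalence)
open import Level using (0ℓ)
open import Relation.Binary using (IsEquivalence)
open import Relation.Binary.PropositionalEquality as ≡ using (_≡_; _≢_)
open import Relation.Nullary using (¬_; does; yes; no; contradiction)
open import Relation.Nullary.Decidable using (dec-true; dec-false; decidable-stable; does-⇔)

-- The obstacle is that the times `t j` may be unbounded, so no single truncation of the exponential
-- series serves all of them. This fixes the order of the choices: the tolerance ε depends only on
-- n, p and a bound for γ; then one j within ε is taken, which yields a bound T for its time; then
-- the truncation N, large in terms of T; and last the index of the Cauchy sequences. Truncated
-- exponentials are multiplicative up to terms of total degree at least N, and comparison with the
-- series at the doubled argument bounds those by a constant times 2 to the power -N.
--
-- All matrices involved are polynomials in commuting translations, so the computation runs in a
-- commutative semiring of operators, with errors kept as extra summands on either side of an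
-- equation. An equation becomes numerical by applying it to one function, a point mass on ℤₙ times
-- a difference of two point masses on ℤₚ, and evaluating at one point: the translation that lands
-- on 0 contributes minus its coefficient, the other one zero. Divisibility being decidable, it is
-- enough to refute its negation by the resulting inequality.

-- Finite sums, Cauchy products and truncated exponentials

module Series (R : CommutativeSemiring 0ℓ 0ℓ) where
  open CommutativeSemiring R
  open import Relation.Binary.Reasoning.Setoid setoid
  open import Algebra.Solver.Ring.NaturalCoefficients.Default R using (solve; _:=_; _:+_; _:*_)

  Σ< Π< : ℕ → (ℕ → Carrier) → Carrier
  Σ< zero    f = 0#
  Σ< (suc N) f = Σ< N f + f N
  Π< zero    f = 1#
  Π< (suc N) f = Π< N f * f N

  Σ<-cong : ∀ N {f g} → (∀ i → i ℕ.< N → f i ≈ g i) → Σ< N f ≈ Σ< N g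
  Σ<-cong zero    f≈g = refl
  Σ<-cong (suc N) f≈g = +-cong (Σ<-cong N λ i i<N → f≈g i (ℕ.m≤n⇒m≤1+n i<N)) (f≈g N ℕ.≤-refl)

  Π<-cong : ∀ N {f g} → (∀ i → f i ≈ g i) → Π< N f ≈ Π< N g
  Π<-cong zero    f≈g = refl
  Π<-cong (suc N) f≈g = *-cong (Π<-cong N f≈g) (f≈g N)

  Σ<-zero : ∀ N {f} → (∀ i → i ℕ.< N → f i ≈ 0#) → Σ< N f ≈ 0#
  Σ<-zero zero    f≈0 = refl
  Σ<-zero (suc N) f≈0 =
    trans (+-cong (Σ<-zero N λ i i<N → f≈0 i (ℕ.m≤n⇒m≤1+n i<N)) (f≈0 N ℕ.≤-refl)) (+-identityˡ 0#)

  Σ<-front : ∀ N f → Σ< (suc N) f ≈ f 0 + Σ< N (f ∘ suc)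
  Σ<-front zero    f = +-comm 0# (f 0)
  Σ<-front (suc N) f = trans (+-congʳ (Σ<-front N f)) (+-assoc _ _ _)

  Σ<-+ : ∀ N f g → Σ< N (λ i → f i + g i) ≈ Σ< N f + Σ< N g
  Σ<-+ zero    f g = sym (+-identityˡ 0#)
  Σ<-+ (suc N) f g = trans (+-congʳ (Σ<-+ N f g))
    (solve 4 (λ a b c d → (a :+ b) :+ (c :+ d) := (a :+ c) :+ (b :+ d)) refl (Σ< N f) (Σ< N g) (f N) (g N))

  *-Σ< : ∀ N x f → x * Σ< N f ≈ Σ< N (λ i → x * f i)
  *-Σ< zero    x f = zeroʳ x
  *-Σ< (suc N) x f = trans (distribˡ x _ _) (+-congʳ (*-Σ< N x f))

  Π<-* : ∀ N f g → Π< N (λ i → f i * g i) ≈ Π< N f * Π< N g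
  Π<-* zero    f g = sym (*-identityˡ 1#)
  Π<-* (suc N) f g = trans (*-congʳ (Π<-* N f g))
    (solve 4 (λ a b c d → (a :* b) :* (c :* d) := (a :* c) :* (b :* d)) refl (Π< N f) (Π< N g) (f N) (g N))

  Σ<-comm : ∀ M N (f : ℕ → ℕ → Carrier) →
            Σ< M (λ i → Σ< N (f i)) ≈ Σ< N (λ j → Σ< M (λ i → f i j))
  Σ<-comm zero    N f = sym (Σ<-zero N λ _ _ → refl)
  Σ<-comm (suc M) N f = trans (+-congʳ (Σ<-comm M N f)) (sym (Σ<-+ N _ (f M)))

  Σ<-split : ∀ d {N K} g → d ℕ.+ N ≡ K → Σ< K g ≈ Σ< N g + Σ< d (λ i → g (i ℕ.+ N))
  Σ<-split zero    g ≡.refl = sym (+-identityʳ _)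
  Σ<-split (suc d) g ≡.refl = trans (+-congʳ (Σ<-split d g ≡.refl)) (+-assoc _ _ _)

  Σ<-rotate₁ : ∀ n f → f n ≈ f 0 → Σ< n (f ∘ suc) ≈ Σ< n f
  Σ<-rotate₁ zero    f _   = refl
  Σ<-rotate₁ (suc n) f fn≈ = begin
    Σ< n (f ∘ suc) + f (suc n)  ≈⟨ +-congˡ fn≈ ⟩
    Σ< n (f ∘ suc) + f 0        ≈⟨ +-comm _ _ ⟩
    f 0 + Σ< n (f ∘ suc)        ≈⟨ Σ<-front n f ⟨
    Σ< (suc n) f                ∎

  Σ<-rotate : ∀ n d f → (∀ i → f (i ℕ.+ n) ≈ f i) → Σ< n (λ i → f (i ℕ.+ d)) ≈ Σ< n f
  Σ<-rotate n zero    f f-per = Σ<-cong n λ i _ → reflexive (≡.cong f (ℕ.+-identityʳ i))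
  Σ<-rotate n (suc d) f f-per = begin
    Σ< n (λ i → f (i ℕ.+ suc d))  ≈⟨ Σ<-cong n (λ i _ → reflexive (≡.cong f (ℕ.+-suc i d))) ⟩
    Σ< n (λ i → f (suc i ℕ.+ d))  ≈⟨ Σ<-rotate₁ n (λ i → f (i ℕ.+ d))
                                     (trans (reflexive (≡.cong f (ℕ.+-comm n d))) (f-per d)) ⟩
    Σ< n (λ i → f (i ℕ.+ d))      ≈⟨ Σ<-rotate n d f f-per ⟩
    Σ< n f                        ∎

  Σ<-reverse : ∀ n f → Σ< n (λ i → f (n ℕ.∸ suc i)) ≈ Σ< n f
  Σ<-reverse zero    f = refl
  Σ<-reverse (suc n) f = begin
    Σ< (suc n) (λ i → f (n ℕ.∸ i))       ≈⟨ Σ<-front n (λ i → f (n ℕ.∸ i)) ⟩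
    f n + Σ< n (λ i → f (n ℕ.∸ suc i))   ≈⟨ +-congˡ (Σ<-reverse n f) ⟩
    f n + Σ< n f                         ≈⟨ +-comm _ _ ⟩
    Σ< (suc n) f                         ∎

  Σ<-negate : ∀ n f → f n ≈ f 0 → Σ< n (λ i → f (n ℕ.∸ i)) ≈ Σ< n f
  Σ<-negate n f fn≈ = begin
    Σ< n (λ i → f (n ℕ.∸ i))            ≈⟨ Σ<-cong n (λ i i<n → reflexive (≡.cong f (ℕ.+-∸-assoc 1 i<n))) ⟩
    Σ< n (λ i → f (suc (n ℕ.∸ suc i)))  ≈⟨ Σ<-reverse n (f ∘ suc) ⟩
    Σ< n (f ∘ suc)                      ≈⟨ Σ<-rotate₁ n f fn≈ ⟩
    Σ< n f                              ∎

  -- The degree `j` coefficient of the Cauchy product of two power series.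
  conv : ℕ → (ℕ → Carrier) → (ℕ → Carrier) → Carrier
  conv zero    f g = f 0 * g 0
  conv (suc j) f g = f 0 * g (suc j) + conv j (f ∘ suc) g

  conv-cong : ∀ j {f f′ g g′} → (∀ i → f i ≈ f′ i) → (∀ i → g i ≈ g′ i) → conv j f g ≈ conv j f′ g′
  conv-cong zero    f≈ g≈ = *-cong (f≈ 0) (g≈ 0)
  conv-cong (suc j) f≈ g≈ = +-cong (*-cong (f≈ 0) (g≈ (suc j))) (conv-cong j (f≈ ∘ suc) g≈)

  conv-last : ∀ j f g → conv (suc j) f g ≈ conv j f (g ∘ suc) + f (suc j) * g 0
  conv-last zero    f g = refl
  conv-last (suc j) f g = trans (+-congˡ (conv-last j (f ∘ suc) g)) (sym (+-assoc _ _ _))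

  *-conv : ∀ j r f g → conv j (λ i → r * f i) g ≈ r * conv j f g
  *-conv zero    r f g = *-assoc _ _ _
  *-conv (suc j) r f g = trans (+-cong (*-assoc _ _ _) (*-conv j r (f ∘ suc) g)) (sym (distribˡ r _ _))

  conv-* : ∀ j r f g → conv j f (λ i → r * g i) ≈ r * conv j f g
  conv-* zero    r f g = solve 3 (λ r a b → a :* (r :* b) := r :* (a :* b)) refl r (f 0) (g 0)
  conv-* (suc j) r f g = trans
    (+-cong (solve 3 (λ r a b → a :* (r :* b) := r :* (a :* b)) refl r (f 0) (g (suc j)))
            (conv-* j r (f ∘ suc) g))
    (sym (distribˡ r _ _))

  -- The products f i * g k with i + k < N, taken row by row; `triangle≈Σconv` regroups them by
  -- antidiagonals.
  triangle : ℕ → (ℕ → Carrier) → (ℕ → Carrier) → Carrier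
  triangle zero    f g = 0#
  triangle (suc N) f g = f 0 * Σ< (suc N) g + triangle N (f ∘ suc) g

  triangle≈Σconv : ∀ N f g → triangle N f g ≈ Σ< N (λ j → conv j f g)
  triangle≈Σconv zero    f g = refl
  triangle≈Σconv (suc N) f g = begin
    f 0 * Σ< (suc N) g + triangle N (f ∘ suc) g
      ≈⟨ +-cong (*-congˡ (Σ<-front N g)) (triangle≈Σconv N (f ∘ suc) g) ⟩
    f 0 * (g 0 + Σ< N (g ∘ suc)) + Σ< N (λ j → conv j (f ∘ suc) g)
      ≈⟨ solve 4 (λ a b c d → a :* (b :+ c) :+ d := a :* b :+ (a :* c :+ d)) refl _ _ _ _ ⟩
    f 0 * g 0 + (f 0 * Σ< N (g ∘ suc) + Σ< N (λ j → conv j (f ∘ suc) g))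
      ≈⟨ +-congˡ (+-congʳ (*-Σ< N (f 0) (g ∘ suc))) ⟩
    f 0 * g 0 + (Σ< N (λ j → f 0 * g (suc j)) + Σ< N (λ j → conv j (f ∘ suc) g))
      ≈⟨ +-congˡ (Σ<-+ N _ _) ⟨
    f 0 * g 0 + Σ< N (λ j → conv (suc j) f g)
      ≈⟨ Σ<-front N (λ j → conv j f g) ⟨
    Σ< (suc N) (λ j → conv j f g) ∎

  -- The part of the rectangle i < N, k < d + N that lies outside the triangle i + k < N.
  corner : ℕ → ℕ → (ℕ → Carrier) → (ℕ → Carrier) → Carrier
  corner zero    d f g = 0#
  corner (suc N) d f g = f 0 * Σ< d (λ i → g (i ℕ.+ suc N)) + corner N (suc d) (f ∘ suc) g

  -- The first row splits into its part inside the triangle and the `d` entries beyond it. In the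
  -- remaining rows the triangle is one column narrower while the width `K` stays, so `d` grows in
  -- the induction.
  rectangle : ∀ N d {K} f g → d ℕ.+ N ≡ K → Σ< N f * Σ< K g ≈ triangle N f g + corner N d f g
  rectangle zero    d f g _ = trans (zeroˡ _) (sym (+-identityˡ 0#))
  rectangle (suc N) d {K} f g e = begin
    Σ< (suc N) f * Σ< K g
      ≈⟨ *-congʳ (Σ<-front N f) ⟩
    (f 0 + Σ< N (f ∘ suc)) * Σ< K g
      ≈⟨ distribʳ _ _ _ ⟩
    f 0 * Σ< K g + Σ< N (f ∘ suc) * Σ< K g
      ≈⟨ +-cong (*-congˡ (Σ<-split d g e)) (rectangle N (suc d) (f ∘ suc) g (≡.trans (≡.sym (ℕ.+-suc d N)) e)) ⟩
    f 0 * (Σ< (suc N) g + Σ< d (λ i → g (i ℕ.+ suc N))) + (triangle N (f ∘ suc) g + corner N (suc d) (f ∘ suc) g)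
      ≈⟨ solve 5 (λ a b c d e → a :* (b :+ c) :+ (d :+ e) := (a :* b :+ d) :+ (a :* c :+ e)) refl _ _ _ _ _ ⟩
    triangle (suc N) f g + corner (suc N) d f g ∎

  natural : ℕ → Carrier
  natural k = Σ< k (λ _ → 1#)

  natural-+ : ∀ k l → natural (k ℕ.+ l) ≈ natural k + natural l
  natural-+ zero    l = sym (+-identityˡ _)
  natural-+ (suc k) l = trans (+-congʳ (natural-+ k l))
    (solve 3 (λ a b c → (a :+ b) :+ c := (a :+ c) :+ b) refl (natural k) (natural l) 1#)

  -- The Leibniz rule for the derivation that multiplies each coefficient by its degree. The offset
  -- `a` grows in the induction because unfolding `conv` passes to `f ∘ suc`, whose indices lag by
  -- one.
  conv-weights : ∀ j a b f g →
    conv j (λ i → natural (i ℕ.+ a) * f i) g + conv j f (λ i → natural (i ℕ.+ b) * g i)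
    ≈ natural (j ℕ.+ (a ℕ.+ b)) * conv j f g
  conv-weights zero a b f g = begin
    (natural a * f 0) * g 0 + f 0 * (natural b * g 0)
      ≈⟨ solve 4 (λ a b f g → (a :* f) :* g :+ f :* (b :* g) := (a :+ b) :* (f :* g)) refl _ _ _ _ ⟩
    (natural a + natural b) * (f 0 * g 0)
      ≈⟨ *-congʳ (natural-+ a b) ⟨
    natural (a ℕ.+ b) * (f 0 * g 0) ∎
  conv-weights (suc j) a b f g = begin
    ((natural a * f 0) * g (suc j) + conv j (λ i → natural (suc i ℕ.+ a) * f (suc i)) g)
      + (f 0 * (natural (suc j ℕ.+ b) * g (suc j)) + conv j (f ∘ suc) (λ i → natural (i ℕ.+ b) * g i))
      ≈⟨ +-congʳ (+-congˡ (conv-cong j (λ i → *-congʳ (reflexive (≡.cong natural (≡.sym (ℕ.+-suc i a))))) (λ _ → refl))) ⟩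
    ((natural a * f 0) * g (suc j) + conv j (λ i → natural (i ℕ.+ suc a) * f (suc i)) g)
      + (f 0 * (natural (suc j ℕ.+ b) * g (suc j)) + conv j (f ∘ suc) (λ i → natural (i ℕ.+ b) * g i))
      ≈⟨ solve 6 (λ na nb f g x y → ((na :* f) :* g :+ x) :+ (f :* (nb :* g) :+ y) := (na :+ nb) :* (f :* g) :+ (x :+ y)) refl _ _ _ _ _ _ ⟩
    (natural a + natural (suc j ℕ.+ b)) * (f 0 * g (suc j))
      + (conv j (λ i → natural (i ℕ.+ suc a) * f (suc i)) g + conv j (f ∘ suc) (λ i → natural (i ℕ.+ b) * g i))
      ≈⟨ +-cong (*-congʳ (sym (trans (reflexive (≡.cong natural swap)) (natural-+ a (suc j ℕ.+ b)))))
                (trans (conv-weights j (suc a) b (f ∘ suc) g) (*-congʳ (reflexive (≡.cong natural (ℕ.+-suc j (a ℕ.+ b)))))) ⟩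
    natural (suc j ℕ.+ (a ℕ.+ b)) * (f 0 * g (suc j)) + natural (suc j ℕ.+ (a ℕ.+ b)) * conv j (f ∘ suc) g
      ≈⟨ distribˡ _ _ _ ⟨
    natural (suc j ℕ.+ (a ℕ.+ b)) * conv (suc j) f g ∎
    where
    swap : suc j ℕ.+ (a ℕ.+ b) ≡ a ℕ.+ (suc j ℕ.+ b)
    swap = ≡.trans (≡.sym (ℕ.+-assoc (suc j) a b))
      (≡.trans (≡.cong (ℕ._+ b) (ℕ.+-comm (suc j) a)) (ℕ.+-assoc a (suc j) b))

  module Exponential (recip : ℕ → Carrier) (recip-inverse : ∀ k → recip k * natural (suc k) ≈ 1#) where

    term : Carrier → ℕ → Carrier
    term r zero    = 1#
    term r (suc k) = recip k * (r * term r k)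

    term-cong : ∀ {r s} → r ≈ s → ∀ k → term r k ≈ term s k
    term-cong r≈s zero    = refl
    term-cong r≈s (suc k) = *-congˡ (*-cong r≈s (term-cong r≈s k))

    term-step : ∀ r k → natural (suc k) * term r (suc k) ≈ r * term r k
    term-step r k = begin
      natural (suc k) * (recip k * (r * term r k))  ≈⟨ solve 3 (λ a b c → a :* (b :* c) := (b :* a) :* c) refl _ _ _ ⟩
      (recip k * natural (suc k)) * (r * term r k)  ≈⟨ *-congʳ (recip-inverse k) ⟩
      1# * (r * term r k)                           ≈⟨ *-identityˡ _ ⟩
      r * term r k                                  ∎

    -- The equation y' = r y with y(0) = 1 determines every coefficient, since each k + 1 is
    -- invertible.
    term-unique : ∀ r (f : ℕ → Carrier) → f 0 ≈ 1# → (∀ k → natural (suc k) * f (suc k) ≈ r * f k) → ∀ k → f k ≈ term r k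
    term-unique r f f0 step zero    = f0
    term-unique r f f0 step (suc k) = begin
      f (suc k)                                ≈⟨ *-identityˡ _ ⟨
      1# * f (suc k)                           ≈⟨ *-congʳ (recip-inverse k) ⟨
      (recip k * natural (suc k)) * f (suc k)  ≈⟨ *-assoc _ _ _ ⟩
      recip k * (natural (suc k) * f (suc k))  ≈⟨ *-congˡ (step k) ⟩
      recip k * (r * f k)                      ≈⟨ *-congˡ (*-congˡ (term-unique r f f0 step k)) ⟩
      term r (suc k)                           ∎

    -- By the Leibniz rule the product of the two exponential series solves y' = (r + s) y.
    conv-term : ∀ r s k → conv k (term r) (term s) ≈ term (r + s) k
    conv-term r s = term-unique (r + s) (λ k → conv k (term r) (term s)) (*-identityˡ 1#) step
      where
      f = term r
      g = term s
      weight : (ℕ → Carrier) → ℕ → Carrier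
      weight h i = natural (i ℕ.+ 0) * h i
      derivative : ∀ q i → natural (suc i ℕ.+ 0) * term q (suc i) ≈ q * term q i
      derivative q i = trans (*-congʳ (reflexive (≡.cong natural (ℕ.+-identityʳ (suc i))))) (term-step q i)
      step : ∀ k → natural (suc k) * conv (suc k) f g ≈ (r + s) * conv k f g
      step k = begin
        natural (suc k) * conv (suc k) f g
          ≈⟨ *-congʳ (reflexive (≡.cong natural (ℕ.+-identityʳ (suc k)))) ⟨
        natural (suc k ℕ.+ 0) * conv (suc k) f g
          ≈⟨ conv-weights (suc k) 0 0 f g ⟨
        conv (suc k) (weight f) g + conv (suc k) f (weight g)
          -- The weight at degree 0 is 0, so one boundary term of each convolution drops out and the
          -- rest shifts by one degree.
          ≈⟨ +-cong
               (trans (+-congʳ (trans (*-congʳ (zeroˡ _)) (zeroˡ _))) (+-identityˡ _))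
               (trans (conv-last k f (weight g)) (trans (+-congˡ (trans (*-congˡ (zeroˡ _)) (zeroʳ _))) (+-identityʳ _))) ⟩
        conv k (weight f ∘ suc) g + conv k f (weight g ∘ suc)
          ≈⟨ +-cong (conv-cong k (derivative r) (λ _ → refl)) (conv-cong k (λ _ → refl) (derivative s)) ⟩
        conv k (λ i → r * f i) g + conv k f (λ i → s * g i)
          ≈⟨ +-cong (*-conv k r f g) (conv-* k s f g) ⟩
        r * conv k f g + s * conv k f g
          ≈⟨ distribʳ _ r s ⟨
        (r + s) * conv k f g ∎

    expSum : ℕ → Carrier → Carrier
    expSum N r = Σ< N (term r)

    expSum-cong : ∀ N {r s} → r ≈ s → expSum N r ≈ expSum N s
    expSum-cong N r≈s = Σ<-cong N (λ k _ → term-cong r≈s k)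

    expSum-0 : ∀ N → expSum (suc N) 0# ≈ 1#
    expSum-0 N = trans (Σ<-front N (term 0#)) (trans
      (+-congˡ (Σ<-zero N λ k _ → trans (*-congˡ (zeroˡ _)) (zeroʳ _))) (+-identityʳ 1#))

    expSum-* : ∀ N r s → expSum N r * expSum N s ≈ expSum N (r + s) + corner N 0 (term r) (term s)
    expSum-* N r s = trans (rectangle N 0 (term r) (term s) ≡.refl)
      (+-congʳ (trans (triangle≈Σconv N (term r) (term s)) (Σ<-cong N λ k _ → conv-term r s k)))

-- Rational estimates for the exponential majorant

module RationalSums where
  open import Data.Rational using (_+_; _*_; _≤_; _<_)
  open ℚ-Solver.+-*-Solver using (solve; _:=_; _:+_; _:*_; con)

  private module ℚΣ = Series (CommutativeRing.commutativeSemiring ℚ.+-*-commutativeRing)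

  ∑ℚ : ℕ → (ℕ → ℚ) → ℚ
  ∑ℚ = ℚΣ.Σ<

  ∑ℚ-front : ∀ N f → ∑ℚ (suc N) f ≡ f 0 + ∑ℚ N (f ∘ suc)
  ∑ℚ-front = ℚΣ.Σ<-front

  *-∑ℚ : ∀ N x f → x * ∑ℚ N f ≡ ∑ℚ N (λ i → x * f i)
  *-∑ℚ = ℚΣ.*-Σ<

  ∑ℚ-mono : ∀ N {f g} → (∀ i → f i ≤ g i) → ∑ℚ N f ≤ ∑ℚ N g
  ∑ℚ-mono zero    f≤g = ℚ.≤-refl
  ∑ℚ-mono (suc N) f≤g = ℚ.+-mono-≤ (∑ℚ-mono N f≤g) (f≤g N)

  ∑ℚ-nonNeg : ∀ N {f} → (∀ i → 0ℚ ≤ f i) → 0ℚ ≤ ∑ℚ N f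
  ∑ℚ-nonNeg zero    0≤f = ℚ.≤-refl
  ∑ℚ-nonNeg (suc N) 0≤f = ℚ.+-mono-≤ (∑ℚ-nonNeg N 0≤f) (0≤f N)

  ∑ℚ-tail : ∀ d {N K} f → (∀ i → 0ℚ ≤ f i) → d ℕ.+ N ≡ K → ∑ℚ d (λ i → f (i ℕ.+ N)) ≤ ∑ℚ K f
  ∑ℚ-tail d {N} f 0≤f e = ≡.subst (∑ℚ d (λ i → f (i ℕ.+ N)) ≤_) (≡.sym (ℚΣ.Σ<-split d f e))
    (≤-+ˡ ℚ.≤-refl (∑ℚ-nonNeg N 0≤f))

  pow½-nonNeg : ∀ k → 0ℚ ≤ pow ½ k
  pow½-nonNeg k = ℚ.<⇒≤ (pow-pos 0<½ k)

  pow-nonNeg : ∀ {c} → 0ℚ ≤ c → ∀ k → 0ℚ ≤ pow c k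
  pow-nonNeg 0≤c zero    = ℚ.<⇒≤ 0<1
  pow-nonNeg 0≤c (suc k) = *-nonNeg 0≤c (pow-nonNeg 0≤c k)

  pow½-+ : ∀ i N → pow ½ (i ℕ.+ N) ≤ pow ½ N
  pow½-+ zero    N = ℚ.≤-refl
  pow½-+ (suc i) N = ℚ.≤-trans
    (≡.subst (½ * pow ½ (i ℕ.+ N) ≤_) (half+half (pow ½ (i ℕ.+ N)))
      (≤-+ʳ ℚ.≤-refl (*-nonNeg (ℚ.<⇒≤ 0<½) (pow½-nonNeg (i ℕ.+ N)))))
    (pow½-+ i N)

  -- Doubling the argument releases a geometric factor while leaving a series with bounded sums; the
  -- factor is what makes truncation errors small.
  majorant-double : ∀ c k → majorant c k ≡ pow ½ k * majorant (c + c) k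
  majorant-double c zero    = ≡.refl
  majorant-double c (suc k) = begin
    majorant c (suc k)
      ≡⟨ majorant-suc c k ⟩
    (c * inv k) * majorant c k
      ≡⟨ ≡.cong ((c * inv k) *_) (majorant-double c k) ⟩
    (c * inv k) * (pow ½ k * majorant (c + c) k)
      ≡⟨ solve 4 (λ c v h m → (c :* v) :* (h :* m) := (con ½ :* h) :* (((c :+ c) :* v) :* m)) ≡.refl c (inv k) (pow ½ k) (majorant (c + c) k) ⟩
    pow ½ (suc k) * (((c + c) * inv k) * majorant (c + c) k)
      ≡⟨ ≡.cong (pow ½ (suc k) *_) (majorant-suc (c + c) k) ⟨
    pow ½ (suc k) * majorant (c + c) (suc k) ∎
    where open ≡.≡-Reasoning

  module MajorantSum {c} (0<c : 0ℚ < c) (K : ℕ) (K-large : ∀ k → K ℕ.≤ k → c * inv k < ½) where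
    μ-nonNeg : ∀ k → 0ℚ ≤ majorant c k
    μ-nonNeg = majorant-nonNeg 0<c

    S 2μ : ℕ → ℚ
    S N = ∑ℚ N (majorant c)
    2μ k = majorant c k + majorant c k

    2μ-nonNeg : ∀ k → 0ℚ ≤ 2μ k
    2μ-nonNeg k = ℚ.+-mono-≤ (μ-nonNeg k) (μ-nonNeg k)

    -- Beyond `K` each term is at most half its predecessor, so the partial sum plus twice the next
    -- term never increases.
    S+2μ-decr : ∀ d → S (d ℕ.+ K) + 2μ (d ℕ.+ K) ≤ S K + 2μ K
    S+2μ-decr zero    = ℚ.≤-refl
    S+2μ-decr (suc d) = ℚ.≤-trans
      (ℚ.+-monoʳ-≤ (S (suc d ℕ.+ K))
        (Majorised.halving 0<c (majorant c) μ-nonNeg (majorant-suc c) K K-large (d ℕ.+ K) (ℕ.m≤n+m K d)))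
      (≡.subst (_≤ S K + 2μ K) (≡.sym (ℚ.+-assoc (S (d ℕ.+ K)) (majorant c (d ℕ.+ K)) (majorant c (d ℕ.+ K)))) (S+2μ-decr d))

    S-bounded : ∀ N → S N ≤ S K + 2μ K
    S-bounded N with ℕ.≤-total K N
    ... | inj₁ K≤N = ≡.subst (λ N → S N ≤ S K + 2μ K) (ℕ.m∸n+n≡m K≤N)
      (ℚ.≤-trans (≤-+ʳ ℚ.≤-refl (2μ-nonNeg (N ℕ.∸ K ℕ.+ K))) (S+2μ-decr (N ℕ.∸ K)))
    ... | inj₂ N≤K = ≤-+ʳ
      (≡.subst (S N ≤_) (≡.sym (ℚΣ.Σ<-split (K ℕ.∸ N) (majorant c) (ℕ.m∸n+n≡m N≤K)))
        (≤-+ʳ ℚ.≤-refl (∑ℚ-nonNeg (K ℕ.∸ N) (λ i → μ-nonNeg (i ℕ.+ N)))))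
      (2μ-nonNeg K)

  majorant-sum-bounded : ∀ {c} → 0ℚ < c → ∃[ C ] 0ℚ ≤ C × (∀ N → ∑ℚ N (majorant c) ≤ C)
  majorant-sum-bounded {c} 0<c =
    let K , K-large = archimedean 0<c 0<½
        open MajorantSum 0<c K K-large
    in S K + 2μ K , ℚ.+-mono-≤ (∑ℚ-nonNeg K μ-nonNeg) (2μ-nonNeg K) , S-bounded

-- Norm bounds for perturbed products and for products of truncated exponentials

-- A relation "norm at most c" in place of a norm function: the operator norm to which it is applied
-- is a supremum, of which only rational upper bounds are used.
record Norm (R : CommutativeSemiring 0ℓ 0ℓ) : Set₁ where
  open CommutativeSemiring R
  infix 4 _≼_
  field
    _≼_      : Carrier → ℚ → Set
    ≼-weaken : ∀ {r c d} → c ℚ.≤ d → r ≼ c → r ≼ d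
    0≼0      : 0# ≼ 0ℚ
    1≼1      : 1# ≼ 1ℚ
    +-≼      : ∀ {r s c d} → r ≼ c → s ≼ d → r + s ≼ c ℚ.+ d
    *-≼      : ∀ {r s c d} → r ≼ c → s ≼ d → r * s ≼ c ℚ.* d

module NormedSeries (R : CommutativeSemiring 0ℓ 0ℓ) (norm : Norm R) where
  open CommutativeSemiring R
  open Norm norm
  open Series R
  open RationalSums
  open import Relation.Binary.Reasoning.Setoid setoid
  open import Algebra.Solver.Ring.NaturalCoefficients.Default R using (solve; _:=_; _:+_; _:*_)
  private
    module ℚS = ℚ-Solver.+-*-Solver

  ≼-resp : ∀ {r c d} → c ≡ d → r ≼ c → r ≼ d
  ≼-resp c≡d = ≼-weaken (ℚ.≤-reflexive c≡d)

  Σ<-≼ : ∀ N {f α} → (∀ i → f i ≼ α i) → Σ< N f ≼ ∑ℚ N α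
  Σ<-≼ zero    f≼α = 0≼0
  Σ<-≼ (suc N) f≼α = +-≼ (Σ<-≼ N f≼α) (f≼α N)

  Π<-≼ : ∀ N {f c} → (∀ i → f i ≼ c) → Π< N f ≼ pow c N
  Π<-≼ zero    f≼c = 1≼1
  Π<-≼ (suc N) {c = c} f≼c = ≼-resp (ℚ.*-comm (pow c N) c) (*-≼ (Π<-≼ N f≼c) (f≼c N))

  -- Every product in the corner has total degree at least `N`, so the two geometric factors
  -- together contribute at most 2 to the power -N.
  corner-≼ : ∀ N d {K} {f g α β} → (∀ i → 0ℚ ℚ.≤ α i) → (∀ i → 0ℚ ℚ.≤ β i) →
             (∀ i → f i ≼ pow ½ i ℚ.* α i) → (∀ i → g i ≼ pow ½ i ℚ.* β i) → d ℕ.+ N ≡ K →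
             corner N d f g ≼ pow ½ N ℚ.* (∑ℚ N α ℚ.* ∑ℚ K β)
  corner-≼ zero d {K} {β = β} 0≤α 0≤β f≼ g≼ e =
    ≼-resp (ℚS.solve 1 (λ x → ℚS.con 0ℚ ℚS.:= ℚS.con 1ℚ ℚS.:* (ℚS.con 0ℚ ℚS.:* x)) ≡.refl (∑ℚ K β)) 0≼0
  corner-≼ (suc N) d {K} {f} {g} {α} {β} 0≤α 0≤β f≼ g≼ e =
    -- Dropping the first row shifts `f` by one degree; the factor ½ so released is absorbed into
    -- `α`, which restores the shape of the hypothesis and of the bound.
    ≼-resp total (+-≼ (*-≼ (f≼ 0) tail≼) (corner-≼ N (suc d) {α = λ i → ½ ℚ.* α (suc i)}
      (λ i → *-nonNeg (ℚ.<⇒≤ 0<½) (0≤α (suc i))) 0≤β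
      (λ i → ≼-resp (shift i) (f≼ (suc i))) g≼ (≡.trans (≡.sym (ℕ.+-suc d N)) e)))
    where
    h = pow ½ N
    b = ∑ℚ K β
    tail≼ : Σ< d (λ i → g (i ℕ.+ suc N)) ≼ pow ½ (suc N) ℚ.* b
    tail≼ = ≼-weaken
      (ℚ.≤-trans
        (∑ℚ-mono d λ i → ℚ.*-monoʳ-≤-nonNeg (β (i ℕ.+ suc N)) {{ℚ.nonNegative (0≤β (i ℕ.+ suc N))}} (pow½-+ i (suc N)))
        (≡.subst (ℚ._≤ pow ½ (suc N) ℚ.* b) (*-∑ℚ d (pow ½ (suc N)) (λ i → β (i ℕ.+ suc N)))
          (ℚ.*-monoˡ-≤-nonNeg (pow ½ (suc N)) {{ℚ.nonNegative (pow½-nonNeg (suc N))}} (∑ℚ-tail d β 0≤β e))))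
      (Σ<-≼ d (λ i → g≼ (i ℕ.+ suc N)))
    shift : ∀ i → pow ½ (suc i) ℚ.* α (suc i) ≡ pow ½ i ℚ.* (½ ℚ.* α (suc i))
    shift i = ℚS.solve 2 (λ h a → (ℚS.con ½ ℚS.:* h) ℚS.:* a ℚS.:= h ℚS.:* (ℚS.con ½ ℚS.:* a)) ≡.refl (pow ½ i) (α (suc i))
    total : (1ℚ ℚ.* α 0) ℚ.* ((½ ℚ.* h) ℚ.* b) ℚ.+ h ℚ.* (∑ℚ N (λ i → ½ ℚ.* α (suc i)) ℚ.* b)
            ≡ (½ ℚ.* h) ℚ.* (∑ℚ (suc N) α ℚ.* b)
    total = ≡.trans
      (≡.cong (λ s → (1ℚ ℚ.* α 0) ℚ.* ((½ ℚ.* h) ℚ.* b) ℚ.+ h ℚ.* (s ℚ.* b)) (≡.sym (*-∑ℚ N ½ (α ∘ suc))))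
      (≡.trans
        (ℚS.solve 4 (λ a h b s → (ℚS.con 1ℚ ℚS.:* a) ℚS.:* ((ℚS.con ½ ℚS.:* h) ℚS.:* b) ℚS.:+ h ℚS.:* ((ℚS.con ½ ℚS.:* s) ℚS.:* b)
            ℚS.:= (ℚS.con ½ ℚS.:* h) ℚS.:* ((a ℚS.:+ s) ℚS.:* b)) ≡.refl (α 0) h b (∑ℚ N (α ∘ suc)))
        (≡.cong (λ s → (½ ℚ.* h) ℚ.* (s ℚ.* b)) (≡.sym (∑ℚ-front N α))))

  -- The constant is fixed before ε and the factors, so that ε can later be chosen in terms of it.
  -- The condition ε ≤ 1 keeps the error linear in ε.
  Π<-perturb : ∀ K c → 0ℚ ℚ.≤ c → ∃[ c′ ] 0ℚ ℚ.≤ c′ × (∀ ε → 0ℚ ℚ.≤ ε → ε ℚ.≤ 1ℚ →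
    ∀ (Q Δ : ℕ → Carrier) → (∀ k → Q k ≼ c) → (∀ k → Δ k ≼ ε) →
    ∃[ D ] D ≼ ε ℚ.* c′ × Π< K (λ k → Q k + Δ k) ≈ Π< K Q + D)
  Π<-perturb zero c 0≤c = 0ℚ , ℚ.≤-refl , λ ε _ _ Q Δ _ _ →
    0# , ≼-resp (≡.sym (ℚ.*-zeroʳ ε)) 0≼0 , sym (+-identityʳ 1#)
  Π<-perturb (suc K) c 0≤c with Π<-perturb K c 0≤c
  ... | c′ , 0≤c′ , ih = pow c K ℚ.+ c′ ℚ.* (c ℚ.+ 1ℚ) , ℚ.+-mono-≤ (pow-nonNeg 0≤c K) (*-nonNeg 0≤c′ (≤-+ʳ 0≤c (ℚ.<⇒≤ 0<1))) ,
    λ ε 0≤ε ε≤1 Q Δ Q≼ Δ≼ → let D , D≼ , eq = ih ε 0≤ε ε≤1 Q Δ Q≼ Δ≼ in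
    Π< K Q * Δ K + D * (Q K + Δ K) ,
    ≼-weaken
      (≡.subst (pow c K ℚ.* ε ℚ.+ (ε ℚ.* c′) ℚ.* (c ℚ.+ ε) ℚ.≤_)
        (ℚS.solve 4 (λ P ε c′ s → P ℚS.:* ε ℚS.:+ (ε ℚS.:* c′) ℚS.:* s ℚS.:= ε ℚS.:* (P ℚS.:+ c′ ℚS.:* s)) ≡.refl (pow c K) ε c′ (c ℚ.+ 1ℚ))
        (ℚ.+-monoʳ-≤ (pow c K ℚ.* ε)
          (ℚ.*-monoˡ-≤-nonNeg (ε ℚ.* c′) {{ℚ.nonNegative (*-nonNeg 0≤ε 0≤c′)}} (ℚ.+-monoʳ-≤ c ε≤1))))
      (+-≼ (*-≼ (Π<-≼ K Q≼) (Δ≼ K)) (*-≼ D≼ (+-≼ (Q≼ K) (Δ≼ K)))) ,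
    trans (*-congʳ eq) (solve 4 (λ P D Q Δ → (P :+ D) :* (Q :+ Δ) := P :* Q :+ (P :* Δ :+ D :* (Q :+ Δ))) refl (Π< K Q) D (Q K) (Δ K))

  module NormedExponential (recip : ℕ → Carrier) (recip-inverse : ∀ k → recip k * natural (suc k) ≈ 1#)
    (recip≼ : ∀ k → recip k ≼ inv k) where
    open Exponential recip recip-inverse

    term-≼ : ∀ {r c} → r ≼ c → ∀ k → term r k ≼ majorant c k
    term-≼ r≼c zero = 1≼1
    term-≼ {c = c} r≼c (suc k) = ≼-resp
      (≡.trans (ℚS.solve 3 (λ v c m → v ℚS.:* (c ℚS.:* m) ℚS.:= (c ℚS.:* v) ℚS.:* m) ≡.refl (inv k) c (majorant c k))
        (≡.sym (majorant-suc c k)))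
      (*-≼ (recip≼ k) (*-≼ r≼c (term-≼ r≼c k)))

    corner-term-≼ : ∀ {a b} → 0ℚ ℚ.< a → 0ℚ ℚ.< b → ∃[ C ] 0ℚ ℚ.≤ C × (∀ N {r s} → r ≼ a → s ≼ b →
      corner N 0 (term r) (term s) ≼ pow ½ N ℚ.* C)
    corner-term-≼ {a} {b} 0<a 0<b = A ℚ.* B , *-nonNeg 0≤A 0≤B , λ N r≼a s≼b →
      ≼-weaken
        (ℚ.*-monoˡ-≤-nonNeg (pow ½ N) {{ℚ.nonNegative (pow½-nonNeg N)}}
          (*-mono-≤ (∑ℚ-nonNeg N (majorant-nonNeg 0<2a)) (A-bound N) (∑ℚ-nonNeg N (majorant-nonNeg 0<2b)) (B-bound N)))
        (corner-≼ N 0 (majorant-nonNeg 0<2a) (majorant-nonNeg 0<2b)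
          (λ i → ≼-resp (majorant-double a i) (term-≼ r≼a i))
          (λ i → ≼-resp (majorant-double b i) (term-≼ s≼b i)) ≡.refl)
      where
      0<2a = ℚ.+-mono-< 0<a 0<a
      0<2b = ℚ.+-mono-< 0<b 0<b
      A = proj₁ (majorant-sum-bounded 0<2a)
      0≤A = proj₁ (proj₂ (majorant-sum-bounded 0<2a))
      A-bound = proj₂ (proj₂ (majorant-sum-bounded 0<2a))
      B = proj₁ (majorant-sum-bounded 0<2b)
      0≤B = proj₁ (proj₂ (majorant-sum-bounded 0<2b))
      B-bound = proj₂ (proj₂ (majorant-sum-bounded 0<2b))

    expSum-≼ : ∀ {a} → 0ℚ ℚ.< a → ∃[ C ] 0ℚ ℚ.≤ C × (∀ N {r} → r ≼ a → expSum N r ≼ C)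
    expSum-≼ 0<a =
      let C , 0≤C , bound = majorant-sum-bounded 0<a
      in C , 0≤C , λ N r≼a → ≼-weaken (bound N) (Σ<-≼ N (term-≼ r≼a))

    -- Each new factor adds one corner and multiplies the previous error by a bounded truncated
    -- exponential. The constant depends on `K` and `b` but not on `N`. The truncation keeps at
    -- least one term because the empty product must equal the truncation of exp 0.
    Π<-expSum : ∀ K {b} → 0ℚ ℚ.< b → ∃[ c ] 0ℚ ℚ.≤ c × (∀ N (B : ℕ → Carrier) → (∀ k → B k ≼ b) →
      ∃[ D ] D ≼ pow ½ (suc N) ℚ.* c ×
             Π< K (λ k → expSum (suc N) (B k)) ≈ expSum (suc N) (Σ< K B) + D)
    Π<-expSum zero 0<b = 0ℚ , ℚ.≤-refl , λ N B _ →
      0# , ≼-resp (≡.sym (ℚ.*-zeroʳ (pow ½ (suc N)))) 0≼0 ,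
      trans (sym (expSum-0 N)) (sym (+-identityʳ _))
    Π<-expSum (suc K) {b} 0<b =
      let c  , 0≤c  , ih = Π<-expSum K 0<b
          C₁ , 0≤C₁ , corner-bound = corner-term-≼ 0<s 0<b
          C₂ , 0≤C₂ , exp-bound = expSum-≼ 0<b
      in C₁ ℚ.+ c ℚ.* C₂ , ℚ.+-mono-≤ 0≤C₁ (*-nonNeg 0≤c 0≤C₂) , λ N B B≼b →
        let D , D≼ , eq = ih N B B≼b
            S = Σ< K B
            e = expSum (suc N)
            X = corner (suc N) 0 (term S) (term (B K))
        in X + D * e (B K) ,
           ≼-resp (ℚS.solve 4 (λ h C₁ c C₂ → h ℚS.:* C₁ ℚS.:+ (h ℚS.:* c) ℚS.:* C₂ ℚS.:= h ℚS.:* (C₁ ℚS.:+ c ℚS.:* C₂)) ≡.refl (pow ½ (suc N)) C₁ c C₂)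
             (+-≼ (corner-bound (suc N) (≼-weaken S≤s (Σ<-≼ K B≼b)) (B≼b K)) (*-≼ D≼ (exp-bound (suc N) (B≼b K)))) ,
           (begin
             Π< K (λ k → e (B k)) * e (B K)    ≈⟨ *-congʳ eq ⟩
             (e S + D) * e (B K)               ≈⟨ distribʳ _ _ _ ⟩
             e S * e (B K) + D * e (B K)       ≈⟨ +-congʳ (expSum-* (suc N) S (B K)) ⟩
             (e (S + B K) + X) + D * e (B K)   ≈⟨ +-assoc _ _ _ ⟩
             e (S + B K) + (X + D * e (B K))   ∎)
      where
      -- The extra `b` keeps the bound strictly positive when `K` is 0.
      s = ∑ℚ K (λ _ → b) ℚ.+ b
      0<s : 0ℚ ℚ.< s
      0<s = ℚ.<-≤-trans 0<b (≤-+ˡ ℚ.≤-refl (∑ℚ-nonNeg K (λ _ → ℚ.<⇒≤ 0<b)))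
      S≤s : ∑ℚ K (λ _ → b) ℚ.≤ s
      S≤s = ≤-+ʳ ℚ.≤-refl (ℚ.<⇒≤ 0<b)

-- The commutative algebra of translation operators on ℤₙ × ℤₚ

module Operators (𝕜 : CommutativeSemiring 0ℓ 0ℓ) (n p : ℕ) where
  open CommutativeSemiring 𝕜
  open Series 𝕜
  open import Relation.Binary.Reasoning.Setoid setoid
  open import Algebra.Solver.Ring.NaturalCoefficients.Default 𝕜 using (solve; _:=_; _:+_; _:*_)

  infixl 6 _⊕_
  infixl 7 _⊗_
  infix  4 _≋_

  -- Syntax instead of arbitrary linear maps: everything built from translations and scalars
  -- commutes, and induction over the terms proves it.
  data Operator : Set where
    shift   : ℕ → ℕ → Operator
    scalar  : Carrier → Operator
    _⊕_ _⊗_ : Operator → Operator → Operator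

  act : Operator → (ℕ → ℕ → Carrier) → ℕ → ℕ → Carrier
  act (shift s t) φ a b = φ (a ℕ.+ s) (b ℕ.+ t)
  act (scalar c)  φ a b = c * φ a b
  act (r ⊕ s)     φ a b = act r φ a b + act s φ a b
  act (r ⊗ s)     φ     = act r (act s φ)

  act-cong : ∀ r {φ ψ} → (∀ a b → φ a b ≈ ψ a b) → ∀ a b → act r φ a b ≈ act r ψ a b
  act-cong (shift s t) φ≈ψ a b = φ≈ψ (a ℕ.+ s) (b ℕ.+ t)
  act-cong (scalar c)  φ≈ψ a b = *-congˡ (φ≈ψ a b)
  act-cong (r ⊕ s)     φ≈ψ a b = +-cong (act-cong r φ≈ψ a b) (act-cong s φ≈ψ a b)
  act-cong (r ⊗ s)     φ≈ψ     = act-cong r (act-cong s φ≈ψ)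

  act-+ : ∀ r φ ψ a b → act r (λ a b → φ a b + ψ a b) a b ≈ act r φ a b + act r ψ a b
  act-+ (shift s t) φ ψ a b = refl
  act-+ (scalar c)  φ ψ a b = distribˡ c _ _
  act-+ (r ⊕ s)     φ ψ a b = trans (+-cong (act-+ r φ ψ a b) (act-+ s φ ψ a b))
    (solve 4 (λ x y z w → (x :+ y) :+ (z :+ w) := (x :+ z) :+ (y :+ w)) refl _ _ _ _)
  act-+ (r ⊗ s)     φ ψ a b = trans (act-cong r (act-+ s φ ψ) a b) (act-+ r (act s φ) (act s ψ) a b)

  act-* : ∀ r c φ a b → act r (λ a b → c * φ a b) a b ≈ c * act r φ a b
  act-* (shift s t) c φ a b = refl
  act-* (scalar d)  c φ a b = solve 3 (λ c d x → d :* (c :* x) := c :* (d :* x)) refl _ _ _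
  act-* (r ⊕ s)     c φ a b = trans (+-cong (act-* r c φ a b) (act-* s c φ a b)) (sym (distribˡ c _ _))
  act-* (r ⊗ s)     c φ a b = trans (act-cong r (act-* s c φ) a b) (act-* r c (act s φ) a b)

  act-shift : ∀ r s t φ a b → act r (λ a b → φ (a ℕ.+ s) (b ℕ.+ t)) a b ≈ act r φ (a ℕ.+ s) (b ℕ.+ t)
  act-shift (shift s′ t′) s t φ a b = reflexive (≡.cong₂ φ (swap a s′ s) (swap b t′ t))
    where
    swap : ∀ x y z → x ℕ.+ y ℕ.+ z ≡ x ℕ.+ z ℕ.+ y
    swap x y z = ≡.trans (ℕ.+-assoc x y z) (≡.trans (≡.cong (x ℕ.+_) (ℕ.+-comm y z)) (≡.sym (ℕ.+-assoc x z y)))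
  act-shift (scalar c) s t φ a b = refl
  act-shift (r ⊕ r′)   s t φ a b = +-cong (act-shift r s t φ a b) (act-shift r′ s t φ a b)
  act-shift (r ⊗ r′)   s t φ a b = trans (act-cong r (act-shift r′ s t φ) a b) (act-shift r s t (act r′ φ) a b)

  act-comm : ∀ r s φ a b → act r (act s φ) a b ≈ act s (act r φ) a b
  act-comm (shift x y) s φ a b = sym (act-shift s x y φ a b)
  act-comm (scalar c)  s φ a b = sym (act-* s c φ a b)
  act-comm (r ⊕ r′)    s φ a b =
    trans (+-cong (act-comm r s φ a b) (act-comm r′ s φ a b)) (sym (act-+ s (act r φ) (act r′ φ) a b))
  act-comm (r ⊗ r′)    s φ a b =
    trans (act-cong r (act-comm r′ s φ) a b) (act-comm r s (act r′ φ) a b)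

  act-Σ< : ∀ r N (φ : ℕ → ℕ → ℕ → Carrier) a b →
           act r (λ a b → Σ< N (λ k → φ k a b)) a b ≈ Σ< N (λ k → act r (φ k) a b)
  act-Σ< r zero    φ a b = begin
    act r (λ _ _ → 0#) a b       ≈⟨ act-cong r (λ _ _ → sym (zeroˡ 0#)) a b ⟩
    act r (λ _ _ → 0# * 0#) a b  ≈⟨ act-* r 0# (λ _ _ → 0#) a b ⟩
    0# * act r (λ _ _ → 0#) a b  ≈⟨ zeroˡ _ ⟩
    0#                           ∎
  act-Σ< r (suc N) φ a b = trans (act-+ r (λ a b → Σ< N (λ k → φ k a b)) (φ N) a b) (+-congʳ (act-Σ< r N φ a b))

  -- The functions on ℤₙ × ℤₚ whose sum over each coset of ℤₚ vanishes: on
  -- them, translation of the second coordinate behaves like multiplication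
  -- by a primitive p-th root of unity.
  record Admissible (φ : ℕ → ℕ → Carrier) : Set where
    field
      periodic₁ : ∀ a b → φ (a ℕ.+ n) b ≈ φ a b
      periodic₂ : ∀ a b → φ a (b ℕ.+ p) ≈ φ a b
      coset-sum : ∀ s → ¬ (p ∣ s) → ∀ a b → Σ< p (λ k → φ a (b ℕ.+ k ℕ.* s)) ≈ 0#
  open Admissible

  -- Every operator is linear and commutes with translations. This closure is what lets composition
  -- respect `_≋_`.
  act-admissible : ∀ r {φ} → Admissible φ → Admissible (act r φ)
  act-admissible r {φ} A .periodic₁ a b = begin
    act r φ (a ℕ.+ n) b                              ≈⟨ reflexive (≡.cong (act r φ (a ℕ.+ n)) (ℕ.+-identityʳ b)) ⟨
    act r φ (a ℕ.+ n) (b ℕ.+ 0)                      ≈⟨ act-shift r n 0 φ a b ⟨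
    act r (λ a b → φ (a ℕ.+ n) (b ℕ.+ 0)) a b        ≈⟨ act-cong r (λ a b → trans (periodic₁ A a (b ℕ.+ 0)) (reflexive (≡.cong (φ a) (ℕ.+-identityʳ b)))) a b ⟩
    act r φ a b                                      ∎
  act-admissible r {φ} A .periodic₂ a b = begin
    act r φ a (b ℕ.+ p)                              ≈⟨ reflexive (≡.cong (λ a → act r φ a (b ℕ.+ p)) (ℕ.+-identityʳ a)) ⟨
    act r φ (a ℕ.+ 0) (b ℕ.+ p)                      ≈⟨ act-shift r 0 p φ a b ⟨
    act r (λ a b → φ (a ℕ.+ 0) (b ℕ.+ p)) a b        ≈⟨ act-cong r (λ a b → trans (periodic₂ A (a ℕ.+ 0) b) (reflexive (≡.cong (λ a → φ a b) (ℕ.+-identityʳ a)))) a b ⟩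
    act r φ a b                                      ∎
  act-admissible r {φ} A .coset-sum s p∤s a b = begin
    Σ< p (λ k → act r φ a (b ℕ.+ k ℕ.* s))
      ≈⟨ Σ<-cong p (λ k _ → trans (reflexive (≡.cong (λ a → act r φ a (b ℕ.+ k ℕ.* s)) (≡.sym (ℕ.+-identityʳ a))))
           (sym (act-shift r 0 (k ℕ.* s) φ a b))) ⟩
    Σ< p (λ k → act r (λ a b → φ (a ℕ.+ 0) (b ℕ.+ k ℕ.* s)) a b)
      ≈⟨ act-Σ< r p _ a b ⟨
    act r (λ a b → Σ< p (λ k → φ (a ℕ.+ 0) (b ℕ.+ k ℕ.* s))) a b
      ≈⟨ act-cong r (λ a b → trans (coset-sum A s p∤s (a ℕ.+ 0) b) (sym (zeroˡ 0#))) a b ⟩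
    act r (λ _ _ → 0# * 0#) a b
      ≈⟨ act-* r 0# (λ _ _ → 0#) a b ⟩
    0# * act r (λ _ _ → 0#) a b
      ≈⟨ zeroˡ _ ⟩
    0# ∎

  -- Testing only on admissible functions imposes the relations T to the n equal to 1, ζ to the p
  -- equal to 1, and the vanishing of the sums of ζ to the ks over k < p, for p not dividing s.
  record _≋_ (r s : Operator) : Set where
    constructor mk≋
    field app : ∀ {φ} → Admissible φ → ∀ a b → act r φ a b ≈ act s φ a b
  open _≋_ public

  operators : CommutativeSemiring 0ℓ 0ℓ
  operators = record
    { Carrier = Operator
    ; _≈_ = _≋_
    ; _+_ = _⊕_
    ; _*_ = _⊗_
    ; 0# = scalar 0#
    ; 1# = scalar 1#
    ; isCommutativeSemiring = isCommutativeSemiringˡ record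
      { +-isCommutativeMonoid = record
        { isMonoid = record
          { isSemigroup = record
            { isMagma = record
              { isEquivalence = ≋-isEquivalence
              ; ∙-cong = λ e f → mk≋ λ A a b → +-cong (app e A a b) (app f A a b)
              }
            ; assoc = λ r s t → mk≋ λ A a b → +-assoc _ _ _
            }
          ; identity = (λ r → mk≋ λ A a b → trans (+-congʳ (zeroˡ _)) (+-identityˡ _))
                     , (λ r → mk≋ λ A a b → trans (+-congˡ (zeroˡ _)) (+-identityʳ _))
          }
        ; comm = λ r s → mk≋ λ A a b → +-comm _ _
        }
      ; *-isCommutativeMonoid = record
        { isMonoid = record
          { isSemigroup = record
            { isMagma = record
              { isEquivalence = ≋-isEquivalence
              ; ∙-cong = λ {r} {r′} {s} {s′} e f → mk≋ λ A a b →
                  trans (app e (act-admissible s A) a b) (act-cong r′ (app f A) a b)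
              }
            ; assoc = λ r s t → mk≋ λ A a b → refl
            }
          ; identity = (λ r → mk≋ λ A a b → *-identityˡ _)
                     , (λ r → mk≋ λ {φ} A a b → act-cong r (λ a b → *-identityˡ _) a b)
          }
        ; comm = λ r s → mk≋ λ {φ} A a b → act-comm r s φ a b
        }
      ; distribʳ = λ t r s → mk≋ λ A a b → refl
      ; zeroˡ = λ r → mk≋ λ A a b → trans (zeroˡ _) (sym (zeroˡ _))
      }
    }
    where
    ≋-isEquivalence : IsEquivalence _≋_
    ≋-isEquivalence = record
      { refl = mk≋ λ A a b → refl
      ; sym = λ e → mk≋ λ A a b → sym (app e A a b)
      ; trans = λ e f → mk≋ λ A a b → trans (app e A a b) (app f A a b)
      }

  private
    module O = CommutativeSemiring operators
    module OΣ = Series operators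

  scalar-cong : ∀ {c d} → c ≈ d → scalar c ≋ scalar d
  scalar-cong c≈d = mk≋ λ A a b → *-congʳ c≈d

  scalar-+ : ∀ c d → scalar (c + d) ≋ scalar c ⊕ scalar d
  scalar-+ c d = mk≋ λ A a b → distribʳ _ c d

  scalar-* : ∀ c d → scalar (c * d) ≋ scalar c ⊗ scalar d
  scalar-* c d = mk≋ λ A a b → *-assoc c d _

  scalar-natural : ∀ k → scalar (natural k) ≋ OΣ.natural k
  scalar-natural zero    = O.refl
  scalar-natural (suc k) = O.trans (scalar-+ (natural k) 1#) (O.+-congʳ (scalar-natural k))

  scalar-inverse : ∀ c k → c * natural k ≈ 1# → scalar c ⊗ OΣ.natural k ≋ O.1#
  scalar-inverse c k inverse = O.trans (O.*-congˡ (O.sym (scalar-natural k)))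
    (O.trans (O.sym (scalar-* c (natural k))) (scalar-cong inverse))

  act-OΣ< : ∀ N f φ a b → act (OΣ.Σ< N f) φ a b ≈ Σ< N (λ k → act (f k) φ a b)
  act-OΣ< zero    f φ a b = zeroˡ _
  act-OΣ< (suc N) f φ a b = +-congʳ (act-OΣ< N f φ a b)

  shift-+ : ∀ s t s′ t′ → shift s t ⊗ shift s′ t′ ≋ shift (s ℕ.+ s′) (t ℕ.+ t′)
  shift-+ s t s′ t′ = mk≋ λ {φ} A a b → reflexive (≡.cong₂ φ (ℕ.+-assoc a s s′) (ℕ.+-assoc b t t′))

  shift-0 : shift 0 0 ≋ O.1#
  shift-0 = mk≋ λ {φ} A a b → trans
    (reflexive (≡.cong₂ φ (ℕ.+-identityʳ a) (ℕ.+-identityʳ b))) (sym (*-identityˡ _))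

  shift-period : ∀ k l → shift (k ℕ.* n) (l ℕ.* p) ≋ O.1#
  shift-period zero zero = shift-0
  shift-period zero (suc l) = O.trans (mk≋ λ {φ} A a b → trans
      (reflexive (≡.cong (φ (a ℕ.+ 0)) (≡.trans (≡.cong (b ℕ.+_) (ℕ.+-comm p (l ℕ.* p))) (≡.sym (ℕ.+-assoc b _ p)))))
      (periodic₂ A (a ℕ.+ 0) (b ℕ.+ l ℕ.* p)))
    (shift-period 0 l)
  shift-period (suc k) l = O.trans (mk≋ λ {φ} A a b → trans
      (reflexive (≡.cong (λ x → φ x (b ℕ.+ l ℕ.* p)) (≡.trans (≡.cong (a ℕ.+_) (ℕ.+-comm n (k ℕ.* n))) (≡.sym (ℕ.+-assoc a _ n)))))
      (periodic₁ A (a ℕ.+ k ℕ.* n) (b ℕ.+ l ℕ.* p)))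
    (shift-period k l)

  module OperatorNorm (∣_∣ₖ : Carrier → ℚ)
    (∣∣-cong : ∀ {x y} → x ≈ y → ∣ x ∣ₖ ≡ ∣ y ∣ₖ)
    (∣∣-nonNeg : ∀ x → 0ℚ ℚ.≤ ∣ x ∣ₖ)
    (∣0∣≡0 : ∣ 0# ∣ₖ ≡ 0ℚ)
    (∣x+y∣≤∣x∣+∣y∣ : ∀ x y → ∣ x + y ∣ₖ ℚ.≤ ∣ x ∣ₖ ℚ.+ ∣ y ∣ₖ)
    (∣x*y∣≤∣x∣*∣y∣ : ∀ x y → ∣ x * y ∣ₖ ℚ.≤ ∣ x ∣ₖ ℚ.* ∣ y ∣ₖ) where

    infix 4 _≼_
    -- An upper bound for the operator norm belonging to the supremum norm on admissible functions.
    record _≼_ (r : Operator) (c : ℚ) : Set where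
      constructor mk≼
      field app≼ : ∀ {φ d} → Admissible φ → (∀ a b → ∣ φ a b ∣ₖ ℚ.≤ d) → ∀ a b → ∣ act r φ a b ∣ₖ ℚ.≤ c ℚ.* d
    open _≼_ public

    scalar≼ : ∀ c → scalar c ≼ ∣ c ∣ₖ
    scalar≼ c = mk≼ λ {φ} A φ≤d a b → ℚ.≤-trans (∣x*y∣≤∣x∣*∣y∣ c (φ a b))
      (ℚ.*-monoˡ-≤-nonNeg ∣ c ∣ₖ {{ℚ.nonNegative (∣∣-nonNeg c)}} (φ≤d a b))

    shift≼ : ∀ s t → shift s t ≼ 1ℚ
    shift≼ s t = mk≼ λ {φ} {d} A φ≤d a b → ≡.subst (_ ℚ.≤_) (≡.sym (ℚ.*-identityˡ d)) (φ≤d (a ℕ.+ s) (b ℕ.+ t))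

    operatorNorm : Norm operators
    operatorNorm = record
      { _≼_      = _≼_
      ; ≼-weaken = λ c≤d r≼c → mk≼ λ {φ} {e} A φ≤e a b → ℚ.≤-trans (app≼ r≼c A φ≤e a b)
          -- `e` is nonnegative because it bounds an absolute value, for instance the one at (0, 0).
          (ℚ.*-monoʳ-≤-nonNeg e {{ℚ.nonNegative (ℚ.≤-trans (∣∣-nonNeg (φ 0 0)) (φ≤e 0 0))}} c≤d)
      ; 0≼0      = ≡.subst (scalar 0# ≼_) ∣0∣≡0 (scalar≼ 0#)
      ; 1≼1      = mk≼ λ {φ} {d} A φ≤d a b → ≡.subst₂ ℚ._≤_ (∣∣-cong (sym (*-identityˡ (φ a b)))) (≡.sym (ℚ.*-identityˡ d)) (φ≤d a b)
      ; +-≼      = λ {r} {s} {c} {d} r≼c s≼d → mk≼ λ {φ} {e} A φ≤e a b →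
          ℚ.≤-trans (∣x+y∣≤∣x∣+∣y∣ (act r φ a b) (act s φ a b))
            (≡.subst (_ ℚ.≤_) (≡.sym (ℚ.*-distribʳ-+ e c d)) (ℚ.+-mono-≤ (app≼ r≼c A φ≤e a b) (app≼ s≼d A φ≤e a b)))
      ; *-≼      = λ {r} {s} {c} {d} r≼c s≼d → mk≼ λ {φ} {e} A φ≤e a b →
          ≡.subst (_ ℚ.≤_) (≡.sym (ℚ.*-assoc c d e)) (app≼ r≼c (act-admissible s A) (app≼ s≼d A φ≤e) a b)
      }

-- Sums over finite index sets; Gaussian rationals and rational approximations of complex numbers

module FinSums (R : CommutativeSemiring 0ℓ 0ℓ) where
  open CommutativeSemiring R
  open import Algebra.Properties.Semiring.Sum semiring public
    using (sum; sum-cong-≋; sum-replicate-zero; ∑-distrib-+; ∑-comm; *-distribˡ-sum; *-distribʳ-sum)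
  open Series R

  sum≈Σ< : ∀ n f → sum {n} (f ∘ toℕ) ≈ Σ< n f
  sum≈Σ< zero    f = refl
  sum≈Σ< (suc n) f = trans (+-congˡ (sum≈Σ< n (f ∘ suc))) (sym (Σ<-front n f))

  sum-zero : ∀ {n} (x : Vector Carrier n) → (∀ a → x a ≈ 0#) → sum x ≈ 0#
  sum-zero {n} x x≈0 = trans (sum-cong-≋ x≈0) (sum-replicate-zero n)

  indicator : ∀ {n} → Fin n → Fin n → Carrier
  indicator a v = if does (a Fin.≟ v) then 1# else 0#

  sum-indicator : ∀ {n} (x : Vector Carrier n) v → sum (λ a → indicator a v * x a) ≈ x v
  sum-indicator {suc n} x Fin.zero    = trans
    (+-cong (*-identityˡ _) (sum-zero (λ a → 0# * x (Fin.suc a)) (λ a → zeroˡ _))) (+-identityʳ _)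
  sum-indicator {suc n} x (Fin.suc v) = trans
    (+-cong (zeroˡ _) (trans (sum-cong-≋ (λ a → *-congʳ (indicator-suc a v))) (sum-indicator (x ∘ Fin.suc) v))) (+-identityˡ _)
    where
    indicator-suc : ∀ {n} (a v : Fin n) → indicator (Fin.suc a) (Fin.suc v) ≈ indicator a v
    indicator-suc a v with does (a Fin.≟ v)
    ... | true  = refl
    ... | false = refl

module GaussianRationals where
  open import Data.Rational using (_+_; _-_; -_; _*_; _≤_; _<_; ∣_∣)
  open ℚ-Solver.+-*-Solver using (solve; _:=_; _:+_; _:*_; _:-_; :-_; con)

  record ℚ[i] : Set where
    constructor ⟨_,_⟩
    field Re Im : ℚ
  open ℚ[i] public

  infixl 6 _+ᴳ_ _-ᴳ_
  infixl 7 _*ᴳ_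

  -- Opaque, so that conversion checking never unfolds rational arithmetic.
  opaque
    _+ᴳ_ _-ᴳ_ _*ᴳ_ : ℚ[i] → ℚ[i] → ℚ[i]
    z +ᴳ w = ⟨ Re z + Re w , Im z + Im w ⟩
    z -ᴳ w = ⟨ Re z - Re w , Im z - Im w ⟩
    z *ᴳ w = ⟨ Re z * Re w - Im z * Im w , Re z * Im w + Im z * Re w ⟩

  0ᴳ 1ᴳ : ℚ[i]
  0ᴳ = ⟨ 0ℚ , 0ℚ ⟩
  1ᴳ = ⟨ 1ℚ , 0ℚ ⟩

  opaque
    unfolding _+ᴳ_ _*ᴳ_
    private
      isCommutativeSemiringᴳ : IsCommutativeSemiring _≡_ _+ᴳ_ _*ᴳ_ 0ᴳ 1ᴳ
      isCommutativeSemiringᴳ = isCommutativeSemiringˡ record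
        { +-isCommutativeMonoid = record
          { isMonoid = record
            { isSemigroup = record
              { isMagma = record { isEquivalence = ≡.isEquivalence ; ∙-cong = ≡.cong₂ _+ᴳ_ }
              ; assoc = λ x y z → ≡.cong₂ ⟨_,_⟩ (ℚ.+-assoc (Re x) (Re y) (Re z)) (ℚ.+-assoc (Im x) (Im y) (Im z))
              }
            ; identity = (λ x → ≡.cong₂ ⟨_,_⟩ (ℚ.+-identityˡ (Re x)) (ℚ.+-identityˡ (Im x)))
                       , (λ x → ≡.cong₂ ⟨_,_⟩ (ℚ.+-identityʳ (Re x)) (ℚ.+-identityʳ (Im x)))
            }
          ; comm = λ x y → ≡.cong₂ ⟨_,_⟩ (ℚ.+-comm (Re x) (Re y)) (ℚ.+-comm (Im x) (Im y))
          }
        ; *-isCommutativeMonoid = record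
          { isMonoid = record
            { isSemigroup = record
              { isMagma = record { isEquivalence = ≡.isEquivalence ; ∙-cong = ≡.cong₂ _*ᴳ_ }
              ; assoc = λ x y z → ≡.cong₂ ⟨_,_⟩
                  (solve 6 (λ a b c d e f → (a :* c :- b :* d) :* e :- (a :* d :+ b :* c) :* f
                                         := a :* (c :* e :- d :* f) :- b :* (c :* f :+ d :* e)) ≡.refl
                    (Re x) (Im x) (Re y) (Im y) (Re z) (Im z))
                  (solve 6 (λ a b c d e f → (a :* c :- b :* d) :* f :+ (a :* d :+ b :* c) :* e
                                         := a :* (c :* f :+ d :* e) :+ b :* (c :* e :- d :* f)) ≡.refl
                    (Re x) (Im x) (Re y) (Im y) (Re z) (Im z))
              }
            ; identity = *-identityˡ , (λ x → ≡.trans (*-comm x 1ᴳ) (*-identityˡ x))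
            }
          ; comm = *-comm
          }
        ; distribʳ = λ z x y → ≡.cong₂ ⟨_,_⟩
            (solve 6 (λ a b c d e f → (a :+ c) :* e :- (b :+ d) :* f := (a :* e :- b :* f) :+ (c :* e :- d :* f)) ≡.refl
              (Re x) (Im x) (Re y) (Im y) (Re z) (Im z))
            (solve 6 (λ a b c d e f → (a :+ c) :* f :+ (b :+ d) :* e := (a :* f :+ b :* e) :+ (c :* f :+ d :* e)) ≡.refl
              (Re x) (Im x) (Re y) (Im y) (Re z) (Im z))
        ; zeroˡ = λ x → ≡.cong₂ ⟨_,_⟩
            (solve 2 (λ a b → con 0ℚ :* a :- con 0ℚ :* b := con 0ℚ) ≡.refl (Re x) (Im x))
            (solve 2 (λ a b → con 0ℚ :* b :+ con 0ℚ :* a := con 0ℚ) ≡.refl (Re x) (Im x))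
        }
        where
        *-comm : ∀ x y → x *ᴳ y ≡ y *ᴳ x
        *-comm x y = ≡.cong₂ ⟨_,_⟩
          (solve 4 (λ a b c d → a :* c :- b :* d := c :* a :- d :* b) ≡.refl (Re x) (Im x) (Re y) (Im y))
          (solve 4 (λ a b c d → a :* d :+ b :* c := c :* b :+ d :* a) ≡.refl (Re x) (Im x) (Re y) (Im y))
        *-identityˡ : ∀ x → 1ᴳ *ᴳ x ≡ x
        *-identityˡ x = ≡.cong₂ ⟨_,_⟩
          (solve 2 (λ a b → con 1ℚ :* a :- con 0ℚ :* b := a) ≡.refl (Re x) (Im x))
          (solve 2 (λ a b → con 1ℚ :* b :+ con 0ℚ :* a := b) ≡.refl (Re x) (Im x))

  gaussian : CommutativeSemiring 0ℓ 0ℓ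
  gaussian = record { isCommutativeSemiring = isCommutativeSemiringᴳ }

  opaque
    unfolding _+ᴳ_ _-ᴳ_
    +-minus : ∀ z w → z ≡ w +ᴳ (z -ᴳ w)
    +-minus z w = ≡.cong₂ ⟨_,_⟩ (lemma (Re z) (Re w)) (lemma (Im z) (Im w))
      where
      lemma : ∀ p q → p ≡ q + (p - q)
      lemma = solve 2 (λ p q → p := q :+ (p :- q)) ≡.refl

  -- The sum norm has rational values, as the modulus does not, and is still submultiplicative.
  ∣_∣₁ : ℚ[i] → ℚ
  ∣ z ∣₁ = ∣ Re z ∣ + ∣ Im z ∣

  ∣∣₁-nonNeg : ∀ z → 0ℚ ≤ ∣ z ∣₁
  ∣∣₁-nonNeg z = ℚ.+-mono-≤ (ℚ.0≤∣p∣ (Re z)) (ℚ.0≤∣p∣ (Im z))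

  opaque
    unfolding _+ᴳ_ _*ᴳ_
    ∣∣₁-+ : ∀ z w → ∣ z +ᴳ w ∣₁ ≤ ∣ z ∣₁ + ∣ w ∣₁
    ∣∣₁-+ z w = ≡.subst (∣ z +ᴳ w ∣₁ ≤_)
      (solve 4 (λ a b c d → (a :+ c) :+ (b :+ d) := (a :+ b) :+ (c :+ d)) ≡.refl (∣ Re z ∣) (∣ Im z ∣) (∣ Re w ∣) (∣ Im w ∣))
      (ℚ.+-mono-≤ (ℚ.∣p+q∣≤∣p∣+∣q∣ (Re z) (Re w)) (ℚ.∣p+q∣≤∣p∣+∣q∣ (Im z) (Im w)))

    ∣∣₁-* : ∀ z w → ∣ z *ᴳ w ∣₁ ≤ ∣ z ∣₁ * ∣ w ∣₁
    ∣∣₁-* z w = ≡.subst (∣ z *ᴳ w ∣₁ ≤_)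
      (≡.trans
        (≡.cong₂ _+_ (≡.cong₂ _+_ (ℚ.∣p*q∣≡∣p∣*∣q∣ (Re z) (Re w)) (ℚ.∣p*q∣≡∣p∣*∣q∣ (Im z) (Im w)))
                     (≡.cong₂ _+_ (ℚ.∣p*q∣≡∣p∣*∣q∣ (Re z) (Im w)) (ℚ.∣p*q∣≡∣p∣*∣q∣ (Im z) (Re w))))
        (solve 4 (λ a b c d → (a :* c :+ b :* d) :+ (a :* d :+ b :* c) := (a :+ b) :* (c :+ d)) ≡.refl (∣ Re z ∣) (∣ Im z ∣) (∣ Re w ∣) (∣ Im w ∣)))
      (ℚ.+-mono-≤ (ℚ.∣p-q∣≤∣p∣+∣q∣ (Re z * Re w) (Im z * Im w)) (ℚ.∣p+q∣≤∣p∣+∣q∣ (Re z * Im w) (Im z * Re w)))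

  opaque
    unfolding _+ᴳ_ _-ᴳ_ _*ᴳ_
    minus-self : ∀ z → z -ᴳ z ≡ 0ᴳ
    minus-self z = ≡.cong₂ ⟨_,_⟩ (ℚ.+-inverseʳ (Re z)) (ℚ.+-inverseʳ (Im z))

    minus-+ : ∀ a b c d → (a -ᴳ b) +ᴳ (c -ᴳ d) ≡ (a +ᴳ c) -ᴳ (b +ᴳ d)
    minus-+ a b c d = ≡.cong₂ ⟨_,_⟩ (lemma (Re a) (Re b) (Re c) (Re d)) (lemma (Im a) (Im b) (Im c) (Im d))
      where
      lemma : ∀ a b c d → (a - b) + (c - d) ≡ (a + c) - (b + d)
      lemma = solve 4 (λ a b c d → (a :- b) :+ (c :- d) := (a :+ c) :- (b :+ d)) ≡.refl

    ∣∣₁-minus : ∀ z w → ∣ z -ᴳ w ∣₁ ≤ ∣ z ∣₁ + ∣ w ∣₁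
    ∣∣₁-minus z w = ≡.subst (∣ z -ᴳ w ∣₁ ≤_)
      (solve 4 (λ a b c d → (a :+ c) :+ (b :+ d) := (a :+ b) :+ (c :+ d)) ≡.refl (∣ Re z ∣) (∣ Im z ∣) (∣ Re w ∣) (∣ Im w ∣))
      (ℚ.+-mono-≤ (ℚ.∣p-q∣≤∣p∣+∣q∣ (Re z) (Re w)) (ℚ.∣p-q∣≤∣p∣+∣q∣ (Im z) (Im w)))

    ∣∣₁-*-minus-one : ∀ z → ∣ z *ᴳ (0ᴳ -ᴳ 1ᴳ) ∣₁ ≡ ∣ z ∣₁
    ∣∣₁-*-minus-one z = ≡.cong₂ _+_
      (≡.trans (≡.cong ∣_∣ (solve 2 (λ a b → a :* con (0ℚ - 1ℚ) :- b :* con (0ℚ - 0ℚ) := :- a) ≡.refl (Re z) (Im z))) (ℚ.∣-p∣≡∣p∣ (Re z)))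
      (≡.trans (≡.cong ∣_∣ (solve 2 (λ a b → a :* con (0ℚ - 0ℚ) :+ b :* con (0ℚ - 1ℚ) := :- b) ≡.refl (Re z) (Im z))) (ℚ.∣-p∣≡∣p∣ (Im z)))

    -- Extracts the estimate from an approximate identity whose errors `e` and `f` were left on
    -- their own sides, as computations in a semiring leave them.
    transfer : ∀ {x y e f} → x +ᴳ e ≡ y +ᴳ f → ∣ x ∣₁ ≤ ∣ y ∣₁ + (∣ f ∣₁ + ∣ e ∣₁)
    transfer {x} {y} {e} {f} x+e≡y+f = ≡.subst (λ z → ∣ z ∣₁ ≤ ∣ y ∣₁ + (∣ f ∣₁ + ∣ e ∣₁)) (≡.sym x≡)
      (ℚ.≤-trans (∣∣₁-+ y (f -ᴳ e)) (ℚ.+-monoʳ-≤ ∣ y ∣₁ (∣∣₁-minus f e)))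
      where
      cancel : ∀ x e → x ≡ (x + e) - e
      cancel = solve 2 (λ x e → x := (x :+ e) :- e) ≡.refl
      x≡ : x ≡ y +ᴳ (f -ᴳ e)
      x≡ = ≡.trans (≡.cong₂ ⟨_,_⟩ (cancel (Re x) (Re e)) (cancel (Im x) (Im e)))
        (≡.trans (≡.cong (_-ᴳ e) x+e≡y+f) (≡.cong₂ ⟨_,_⟩ (ℚ.+-assoc (Re y) (Re f) (- Re e)) (ℚ.+-assoc (Im y) (Im f) (- Im e))))

  p≤∣p∣ : ∀ p → p ≤ ∣ p ∣
  p≤∣p∣ p with ℚ.≤-total 0ℚ p
  ... | inj₁ 0≤p = ℚ.≤-reflexive (≡.sym (ℚ.0≤p⇒∣p∣≡p 0≤p))
  ... | inj₂ p≤0 = ℚ.≤-trans p≤0 (ℚ.0≤∣p∣ p)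

  square≤ : ∀ z → Re z * Re z + Im z * Im z ≤ ∣ z ∣₁ * ∣ z ∣₁
  square≤ z = ℚ.≤-trans (ℚ.+-mono-≤ (lemma (Re z)) (lemma (Im z)))
    (≡.subst (∣ Re z ∣ * ∣ Re z ∣ + ∣ Im z ∣ * ∣ Im z ∣ ≤_)
      (solve 2 (λ a b → (a :* a :+ b :* b) :+ (a :* b :+ b :* a) := (a :+ b) :* (a :+ b)) ≡.refl (∣ Re z ∣) (∣ Im z ∣))
      (≤-+ʳ ℚ.≤-refl (ℚ.+-mono-≤ (*-nonNeg (ℚ.0≤∣p∣ (Re z)) (ℚ.0≤∣p∣ (Im z))) (*-nonNeg (ℚ.0≤∣p∣ (Im z)) (ℚ.0≤∣p∣ (Re z))))))
    where
    lemma : ∀ p → p * p ≤ ∣ p ∣ * ∣ p ∣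
    lemma p = ≡.subst (p * p ≤_) (ℚ.∣p*q∣≡∣p∣*∣q∣ p p) (p≤∣p∣ (p * p))

  open Series gaussian using (natural)

  recip : ℕ → ℚ[i]
  recip k = ⟨ inv k , 0ℚ ⟩

  rational : ℕ → ℚ
  rational zero    = 0ℚ
  rational (suc k) = rational k + 1ℚ

  inv-rational : ∀ k → inv k * rational (suc k) ≡ 1ℚ
  inv-rational k = ℚ.toℚᵘ-injective (ℚᵘ.≃-trans (ℚ.toℚᵘ-homo-* (inv k) (rational (suc k)))
    (ℚᵘ.≃-trans (ℚᵘ.*-congˡ (toℚᵘ-rational (suc k)))
      (ℚᵘ.*≡* (≡.trans (ℤ.*-identityʳ _) (≡.trans (ℤ.*-identityˡ _)
        (≡.sym (≡.trans (ℤ.*-identityˡ _) (≡.cong (λ x → ℤ.+ suc x) (ℕ.*-identityʳ k)))))))))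
    where
    toℚᵘ-rational : ∀ k → ℚ.toℚᵘ (rational k) ℚᵘ.≃ ℚᵘ.mkℚᵘ (ℤ.+ k) 0
    toℚᵘ-rational zero    = ℚᵘ.≃-refl
    toℚᵘ-rational (suc k) = ℚᵘ.≃-trans (ℚ.toℚᵘ-homo-+ (rational k) 1ℚ)
      (ℚᵘ.≃-trans (ℚᵘ.+-congˡ ℚᵘ.1ℚᵘ (toℚᵘ-rational k)) (ℚᵘ.*≡* (≡.cong (ℤ._* ℤ.1ℤ)
        (≡.trans (≡.cong (ℤ._+ ℤ.1ℤ) (ℤ.*-identityʳ (ℤ.+ k))) (ℤ.+-comm (ℤ.+ k) ℤ.1ℤ)))))

  opaque
    unfolding _+ᴳ_ _*ᴳ_
    recip-inverse : ∀ k → recip k *ᴳ natural (suc k) ≡ 1ᴳ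
    recip-inverse k = ≡.trans (≡.cong (recip k *ᴳ_) (natural-real (suc k)))
      (≡.cong₂ ⟨_,_⟩
        (≡.trans (solve 2 (λ v r → v :* r :- con 0ℚ :* con 0ℚ := v :* r) ≡.refl (inv k) (rational (suc k))) (inv-rational k))
        (solve 2 (λ v r → v :* con 0ℚ :+ con 0ℚ :* r := con 0ℚ) ≡.refl (inv k) (rational (suc k))))
      where
      natural-real : ∀ k → natural k ≡ ⟨ rational k , 0ℚ ⟩
      natural-real zero    = ≡.refl
      natural-real (suc k) = ≡.cong (_+ᴳ 1ᴳ) (natural-real k)

  -- Since (k + 1) times ½ to the k never exceeds 1, the archimedean property for `inv` suffices.
  pow½-small : ∀ {c ε} → 0ℚ < c → 0ℚ < ε → ∃[ N ] ∀ k → N ℕ.≤ k → c * pow ½ k < ε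
  pow½-small {c} 0<c 0<ε =
    let N , small = archimedean 0<c 0<ε
    in N , λ k N≤k → ℚ.≤-<-trans
      (ℚ.*-monoˡ-≤-nonNeg c {{ℚ.nonNegative (ℚ.<⇒≤ 0<c)}} (pow½≤inv k)) (small k N≤k)
    where
    rational-nonNeg : ∀ k → 0ℚ ≤ rational k
    rational-nonNeg zero    = ℚ.≤-refl
    rational-nonNeg (suc k) = ≤-+ʳ (rational-nonNeg k) (ℚ.<⇒≤ 0<1)
    pow½*rational≤1 : ∀ k → pow ½ k * rational (suc k) ≤ 1ℚ
    pow½*rational≤1 zero    = ℚ.≤-refl
    pow½*rational≤1 (suc k) = ℚ.≤-trans
      (≡.subst (pow ½ (suc k) * rational (suc (suc k)) ≤_)
        (solve 2 (λ P r → (con ½ :* P) :* ((r :+ con 1ℚ) :+ con 1ℚ) :+ (con ½ :* P) :* r := P :* (r :+ con 1ℚ)) ≡.refl (pow ½ k) (rational k))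
        (≤-+ʳ ℚ.≤-refl (*-nonNeg (ℚ.<⇒≤ (pow-pos 0<½ (suc k))) (rational-nonNeg k))))
      (pow½*rational≤1 k)
    pow½≤inv : ∀ k → pow ½ k ≤ inv k
    pow½≤inv k = ≡.subst₂ _≤_
      (≡.trans (ℚ.*-assoc (pow ½ k) (rational (suc k)) (inv k))
        (≡.trans (≡.cong (pow ½ k *_) (≡.trans (ℚ.*-comm (rational (suc k)) (inv k)) (inv-rational k))) (ℚ.*-identityʳ (pow ½ k))))
      (ℚ.*-identityˡ (inv k))
      (ℚ.*-monoʳ-≤-nonNeg (inv k) {{ℚ.nonNegative (ℚ.<⇒≤ (0<inv k))}} (pow½*rational≤1 k))

  recip≤inv : ∀ k → ∣ recip k ∣₁ ≤ inv k
  recip≤inv k = ℚ.≤-reflexive (≡.trans (ℚ.+-identityʳ ∣ inv k ∣) (ℚ.0≤p⇒∣p∣≡p (ℚ.<⇒≤ (0<inv k))))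

  infix 9 _at_
  opaque
    -- The operations on ℂ act termwise on the Cauchy sequences, so fixing an index is an exact
    -- homomorphism: polynomial identities over ℂ turn into equations over ℚ(i), without any
    -- rounding.
    _at_ : ℂ → ℕ → ℚ[i]
    z at i = ⟨ seq (re z) i , seq (im z) i ⟩

  open FinSums gaussian

  opaque
    unfolding _+ᴳ_ _*ᴳ_ _at_
    0ᶜ-at : ∀ i → 0ᶜ at i ≡ 0ᴳ
    0ᶜ-at i = ≡.refl

    1ᶜ-at : ∀ i → 1ᶜ at i ≡ 1ᴳ
    1ᶜ-at i = ≡.refl

    +-at : ∀ z w i → (z +ᶜ w) at i ≡ z at i +ᴳ w at i
    +-at z w i = ≡.refl

    *-at : ∀ z w i → (z *ᶜ w) at i ≡ z at i *ᴳ w at i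
    *-at z w i = ≡.refl

  -- Stated for arbitrary f: unfolding foldr at f = _+ᶜ_ would make Agda
  -- compare the Cauchy proofs inside the complex numbers.
  foldr-suc : ∀ {A : Set} (f : A → A → A) e {n} (x : Vector A (suc n)) → foldr f e x ≡ f (head x) (foldr f e (tail x))
  foldr-suc f e x = ≡.refl

  foldr-at : ∀ {n} (x : Vector ℂ n) i → foldr _+ᶜ_ 0ᶜ x at i ≡ sum (λ a → x a at i)
  foldr-at {zero}  x i = 0ᶜ-at i
  foldr-at {suc n} x i = ≡.trans (≡.cong (_at i) (foldr-suc _+ᶜ_ 0ᶜ x))
    (≡.trans (+-at (head x) (foldr _+ᶜ_ 0ᶜ (tail x)) i) (≡.cong (head x at i +ᴳ_) (foldr-at (tail x) i)))

  ∑-at : ∀ {n} (x : Vector ℂ n) i → ∑ x at i ≡ sum (λ a → x a at i)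
  ∑-at = foldr-at

  δ-at : ∀ {n} (a b : Fin n) i → δ a b at i ≡ indicator a b
  δ-at a b i with does (a Fin.≟ b)
  ... | true  = 1ᶜ-at i
  ... | false = 0ᶜ-at i

  *ᴹ-at : ∀ {n} (M N : Matrix n) a b i → (M *ᴹ N) a b at i ≡ sum (λ c → M a c at i *ᴳ N c b at i)
  *ᴹ-at M N a b i = ≡.trans (∑-at (λ c → M a c *ᶜ N c b) i) (sum-cong-≋ (λ c → *-at (M a c) (N c b) i))

  *ᵛ-at : ∀ {n} (M : Matrix n) x a i → (M *ᵛ x) a at i ≡ sum (λ c → M a c at i *ᴳ x c at i)
  *ᵛ-at M x a i = ≡.trans (∑-at (λ c → M a c *ᶜ x c) i) (sum-cong-≋ (λ c → *-at (M a c) (x c) i))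

  *ᵛ𝐞-at : ∀ {n} (M : Matrix n) a u i → (M *ᵛ 𝐞 u) a at i ≡ M a u at i
  *ᵛ𝐞-at M a u i = begin
    (M *ᵛ 𝐞 u) a at i                        ≡⟨ *ᵛ-at M (𝐞 u) a i ⟩
    sum (λ c → M a c at i *ᴳ 𝐞 u c at i)     ≡⟨ sum-cong-≋ (λ c → ≡.cong (M a c at i *ᴳ_) (δ-at c u i)) ⟩
    sum (λ c → M a c at i *ᴳ indicator c u)  ≡⟨ sum-cong-≋ (λ c → *-comm (M a c at i) (indicator c u)) ⟩
    sum (λ c → indicator c u *ᴳ M a c at i)  ≡⟨ sum-indicator (λ c → M a c at i) u ⟩
    M a u at i                               ∎
    where
    open ≡.≡-Reasoning
    open CommutativeSemiring gaussian using (*-comm)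

  opaque
    unfolding _at_
    at-bounded : ∀ z → ∃[ C ] 0ℚ < C × (∀ i → ∣ z at i ∣₁ ≤ C)
    at-bounded z =
      let B , 0<B , hB = bounded (re z)
          C , 0<C , hC = bounded (im z)
      in B + C , ℚ.+-mono-< 0<B 0<C , λ i → ℚ.+-mono-≤ (hB i) (hC i)

-- Operator-valued characters and the diagonalisation of circulant matrices

triangular : ℕ → ℕ
triangular zero    = 0
triangular (suc k) = triangular k ℕ.+ k

-- For p = 1 + 2h the total twist 0 + 1 + ... + (p - 1) is hp, a multiple of p, so the powers of ζ
-- cancel in the product over all twists.
triangular-odd : ∀ h → triangular (1 ℕ.+ h ℕ.* 2) ≡ h ℕ.* (1 ℕ.+ h ℕ.* 2)
triangular-odd zero    = ≡.refl
triangular-odd (suc h) = ≡.trans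
  (≡.cong (λ t → t ℕ.+ (1 ℕ.+ h ℕ.* 2) ℕ.+ (2 ℕ.+ h ℕ.* 2)) (triangular-odd h)) (lemma h)
  where
  lemma : ∀ h → h ℕ.* (1 ℕ.+ h ℕ.* 2) ℕ.+ (1 ℕ.+ h ℕ.* 2) ℕ.+ (2 ℕ.+ h ℕ.* 2) ≡ (1 ℕ.+ h) ℕ.* (3 ℕ.+ h ℕ.* 2)
  lemma = ℕ-Solver.solve-∀

module Characters (𝕜 : CommutativeSemiring 0ℓ 0ℓ) (n p : ℕ) where
  private module K = CommutativeSemiring 𝕜
  private module KS = FinSums 𝕜
  open Operators 𝕜 n p
  open CommutativeSemiring operators
  open Series operators
  open FinSums operators
  open import Relation.Binary.Reasoning.Setoid setoid
  open import Algebra.Solver.Ring.NaturalCoefficients.Default operators using (solve; _:=_; _:*_)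

  scalar-sum : ∀ {l} (x : Vector K.Carrier l) → scalar (KS.sum x) ≈ sum (scalar ∘ x)
  scalar-sum {zero}  x = refl
  scalar-sum {suc l} x = trans (scalar-+ (x Fin.zero) _) (+-congˡ (scalar-sum (x ∘ Fin.suc)))

  scalar-indicator : ∀ {l} (a u : Fin l) → scalar (KS.indicator a u) ≈ indicator a u
  scalar-indicator a u with does (a Fin.≟ u)
  ... | true  = refl
  ... | false = refl

  -- The Fourier coefficient of the vector `x` at the character `F`, whose values are operators.
  combination : (ℕ → Operator) → Vector K.Carrier n → Operator
  combination F x = sum {n} (λ a → scalar (x a) * F (toℕ a))

  combination-cong : ∀ F {x y} → (∀ a → x a K.≈ y a) → combination F x ≈ combination F y
  combination-cong F x≈y = sum-cong-≋ {n} (λ a → *-congʳ (scalar-cong (x≈y a)))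

  combination-0 : ∀ F → combination F (λ _ → K.0#) ≈ 0#
  combination-0 F = sum-zero {n} (λ a → 0# * F (toℕ a)) (λ a → zeroˡ (F (toℕ a)))

  combination-+ : ∀ F x y → combination F (λ a → x a K.+ y a) ≈ combination F x + combination F y
  combination-+ F x y = trans
    (sum-cong-≋ {n} (λ a → trans (*-congʳ (scalar-+ (x a) (y a))) (distribʳ (F (toℕ a)) (scalar (x a)) (scalar (y a)))))
    (∑-distrib-+ (λ a → scalar (x a) * F (toℕ a)) (λ a → scalar (y a) * F (toℕ a)))

  combination-* : ∀ F c x → combination F (λ a → c K.* x a) ≈ scalar c * combination F x
  combination-* F c x = trans
    (sum-cong-≋ {n} (λ a → trans (*-congʳ (scalar-* c (x a))) (*-assoc (scalar c) (scalar (x a)) (F (toℕ a)))))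
    (sym (*-distribˡ-sum {n} (scalar c) (λ a → scalar (x a) * F (toℕ a))))

  combination-indicator : ∀ F u → combination F (λ a → KS.indicator a u) ≈ F (toℕ u)
  combination-indicator F u = trans (sum-cong-≋ {n} (λ a → *-congʳ (scalar-indicator a u))) (sum-indicator (F ∘ toℕ) u)

  record IsCharacter (F : ℕ → Operator) : Set where
    field
      homo   : ∀ c d → F (c ℕ.+ d) ≈ F c * F d
      period : F n ≈ 1#

    homo-0 : F 0 ≈ 1#
    homo-0 = begin
      F 0        ≈⟨ *-identityʳ _ ⟨
      F 0 * 1#   ≈⟨ *-congˡ period ⟨
      F 0 * F n  ≈⟨ homo 0 n ⟨
      F n        ≈⟨ period ⟩
      1#         ∎

    periodic : ∀ c → F (c ℕ.+ n) ≈ F c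
    periodic c = trans (homo c n) (trans (*-congˡ period) (*-identityʳ _))

  -- The eigenvalue at the character `F` of the circulant matrix given by `χ`. For `character 1 k`
  -- it is the twisted matrix of the overview.
  connection : (ℕ → Operator) → (ℕ → K.Carrier) → Operator
  connection F χ = Σ< n (λ s → scalar (χ s) * F s)

  module _ {F : ℕ → Operator} (isCharacter : IsCharacter F)
           {χ : ℕ → K.Carrier} (χ-periodic : ∀ c → χ (c ℕ.+ n) K.≈ χ c) where
    open IsCharacter isCharacter

    -- A character is a left eigenvector: the substitution of a + c for a moves column c onto `χ`.
    -- Here `n ℕ.∸ toℕ c` stands for -c.
    circulant-column : ∀ (c : Fin n) →
      sum {n} (λ a → scalar (χ (toℕ a ℕ.+ (n ℕ.∸ toℕ c))) * F (toℕ a)) ≈ F (toℕ c) * connection F χ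
    circulant-column c = begin
      sum {n} (λ a → g (toℕ a))                              ≈⟨ sum≈Σ< n g ⟩
      Σ< n g                                             ≈⟨ Σ<-rotate n d g g-periodic ⟨
      Σ< n (λ a → g (a ℕ.+ d))                           ≈⟨ Σ<-cong n (λ a _ → rotated a) ⟩
      Σ< n (λ a → F d * (scalar (χ a) * F a))            ≈⟨ *-Σ< n (F d) _ ⟨
      F d * connection F χ                               ∎
      where
      d = toℕ c
      g : ℕ → Operator
      g a = scalar (χ (a ℕ.+ (n ℕ.∸ d))) * F a
      swap : ∀ a b c → a ℕ.+ b ℕ.+ c ≡ a ℕ.+ c ℕ.+ b
      swap = ℕ-Solver.solve-∀
      g-periodic : ∀ a → g (a ℕ.+ n) ≈ g a
      g-periodic a = *-cong
        (scalar-cong (K.trans (K.reflexive (≡.cong χ (swap a n (n ℕ.∸ d)))) (χ-periodic (a ℕ.+ (n ℕ.∸ d)))))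
        (periodic a)
      rotated : ∀ a → g (a ℕ.+ d) ≈ F d * (scalar (χ a) * F a)
      rotated a = begin
        scalar (χ (a ℕ.+ d ℕ.+ (n ℕ.∸ d))) * F (a ℕ.+ d)
          ≈⟨ *-cong (scalar-cong (K.trans (K.reflexive (≡.cong χ (≡.trans (ℕ.+-assoc a d _) (≡.cong (a ℕ.+_) (ℕ.m+[n∸m]≡n (ℕ.<⇒≤ (toℕ<n c))))))) (χ-periodic a)))
                    (homo a d) ⟩
        scalar (χ a) * (F a * F d)
          ≈⟨ solve 3 (λ x y z → x :* (y :* z) := z :* (x :* y)) refl (scalar (χ a)) (F a) (F d) ⟩
        F d * (scalar (χ a) * F a) ∎

    module _ (A : Fin n → Fin n → K.Carrier) (A-circulant : ∀ a c → A a c K.≈ χ (toℕ a ℕ.+ (n ℕ.∸ toℕ c)))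
             (τ : K.Carrier) where

      -- Interchanging the sums applies the left eigenvector to each column of `A`, so the Fourier
      -- coefficient turns the matrix into its eigenvalue.
      combination-step : ∀ y → combination F (λ a → KS.sum (λ c → (τ K.* A a c) K.* y c))
                               ≈ (scalar τ * connection F χ) * combination F y
      combination-step y = begin
        sum {n} (λ a → scalar (KS.sum (λ c → (τ K.* A a c) K.* y c)) * F (toℕ a))
          ≈⟨ sum-cong-≋ {n} (λ a → trans (*-congʳ (scalar-sum {n} (λ c → (τ K.* A a c) K.* y c)))
                                     (*-distribʳ-sum (F (toℕ a)) (λ c → scalar ((τ K.* A a c) K.* y c)))) ⟩
        sum {n} (λ a → sum {n} (λ c → scalar ((τ K.* A a c) K.* y c) * F (toℕ a)))
          ≈⟨ ∑-comm (λ a c → scalar ((τ K.* A a c) K.* y c) * F (toℕ a)) ⟩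
        sum {n} (λ c → sum {n} (λ a → scalar ((τ K.* A a c) K.* y c) * F (toℕ a)))
          ≈⟨ sum-cong-≋ {n} (λ c → sum-cong-≋ {n} (λ a → entry a c)) ⟩
        sum {n} (λ c → sum {n} (λ a → (scalar τ * scalar (y c)) * (scalar (χ (toℕ a ℕ.+ (n ℕ.∸ toℕ c))) * F (toℕ a))))
          ≈⟨ sum-cong-≋ {n} (λ c → *-distribˡ-sum {n} (scalar τ * scalar (y c)) (λ a → scalar (χ (toℕ a ℕ.+ (n ℕ.∸ toℕ c))) * F (toℕ a))) ⟨
        sum {n} (λ c → (scalar τ * scalar (y c)) * sum {n} (λ a → scalar (χ (toℕ a ℕ.+ (n ℕ.∸ toℕ c))) * F (toℕ a)))
          ≈⟨ sum-cong-≋ {n} (λ c → trans (*-congˡ (circulant-column c))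
               (solve 4 (λ t y f b → (t :* y) :* (f :* b) := (t :* b) :* (y :* f)) refl (scalar τ) (scalar (y c)) (F (toℕ c)) (connection F χ))) ⟩
        sum {n} (λ c → (scalar τ * connection F χ) * (scalar (y c) * F (toℕ c)))
          ≈⟨ *-distribˡ-sum {n} (scalar τ * connection F χ) (λ c → scalar (y c) * F (toℕ c)) ⟨
        (scalar τ * connection F χ) * combination F y ∎
        where
        entry : ∀ a c → scalar ((τ K.* A a c) K.* y c) * F (toℕ a)
                      ≈ (scalar τ * scalar (y c)) * (scalar (χ (toℕ a ℕ.+ (n ℕ.∸ toℕ c))) * F (toℕ a))
        entry a c = begin
          scalar ((τ K.* A a c) K.* y c) * F (toℕ a)
            ≈⟨ *-congʳ (trans (scalar-* _ (y c)) (*-congʳ (trans (scalar-* τ (A a c)) (*-congˡ (scalar-cong (A-circulant a c)))))) ⟩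
          ((scalar τ * scalar (χ (toℕ a ℕ.+ (n ℕ.∸ toℕ c)))) * scalar (y c)) * F (toℕ a)
            ≈⟨ solve 4 (λ t x y f → ((t :* x) :* y) :* f := (t :* y) :* (x :* f)) refl (scalar τ) _ (scalar (y c)) (F (toℕ a)) ⟩
          (scalar τ * scalar (y c)) * (scalar (χ (toℕ a ℕ.+ (n ℕ.∸ toℕ c))) * F (toℕ a)) ∎

      module _ (r : ℕ → K.Carrier) (r-inverse : ∀ k → scalar (r k) * natural (suc k) ≈ 1#)
               (u : Fin n) (x : ℕ → Vector K.Carrier n)
               (x-zero : ∀ a → x 0 a K.≈ KS.indicator a u)
               (x-suc : ∀ k a → x (suc k) a K.≈ r k K.* KS.sum (λ c → (τ K.* A a c) K.* x k c)) where
        open Exponential (scalar ∘ r) r-inverse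

        -- The hypotheses make `x k` column `u` of the k-th term of the exponential series of τA.
        -- The point mass at `u` transforms to F(u), and each further term multiplies by the
        -- eigenvalue and by 1/(k + 1).
        combination-term : ∀ k → combination F (x k) ≈ F (toℕ u) * term (scalar τ * connection F χ) k
        combination-term zero    = trans (combination-cong F x-zero)
          (trans (combination-indicator F u) (sym (*-identityʳ (F (toℕ u)))))
        combination-term (suc k) = begin
          combination F (x (suc k))
            ≈⟨ trans (combination-cong F (x-suc k)) (combination-* F (r k) _) ⟩
          scalar (r k) * combination F (λ a → KS.sum (λ c → (τ K.* A a c) K.* x k c))
            ≈⟨ *-congˡ (trans (combination-step (x k)) (*-congˡ (combination-term k))) ⟩
          scalar (r k) * (B * (F (toℕ u) * term B k))
            ≈⟨ solve 4 (λ r b f t → r :* (b :* (f :* t)) := f :* (r :* (b :* t))) refl (scalar (r k)) B (F (toℕ u)) (term B k) ⟩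
          F (toℕ u) * term B (suc k) ∎
          where B = scalar τ * connection F χ

        combination-expSum : ∀ N (X : Vector K.Carrier n) → (∀ a → X a K.≈ Series.Σ< 𝕜 N (λ k → x k a)) →
          combination F X ≈ F (toℕ u) * expSum N (scalar τ * connection F χ)
        combination-expSum N X X≈ = trans (combination-cong F X≈) (go N)
          where
          go : ∀ N → combination F (λ a → Series.Σ< 𝕜 N (λ k → x k a)) ≈ F (toℕ u) * expSum N (scalar τ * connection F χ)
          go zero    = trans (combination-0 F) (sym (zeroʳ (F (toℕ u))))
          go (suc N) = trans (combination-+ F _ (x N)) (trans (+-cong (go N) (combination-term N))
            (sym (distribˡ (F (toℕ u)) _ _)))

  -- Substituting n - s for s exchanges the character with its inverse and fixes an even `χ`; equal
  -- values at n and 0 close the cycle.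
  connection-negate : ∀ {F F⁻ χ} → IsCharacter F → IsCharacter F⁻ → (∀ c → F⁻ c * F c ≈ 1#) →
    χ n K.≈ χ 0 → (∀ c → c ℕ.< n → χ (n ℕ.∸ c) K.≈ χ c) → connection F⁻ χ ≈ connection F χ
  connection-negate {F} {F⁻} {χ} isF isF⁻ inverse χn≈χ0 χ-even = begin
    Σ< n g                   ≈⟨ Σ<-negate n g (*-cong (scalar-cong χn≈χ0) (trans F⁻.period (sym F⁻.homo-0))) ⟨
    Σ< n (λ s → g (n ℕ.∸ s)) ≈⟨ Σ<-cong n (λ s s<n → *-cong (scalar-cong (χ-even s s<n)) (F⁻≈F s (ℕ.<⇒≤ s<n))) ⟩
    connection F χ           ∎
    where
    module F⁻ = IsCharacter isF⁻
    g : ℕ → Operator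
    g s = scalar (χ s) * F⁻ s
    F⁻≈F : ∀ s → s ℕ.≤ n → F⁻ (n ℕ.∸ s) ≈ F s
    F⁻≈F s s≤n = begin
      F⁻ (n ℕ.∸ s)                   ≈⟨ *-identityʳ _ ⟨
      F⁻ (n ℕ.∸ s) * 1#              ≈⟨ *-congˡ (inverse s) ⟨
      F⁻ (n ℕ.∸ s) * (F⁻ s * F s)    ≈⟨ *-assoc _ _ _ ⟨
      (F⁻ (n ℕ.∸ s) * F⁻ s) * F s    ≈⟨ *-congʳ (F⁻.homo (n ℕ.∸ s) s) ⟨
      F⁻ (n ℕ.∸ s ℕ.+ s) * F s       ≈⟨ *-congʳ (trans (reflexive (≡.cong F⁻ (ℕ.m∸n+n≡m s≤n))) F⁻.period) ⟩
      1# * F s                       ≈⟨ *-identityˡ _ ⟩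
      F s                            ∎

  -- The character sending c to T to the lc times ζ to the kc. The values used are l = 1, and l = n
  -- - 1 for the inverse translation.
  character : ℕ → ℕ → ℕ → Operator
  character l k c = shift (l ℕ.* c) (k ℕ.* c)

  module _ (m : ℕ) (n≡m*p : n ≡ m ℕ.* p) where

    character-isCharacter : ∀ l k → IsCharacter (character l k)
    character-isCharacter l k = record
      { homo   = λ c d → trans (reflexive (≡.cong₂ shift (ℕ.*-distribˡ-+ l c d) (ℕ.*-distribˡ-+ k c d)))
                               (sym (shift-+ (l ℕ.* c) (k ℕ.* c) (l ℕ.* d) (k ℕ.* d)))
      ; period = trans (reflexive (≡.cong (shift (l ℕ.* n)) (≡.trans (≡.cong (k ℕ.*_) n≡m*p) (≡.sym (ℕ.*-assoc k m p)))))
                       (shift-period l (k ℕ.* m))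
      }

  -- After the sums are exchanged, each s in the support carries the full sum of the powers of ζ to
  -- the s, which is the coset sum of an admissible function.
  connections-cancel : ∀ χ → (∀ s → χ s K.≈ K.0# ⊎ ¬ (p ∣ s)) →
    Σ< p (λ k → connection (character 1 k) χ) ≈ 0#
  connections-cancel χ support = trans (Σ<-comm p n _) (Σ<-zero n λ s _ → begin
    Σ< p (λ k → scalar (χ s) * character 1 k s)  ≈⟨ *-Σ< p (scalar (χ s)) _ ⟨
    scalar (χ s) * Σ< p (λ k → character 1 k s)  ≈⟨ vanish s (support s) ⟩
    0#                                           ∎)
    where
    vanish : ∀ s → χ s K.≈ K.0# ⊎ ¬ (p ∣ s) → scalar (χ s) * Σ< p (λ k → character 1 k s) ≈ 0#
    vanish s (inj₁ χs≈0) = trans (*-congʳ (scalar-cong χs≈0)) (zeroˡ _)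
    vanish s (inj₂ p∤s)  = trans (*-congˡ (mk≋ λ {φ} A a b →
      K.trans (act-OΣ< p (λ k → character 1 k s) φ a b)
        (K.trans (Admissible.coset-sum A s p∤s (a ℕ.+ 1 ℕ.* s) b) (K.sym (K.zeroˡ _)))))
      (zeroʳ _)

  Π<-character : ∀ K c → Π< K (λ k → character 1 k c) ≈ shift (K ℕ.* c) (triangular K ℕ.* c)
  Π<-character zero    c = sym shift-0
  Π<-character (suc K) c = trans (*-congʳ (Π<-character K c))
    (trans (shift-+ (K ℕ.* c) (triangular K ℕ.* c) (1 ℕ.* c) (K ℕ.* c))
      (reflexive (≡.cong₂ shift (lemma K c) (≡.sym (ℕ.*-distribʳ-+ c (triangular K) K)))))
    where
    lemma : ∀ K c → K ℕ.* c ℕ.+ 1 ℕ.* c ≡ (1 ℕ.+ K) ℕ.* c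
    lemma = ℕ-Solver.solve-∀

  Π<-character-odd : ∀ h → p ≡ 1 ℕ.+ h ℕ.* 2 → ∀ c → Π< p (λ k → character 1 k c) ≈ shift (p ℕ.* c) 0
  Π<-character-odd h p≡ c = begin
    Π< p (λ k → character 1 k c)                      ≈⟨ Π<-character p c ⟩
    shift (p ℕ.* c) (triangular p ℕ.* c)              ≈⟨ reflexive (≡.cong₂ shift (≡.sym (ℕ.+-identityʳ _)) even) ⟩
    shift (p ℕ.* c ℕ.+ 0 ℕ.* n) (0 ℕ.+ (c ℕ.* h) ℕ.* p)  ≈⟨ shift-+ (p ℕ.* c) 0 (0 ℕ.* n) ((c ℕ.* h) ℕ.* p) ⟨
    shift (p ℕ.* c) 0 * shift (0 ℕ.* n) ((c ℕ.* h) ℕ.* p) ≈⟨ *-congˡ (shift-period 0 (c ℕ.* h)) ⟩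
    shift (p ℕ.* c) 0 * 1#                            ≈⟨ *-identityʳ _ ⟩
    shift (p ℕ.* c) 0                                 ∎
    where
    even : triangular p ℕ.* c ≡ 0 ℕ.+ (c ℕ.* h) ℕ.* p
    even = ≡.trans (≡.cong (ℕ._* c) (≡.trans (≡.cong triangular p≡) (≡.trans (triangular-odd h) (≡.cong (h ℕ.*_) (≡.sym p≡)))))
      (lemma h p c)
      where
      lemma : ∀ h p c → h ℕ.* p ℕ.* c ≡ (c ℕ.* h) ℕ.* p
      lemma = ℕ-Solver.solve-∀

-- Congruences modulo n and an admissible test function

prime∤⇒coprime : ∀ {p s} → Prime p → ¬ (p ∣ s) → Coprime s p
prime∤⇒coprime p-prime p∤s (d∣s , d∣p) with prime⇒irreducible p-prime d∣p
... | inj₁ d≡1 = d≡1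
... | inj₂ ≡.refl = contradiction d∣s p∤s

module CosetSums {A : Set} (g : ℕ → A) {s p} (coprime : Coprime s p)
  (g-s : ∀ b → g (b ℕ.+ s) ≡ g b) (g-p : ∀ b → g (b ℕ.+ p) ≡ g b) where

  private
    multiple : ∀ d → (∀ b → g (b ℕ.+ d) ≡ g b) → ∀ x b → g (b ℕ.+ x ℕ.* d) ≡ g b
    multiple d g-d zero    b = ≡.cong g (ℕ.+-identityʳ b)
    multiple d g-d (suc x) b = ≡.trans (≡.cong g (≡.trans (≡.cong (b ℕ.+_) (ℕ.+-comm d (x ℕ.* d))) (≡.sym (ℕ.+-assoc b _ d))))
      (≡.trans (g-d (b ℕ.+ x ℕ.* d)) (multiple d g-d x b))

  -- By Bézout, 1 plus a multiple of one period is a multiple of the other, so 1 is a period too.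
  invariant : ∀ b → g (b ℕ.+ 1) ≡ g b
  invariant b with coprime-Bézout coprime
  ... | Bézout.+- x y eq = ≡.trans (≡.sym (multiple p g-p y (b ℕ.+ 1)))
    (≡.trans (≡.cong g (≡.trans (ℕ.+-assoc b 1 _) (≡.cong (b ℕ.+_) eq))) (multiple s g-s x b))
  ... | Bézout.-+ x y eq = ≡.trans (≡.sym (multiple s g-s x (b ℕ.+ 1)))
    (≡.trans (≡.cong g (≡.trans (ℕ.+-assoc b 1 _) (≡.cong (b ℕ.+_) eq))) (multiple p g-p y b))

-- With n = ν + 1, multiplication by ν is negation modulo n.
congruences⇒≡ : ∀ ν {p} h → p ≡ 1 ℕ.+ h ℕ.* 2 → ∀ {u v} → u ℕ.< suc ν → v ℕ.< suc ν →
  suc ν ∣ ν ℕ.* (p ℕ.* u) ℕ.+ p ℕ.* v → suc ν ∣ (u ℕ.+ ν ℕ.* v) ℕ.+ (u ℕ.+ ν ℕ.* v) → u ≡ v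
congruences⇒≡ ν {p} h ≡.refl {u} {v} u<n v<n n∣pX n∣2Y
  with ∣m+n∣m⇒∣n (≡.subst (suc ν ∣_) (split ν h u v) n∣pX) (∣n⇒∣m*n h n∣2X)
  where
  -- Put X = νu + v, which is v - u modulo n, and Y = u + νv, which is u - v. Then 2X + 2Y is a
  -- multiple of n, hence n divides 2X, and pX = h(2X) + X leaves X itself.
  split : ∀ ν h u v → ν ℕ.* ((1 ℕ.+ h ℕ.* 2) ℕ.* u) ℕ.+ (1 ℕ.+ h ℕ.* 2) ℕ.* v
          ≡ h ℕ.* (2 ℕ.* (ν ℕ.* u ℕ.+ v)) ℕ.+ (ν ℕ.* u ℕ.+ v)
  split = ℕ-Solver.solve-∀
  total : ∀ ν u v → 2 ℕ.* (u ℕ.+ v) ℕ.* (1 ℕ.+ ν) ≡ ((u ℕ.+ ν ℕ.* v) ℕ.+ (u ℕ.+ ν ℕ.* v)) ℕ.+ 2 ℕ.* (ν ℕ.* u ℕ.+ v)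
  total = ℕ-Solver.solve-∀
  n∣2X : suc ν ∣ 2 ℕ.* (ν ℕ.* u ℕ.+ v)
  n∣2X = ∣m+n∣m⇒∣n (≡.subst (suc ν ∣_) (total ν u v) (n∣m*n (2 ℕ.* (u ℕ.+ v)))) n∣2Y
... | divides q X≡qn = begin
  u                              ≡⟨ m<n⇒m%n≡m u<n ⟨
  u % suc ν                      ≡⟨ [m+kn]%n≡m%n u q (suc ν) ⟨
  (u ℕ.+ q ℕ.* suc ν) % suc ν    ≡⟨ ≡.cong (λ x → (u ℕ.+ x) % suc ν) X≡qn ⟨
  (u ℕ.+ (ν ℕ.* u ℕ.+ v)) % suc ν  ≡⟨ ≡.cong (_% suc ν) (regroup ν u v) ⟩
  (v ℕ.+ u ℕ.* suc ν) % suc ν    ≡⟨ [m+kn]%n≡m%n v u (suc ν) ⟩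
  v % suc ν                      ≡⟨ m<n⇒m%n≡m v<n ⟩
  v                              ∎
  where
  open ≡.≡-Reasoning
  regroup : ∀ ν u v → u ℕ.+ (ν ℕ.* u ℕ.+ v) ≡ v ℕ.+ u ℕ.* (1 ℕ.+ ν)
  regroup = ℕ-Solver.solve-∀

module TestFunction (n p : ℕ) (p-prime : Prime p) where
  open GaussianRationals
  open CommutativeSemiring gaussian using (zeroˡ; zeroʳ; *-identityˡ)
  open Series gaussian
  open Operators gaussian n p using (Admissible)

  divisible : ℕ → ℕ → ℚ[i]
  divisible d a = if does (d ∣? a) then 1ᴳ else 0ᴳ

  divisible-yes : ∀ {d a} → d ∣ a → divisible d a ≡ 1ᴳ
  divisible-yes {d} {a} d∣a = ≡.cong (λ b → if b then 1ᴳ else 0ᴳ) (dec-true (d ∣? a) d∣a)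

  divisible-no : ∀ {d a} → ¬ (d ∣ a) → divisible d a ≡ 0ᴳ
  divisible-no {d} {a} d∤a = ≡.cong (λ b → if b then 1ᴳ else 0ᴳ) (dec-false (d ∣? a) d∤a)

  divisible-periodic : ∀ d a → divisible d (a ℕ.+ d) ≡ divisible d a
  divisible-periodic d a with d ∣? a
  ... | yes d∣a = divisible-yes (∣m∣n⇒∣m+n d∣a ∣-refl)
  ... | no  d∤a = divisible-no λ d∣a+d → d∤a (∣m+n∣m⇒∣n (≡.subst (d ∣_) (ℕ.+-comm a d) d∣a+d) ∣-refl)

  divisible-bound : ∀ d a → ∣ divisible d a ∣₁ ℚ.≤ 1ℚ
  divisible-bound d a with does (d ∣? a)
  ... | true  = ℚ.≤-refl
  ... | false = ℚ.<⇒≤ 0<1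

  difference : ℕ → ℚ[i]
  difference b = divisible p (b ℕ.+ 1) -ᴳ divisible p b

  -- The point mass at 0 in ℤₙ detects where a translation lands; taking a difference of point
  -- masses in ℤₚ cancels the coset sums but leaves the value -1 at b = 0.
  test : ℕ → ℕ → ℚ[i]
  test a b = divisible n a *ᴳ difference b

  private
    -- As a function of b the sum has period s, by rotating the range of k, and period p; these are
    -- coprime.
    coset-invariant : ∀ s → ¬ (p ∣ s) → ∀ b →
      Σ< p (λ k → divisible p (b ℕ.+ 1 ℕ.+ k ℕ.* s)) ≡ Σ< p (λ k → divisible p (b ℕ.+ k ℕ.* s))
    coset-invariant s p∤s = CosetSums.invariant (λ b → Σ< p (λ k → divisible p (b ℕ.+ k ℕ.* s)))
      (prime∤⇒coprime p-prime p∤s)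
      (λ b → ≡.trans (Σ<-cong p (λ k _ → ≡.cong (divisible p) (ℕ.+-assoc b s (k ℕ.* s))))
        (Σ<-rotate₁ p (λ k → divisible p (b ℕ.+ k ℕ.* s))
          (≡.trans (≡.cong (λ x → divisible p (b ℕ.+ x)) (ℕ.*-comm p s)) (≡.trans (multiple s b) (≡.cong (divisible p) (≡.sym (ℕ.+-identityʳ b)))))))
      (λ b → Σ<-cong p (λ k _ → ≡.trans (≡.cong (divisible p) (swap b p (k ℕ.* s))) (divisible-periodic p (b ℕ.+ k ℕ.* s))))
      where
      swap : ∀ a b c → a ℕ.+ b ℕ.+ c ≡ a ℕ.+ c ℕ.+ b
      swap = ℕ-Solver.solve-∀
      regroup : ∀ b p y → b ℕ.+ (p ℕ.+ y) ≡ b ℕ.+ y ℕ.+ p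
      regroup = ℕ-Solver.solve-∀
      multiple : ∀ x b → divisible p (b ℕ.+ x ℕ.* p) ≡ divisible p b
      multiple zero    b = ≡.cong (divisible p) (ℕ.+-identityʳ b)
      multiple (suc x) b = ≡.trans (≡.cong (divisible p) (regroup b p (x ℕ.* p)))
        (≡.trans (divisible-periodic p (b ℕ.+ x ℕ.* p)) (multiple x b))

    difference-coset-sum : ∀ s → ¬ (p ∣ s) → ∀ b → Σ< p (λ k → difference (b ℕ.+ k ℕ.* s)) ≡ 0ᴳ
    difference-coset-sum s p∤s b = ≡.trans (Σ<-cong p (λ k _ → ≡.cong (λ x → divisible p x -ᴳ divisible p (b ℕ.+ k ℕ.* s)) (swap b (k ℕ.* s))))
      (Σ<-minus p _ _ (coset-invariant s p∤s b))
      where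
      swap : ∀ a b → a ℕ.+ b ℕ.+ 1 ≡ a ℕ.+ 1 ℕ.+ b
      swap = ℕ-Solver.solve-∀
      Σ<-difference : ∀ N f g → Σ< N (λ k → f k -ᴳ g k) ≡ Σ< N f -ᴳ Σ< N g
      Σ<-difference zero    f g = ≡.sym (minus-self 0ᴳ)
      Σ<-difference (suc N) f g = ≡.trans (≡.cong (_+ᴳ (f N -ᴳ g N)) (Σ<-difference N f g)) (minus-+ (Σ< N f) (Σ< N g) (f N) (g N))
      Σ<-minus : ∀ N f g → Σ< N f ≡ Σ< N g → Σ< N (λ k → f k -ᴳ g k) ≡ 0ᴳ
      Σ<-minus N f g f≡g = ≡.trans (Σ<-difference N f g) (≡.trans (≡.cong (_-ᴳ Σ< N g) f≡g) (minus-self (Σ< N g)))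

  test-admissible : Admissible test
  test-admissible = record
    { periodic₁ = λ a b → ≡.cong (_*ᴳ difference b) (divisible-periodic n a)
    ; periodic₂ = λ a b → ≡.cong (divisible n a *ᴳ_) (≡.cong₂ _-ᴳ_
        (≡.trans (≡.cong (divisible p) (swap b p)) (divisible-periodic p (b ℕ.+ 1))) (divisible-periodic p b))
    ; coset-sum = λ s p∤s a b → ≡.trans (≡.sym (*-Σ< p (divisible n a) (λ k → difference (b ℕ.+ k ℕ.* s))))
        (≡.trans (≡.cong (divisible n a *ᴳ_) (difference-coset-sum s p∤s b)) (zeroʳ (divisible n a)))
    }
    where
    swap : ∀ a b → a ℕ.+ b ℕ.+ 1 ≡ a ℕ.+ 1 ℕ.+ b
    swap = ℕ-Solver.solve-∀

  test-bound : ∀ a b → ∣ test a b ∣₁ ℚ.≤ 1ℚ ℚ.+ 1ℚ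
  test-bound a b = ℚ.≤-trans (∣∣₁-* (divisible n a) (difference b))
    (≡.subst (∣ divisible n a ∣₁ ℚ.* ∣ difference b ∣₁ ℚ.≤_) (ℚ.*-identityˡ (1ℚ ℚ.+ 1ℚ)) (*-mono-≤ (∣∣₁-nonNeg (divisible n a)) (divisible-bound n a) (∣∣₁-nonNeg (difference b))
      (ℚ.≤-trans (∣∣₁-minus (divisible p (b ℕ.+ 1)) (divisible p b)) (ℚ.+-mono-≤ (divisible-bound p (b ℕ.+ 1)) (divisible-bound p b)))))

  test-no : ∀ {a} b → ¬ (n ∣ a) → test a b ≡ 0ᴳ
  test-no b n∤a = ≡.trans (≡.cong (_*ᴳ difference b) (divisible-no n∤a)) (zeroˡ (difference b))

  test-yes : ∀ {a} → n ∣ a → test a 0 ≡ 0ᴳ -ᴳ 1ᴳ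
  test-yes n∣a = ≡.trans (≡.cong (_*ᴳ difference 0) (divisible-yes n∣a)) (≡.trans (*-identityˡ (difference 0))
    (≡.cong₂ _-ᴳ_ (divisible-no p∤1) (divisible-yes (p ∣0))))
    where
    p∤1 : ¬ (p ∣ 1)
    p∤1 p∣1 = contradiction (≡.subst Prime (∣1⇒≡1 p∣1) p-prime) λ ()

-- Approximate columns of the exponential and the rigidity estimate

module CirculantExponential
  (ν m p h : ℕ) (n≡m*p : suc ν ≡ m ℕ.* p) (p-odd : p ≡ 1 ℕ.+ h ℕ.* 2) (p-prime : Prime p)
  (χ : ℕ → GaussianRationals.ℚ[i])
  (χ-periodic : ∀ c → χ (c ℕ.+ suc ν) ≡ χ c)
  (χ-even : ∀ c → c ℕ.< suc ν → χ (suc ν ℕ.∸ c) ≡ χ c)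
  (χ-support : ∀ s → χ s ≡ GaussianRationals.0ᴳ ⊎ ¬ (p ∣ s))
  (χ-bound : ∀ s → GaussianRationals.∣_∣₁ (χ s) ℚ.≤ 1ℚ)
  (A : Fin (suc ν) → Fin (suc ν) → GaussianRationals.ℚ[i])
  (A-circulant : ∀ a c → A a c ≡ χ (toℕ a ℕ.+ (suc ν ℕ.∸ toℕ c)))
  (u v : Fin (suc ν)) where

  private
    n = suc ν
    u′ = toℕ u
    v′ = toℕ v

  open GaussianRationals
  private
    module K = CommutativeSemiring gaussian
    module KΣ = Series gaussian
    module KS = FinSums gaussian
    module ℚS = ℚ-Solver.+-*-Solver
  open Operators gaussian n p
  open OperatorNorm ∣_∣₁ (≡.cong ∣_∣₁) ∣∣₁-nonNeg ≡.refl ∣∣₁-+ ∣∣₁-*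
  open Characters gaussian n p
  open CommutativeSemiring operators
  open Norm operatorNorm using (≼-weaken; 0≼0; +-≼; *-≼)
  open Series operators
  open FinSums operators using (sum)
  open NormedSeries operators operatorNorm
  open TestFunction n p p-prime
  open RationalSums using (∑ℚ; ∑ℚ-nonNeg; pow½-nonNeg)
  open import Relation.Binary.Reasoning.Setoid setoid

  private
    r-inverse : ∀ k → scalar (recip k) * natural (suc k) ≈ 1#
    r-inverse k = scalar-inverse (recip k) (suc k) (recip-inverse k)

    r≼ : ∀ k → scalar (recip k) ≼ inv k
    r≼ k = ≼-weaken (recip≤inv k) (scalar≼ (recip k))

  open Exponential (scalar ∘ recip) r-inverse using (expSum; expSum-cong; expSum-0)
  open NormedExponential (scalar ∘ recip) r-inverse r≼ using (Π<-expSum)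

  sum-≼ : ∀ {l} {f : Vector Operator l} {c} → (∀ a → f a ≼ c) → sum f ≼ l ×ℚ c
  sum-≼ {zero}  f≼c = 0≼0
  sum-≼ {suc l} f≼c = +-≼ (f≼c Fin.zero) (sum-≼ (f≼c ∘ Fin.suc))

  scaled-shift≼ : ∀ z {c} s t → ∣ z ∣₁ ℚ.≤ c → scalar z * shift s t ≼ c
  scaled-shift≼ z {c} s t ∣z∣≤c = ≼-weaken (ℚ.≤-reflexive (ℚ.*-identityʳ c)) (*-≼ (≼-weaken ∣z∣≤c (scalar≼ z)) (shift≼ s t))

  combination-≼ : ∀ l k (x : Vector ℚ[i] n) {ε} → (∀ a → ∣ x a ∣₁ ℚ.≤ ε) → combination (character l k) x ≼ n ×ℚ ε
  combination-≼ l k x x≤ε = sum-≼ (λ a → scaled-shift≼ (x a) (l ℕ.* toℕ a) (k ℕ.* toℕ a) (x≤ε a))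

  evaluate : ∀ {r c} → r ≼ c → ∀ a b → ∣ act r test a b ∣₁ ℚ.≤ c ℚ.* (1ℚ ℚ.+ 1ℚ)
  evaluate r≼c = app≼ r≼c test-admissible test-bound

  -- All that the estimates see of an instance of state transfer, at one index of the Cauchy
  -- sequences and one truncation: `τ` approximates -it, `x k` is the k-th term of column `u`, and
  -- `X` is the truncated column.
  record ColumnApproximation (C T ε : ℚ) (N : ℕ) : Set where
    field
      τ γ    : ℚ[i]
      x      : ℕ → Vector ℚ[i] n
      X      : Vector ℚ[i] n
      x-zero : ∀ a → x 0 a ≡ KS.indicator a u
      x-suc  : ∀ k a → x (suc k) a ≡ recip k *ᴳ KS.sum (λ c → (τ *ᴳ A a c) *ᴳ x k c)
      X-sum  : ∀ a → X a ≡ KΣ.Σ< N (λ k → x k a)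
      τ≤T    : ∣ τ ∣₁ ℚ.≤ T
      γ≤C    : ∣ γ ∣₁ ℚ.≤ C
      close  : ∀ a → ∣ X a -ᴳ γ *ᴳ KS.indicator a v ∣₁ ℚ.≤ ε

    Δ : Vector ℚ[i] n
    Δ a = X a -ᴳ γ *ᴳ KS.indicator a v

    generator : ℕ → ℕ → Operator
    generator l k = scalar τ * connection (character l k) χ

    column : ∀ l k → combination (character l k) X ≈ character l k u′ * expSum N (generator l k)
    column l k = combination-expSum (character-isCharacter m n≡m*p l k) {χ} χ-periodic A A-circulant τ
      recip r-inverse u x x-zero x-suc N X X-sum

    -- The second evaluation of the Fourier coefficients of `X`, from its closeness to γ 𝐞ᵥ;
    -- `column` computes them from the series. Comparing the two drives both estimates.
    split : ∀ l k → combination (character l k) X ≈ scalar γ * character l k v′ + combination (character l k) Δ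
    split l k = begin
      combination F X
        ≈⟨ combination-cong F (λ a → +-minus (X a) (γ *ᴳ KS.indicator a v)) ⟩
      combination F (λ a → γ *ᴳ KS.indicator a v +ᴳ Δ a)
        ≈⟨ combination-+ F (λ a → γ *ᴳ KS.indicator a v) Δ ⟩
      combination F (λ a → γ *ᴳ KS.indicator a v) + combination F Δ
        ≈⟨ +-congʳ (trans (combination-* F γ (λ a → KS.indicator a v)) (*-congˡ (combination-indicator F v))) ⟩
      scalar γ * F v′ + combination F Δ ∎
      where F = character l k

    Δ≼ : ∀ l k → combination (character l k) Δ ≼ n ×ℚ ε
    Δ≼ l k = combination-≼ l k Δ close

  generators-cancel : ∀ τ → Σ< p (λ k → scalar τ * connection (character 1 k) χ) ≈ 0#
  generators-cancel τ = trans (sym (*-Σ< p (scalar τ) (λ k → connection (character 1 k) χ)))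
    (trans (*-congˡ (connections-cancel χ χ-support)) (zeroʳ (scalar τ)))

  negation-inverse : ∀ c → character ν 0 c * character 1 0 c ≈ 1#
  negation-inverse c = begin
    character ν 0 c * character 1 0 c  ≈⟨ shift-+ (ν ℕ.* c) 0 (1 ℕ.* c) 0 ⟩
    shift (ν ℕ.* c ℕ.+ 1 ℕ.* c) 0      ≈⟨ reflexive (≡.cong (λ s → shift s 0) (lemma ν c)) ⟩
    shift (c ℕ.* n) (0 ℕ.* p)          ≈⟨ shift-period c 0 ⟩
    1#                                 ∎
    where
    lemma : ∀ ν c → ν ℕ.* c ℕ.+ 1 ℕ.* c ≡ c ℕ.* (1 ℕ.+ ν)
    lemma = ℕ-Solver.solve-∀

  connection-even : connection (character ν 0) χ ≈ connection (character 1 0) χ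
  connection-even = connection-negate (character-isCharacter m n≡m*p 1 0) (character-isCharacter m n≡m*p ν 0)
    negation-inverse (χ-periodic 0) χ-even

  -- H is symmetric, so H 𝐞ᵤ ≈ γ 𝐞ᵥ puts the entry γ at both v - u and u - v.
  reflection : ∀ {C T ε N} (a : ColumnApproximation C T ε N) → ¬ (n ∣ (u′ ℕ.+ ν ℕ.* v′) ℕ.+ (u′ ℕ.+ ν ℕ.* v′)) →
    ∣ ColumnApproximation.γ a ∣₁ ℚ.≤ (n ×ℚ ε) ℚ.* (1ℚ ℚ.+ 1ℚ) ℚ.+ (n ×ℚ ε) ℚ.* (1ℚ ℚ.+ 1ℚ)
  reflection {ε = ε} {N} approximation n∤ = ≡.subst₂ ℚ._≤_ main≡ (ℚ.+-identityˡ _)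
    (ℚ.≤-trans (transfer {y = 0ᴳ} equation)
      (ℚ.+-monoʳ-≤ 0ℚ (ℚ.+-mono-≤ (evaluate (shifted≼ (Δ≼ ν 0) (1 ℕ.* u′)) a₀ 0)
                                   (evaluate (shifted≼ (Δ≼ 1 0) (ν ℕ.* u′)) a₀ 0))))
    where
    open ColumnApproximation approximation
    F  = character 1 0
    F⁻ = character ν 0
    -- This represents u - v. Translation by v - u brings it to 0, where the test function is -1;
    -- translation by u - v brings it to 2(u - v), where it vanishes by assumption.
    a₀ = u′ ℕ.+ ν ℕ.* v′
    e : Operator
    e = expSum N (generator 1 0)
    shifted≼ : ∀ {r c} → r ≼ c → ∀ s → shift s 0 * r ≼ c
    shifted≼ {c = c} r≼c s = ≼-weaken (ℚ.≤-reflexive (ℚ.*-identityˡ c)) (*-≼ (shift≼ s 0) r≼c)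
    -- By evenness of `χ` both Fourier coefficients carry the same exponential `e`, so multiplying
    -- crosswise by the characters at `u` makes them agree.
    swapped : F⁻ u′ * combination F X ≈ F u′ * combination F⁻ X
    swapped = begin
      F⁻ u′ * combination F X       ≈⟨ *-congˡ (column 1 0) ⟩
      F⁻ u′ * (F u′ * e)            ≈⟨ *-assoc (F⁻ u′) (F u′) e ⟨
      (F⁻ u′ * F u′) * e            ≈⟨ *-congʳ (*-comm (F⁻ u′) (F u′)) ⟩
      (F u′ * F⁻ u′) * e            ≈⟨ *-assoc (F u′) (F⁻ u′) e ⟩
      F u′ * (F⁻ u′ * e)            ≈⟨ *-congˡ (*-congˡ (expSum-cong N (*-congˡ (sym connection-even)))) ⟩
      F u′ * (F⁻ u′ * expSum N (generator ν 0)) ≈⟨ *-congˡ (column ν 0) ⟨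
      F u′ * combination F⁻ X       ∎
    expanded : F⁻ u′ * (scalar γ * F v′) + F⁻ u′ * combination F Δ
             ≈ F u′ * (scalar γ * F⁻ v′) + F u′ * combination F⁻ Δ
    expanded = begin
      F⁻ u′ * (scalar γ * F v′) + F⁻ u′ * combination F Δ   ≈⟨ distribˡ (F⁻ u′) _ _ ⟨
      F⁻ u′ * (scalar γ * F v′ + combination F Δ)           ≈⟨ *-congˡ (split 1 0) ⟨
      F⁻ u′ * combination F X                               ≈⟨ swapped ⟩
      F u′ * combination F⁻ X                               ≈⟨ *-congˡ (split ν 0) ⟩
      F u′ * (scalar γ * F⁻ v′ + combination F⁻ Δ)          ≈⟨ distribˡ (F u′) _ _ ⟩
      F u′ * (scalar γ * F⁻ v′) + F u′ * combination F⁻ Δ   ∎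
    main≡ : ∣ act (F⁻ u′ * (scalar γ * F v′)) test a₀ 0 ∣₁ ≡ ∣ γ ∣₁
    main≡ = ≡.trans (≡.cong (λ w → ∣ γ *ᴳ w ∣₁) (test-yes (divides (u′ ℕ.+ v′) (lemma ν u′ v′)))) (∣∣₁-*-minus-one γ)
      where
      lemma : ∀ ν u v → u ℕ.+ ν ℕ.* v ℕ.+ ν ℕ.* u ℕ.+ 1 ℕ.* v ≡ (u ℕ.+ v) ℕ.* (1 ℕ.+ ν)
      lemma = ℕ-Solver.solve-∀
    other≡ : act (F u′ * (scalar γ * F⁻ v′)) test a₀ 0 ≡ 0ᴳ
    other≡ = ≡.trans (≡.cong (γ *ᴳ_) (test-no _ (λ n∣ → n∤ (≡.subst (n ∣_) (lemma ν u′ v′) n∣)))) (K.zeroʳ γ)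
      where
      lemma : ∀ ν u v → u ℕ.+ ν ℕ.* v ℕ.+ 1 ℕ.* u ℕ.+ ν ℕ.* v ≡ (u ℕ.+ ν ℕ.* v) ℕ.+ (u ℕ.+ ν ℕ.* v)
      lemma = ℕ-Solver.solve-∀
    equation : act (F⁻ u′ * (scalar γ * F v′)) test a₀ 0 +ᴳ act (F⁻ u′ * combination F Δ) test a₀ 0
             ≡ 0ᴳ +ᴳ act (F u′ * combination F⁻ Δ) test a₀ 0
    equation = ≡.trans (app expanded test-admissible a₀ 0) (≡.cong (_+ᴳ act (F u′ * combination F⁻ Δ) test a₀ 0) other≡)

  private
    2ℚ 4ℚ 7ℚ 8ℚ : ℚ
    2ℚ = 1ℚ ℚ.+ 1ℚ
    4ℚ = ℤ.+ 4 ℚ./ 1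
    7ℚ = ℤ.+ 7 ℚ./ 1
    8ℚ = ℤ.+ 8 ℚ./ 1

    generatorBound : ℚ → ℚ
    generatorBound T = T ℚ.* ∑ℚ n (λ _ → 1ℚ)

    0<generatorBound : ∀ {T} → 0ℚ ℚ.< T → 0ℚ ℚ.< generatorBound T
    0<generatorBound 0<T = *-pos 0<T (ℚ.<-≤-trans 0<1 (≤-+ˡ ℚ.≤-refl (∑ℚ-nonNeg ν (λ _ → ℚ.<⇒≤ 0<1))))

    generator≼ : ∀ {τ T} → ∣ τ ∣₁ ℚ.≤ T → ∀ l k → scalar τ * connection (character l k) χ ≼ generatorBound T
    generator≼ {τ} τ≤T l k = *-≼ (≼-weaken τ≤T (scalar≼ τ)) (Σ<-≼ n (λ s → scaled-shift≼ (χ s) (l ℕ.* s) (k ℕ.* s) (χ-bound s)))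

  -- The product over k of the twisted columns is exp 0 = 1 up to truncation,
  -- and (γ F_k(v))ₖ multiplies to γᵖ times translation by p v.
  norm : ∀ {C T} (0≤C : 0ℚ ℚ.≤ C) (0<T : 0ℚ ℚ.< T) {ε N} → ColumnApproximation C T ε (suc N) →
    0ℚ ℚ.≤ n ×ℚ ε → n ×ℚ ε ℚ.≤ 1ℚ → ¬ (n ∣ ν ℕ.* (p ℕ.* u′) ℕ.+ p ℕ.* v′) →
    1ℚ ℚ.≤ ((n ×ℚ ε) ℚ.* proj₁ (Π<-perturb p C 0≤C)) ℚ.* 2ℚ
         ℚ.+ (pow ½ (suc N) ℚ.* proj₁ (Π<-expSum p (0<generatorBound 0<T))) ℚ.* 2ℚ
  norm {C} {T} 0≤C 0<T {ε} {N} approximation 0≤η η≤1 n∤ = ≡.subst₂ ℚ._≤_ main≡ (ℚ.+-identityˡ _)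
    (ℚ.≤-trans (transfer {y = 0ᴳ} equation)
      (ℚ.+-monoʳ-≤ 0ℚ (ℚ.+-mono-≤ (evaluate D₁≼ a₀ 0) (evaluate shifted-D₂≼ a₀ 0))))
    where
    open ColumnApproximation approximation
    -- This represents -pu: translation by pu lands on 0, and translation by pv lands on p(v - u),
    -- assumed nonzero.
    a₀ = ν ℕ.* (p ℕ.* u′)
    F : ℕ → ℕ → Operator
    F k = character 1 k
    e : Operator → Operator
    e = expSum (suc N)
    B : ℕ → Operator
    B k = generator 1 k
    perturbed = proj₂ (proj₂ (Π<-perturb p C 0≤C)) (n ×ℚ ε) 0≤η η≤1
      (λ k → scalar γ * F k v′) (λ k → combination (F k) Δ)
      (λ k → scaled-shift≼ γ (1 ℕ.* v′) (k ℕ.* v′) γ≤C) (λ k → Δ≼ 1 k)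
    D₁ = proj₁ perturbed
    D₁≼ = proj₁ (proj₂ perturbed)
    D₁-eq = proj₂ (proj₂ perturbed)
    expanded = proj₂ (proj₂ (Π<-expSum p (0<generatorBound 0<T))) N B (λ k → generator≼ τ≤T 1 k)
    D₂ = proj₁ expanded
    D₂≼ = proj₁ (proj₂ expanded)
    D₂-eq = proj₂ (proj₂ expanded)
    shifted-D₂≼ : shift (p ℕ.* u′) 0 * D₂ ≼ pow ½ (suc N) ℚ.* proj₁ (Π<-expSum p (0<generatorBound 0<T))
    shifted-D₂≼ = ≼-weaken (ℚ.≤-reflexive (ℚ.*-identityˡ _)) (*-≼ (shift≼ (p ℕ.* u′) 0) D₂≼)
    Πγ-scalar : ∀ K → Π< K (λ _ → scalar γ) ≈ scalar (KΣ.Π< K (λ _ → γ))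
    Πγ-scalar zero    = refl
    Πγ-scalar (suc K) = trans (*-congʳ (Πγ-scalar K)) (sym (scalar-* _ γ))
    products : shift (p ℕ.* u′) 0 + shift (p ℕ.* u′) 0 * D₂
             ≈ scalar (KΣ.Π< p (λ _ → γ)) * shift (p ℕ.* v′) 0 + D₁
    products = begin
      shift (p ℕ.* u′) 0 + shift (p ℕ.* u′) 0 * D₂
        ≈⟨ +-congʳ (*-identityʳ _) ⟨
      shift (p ℕ.* u′) 0 * 1# + shift (p ℕ.* u′) 0 * D₂
        ≈⟨ distribˡ (shift (p ℕ.* u′) 0) 1# D₂ ⟨
      shift (p ℕ.* u′) 0 * (1# + D₂)
        ≈⟨ *-congˡ (+-congʳ (trans (expSum-cong (suc N) (generators-cancel τ)) (expSum-0 N))) ⟨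
      shift (p ℕ.* u′) 0 * (e (Σ< p B) + D₂)
        ≈⟨ *-cong (Π<-character-odd h p-odd u′) D₂-eq ⟨
      Π< p (λ k → F k u′) * Π< p (λ k → e (B k))
        ≈⟨ Π<-* p (λ k → F k u′) (λ k → e (B k)) ⟨
      Π< p (λ k → F k u′ * e (B k))
        ≈⟨ Π<-cong p (λ k → trans (sym (column 1 k)) (split 1 k)) ⟩
      Π< p (λ k → scalar γ * F k v′ + combination (F k) Δ)
        ≈⟨ D₁-eq ⟩
      Π< p (λ k → scalar γ * F k v′) + D₁
        ≈⟨ +-congʳ (trans (Π<-* p (λ _ → scalar γ) (λ k → F k v′)) (*-cong (Πγ-scalar p) (Π<-character-odd h p-odd v′))) ⟩
      scalar (KΣ.Π< p (λ _ → γ)) * shift (p ℕ.* v′) 0 + D₁ ∎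
    main≡ : ∣ act (shift (p ℕ.* u′) 0) test a₀ 0 ∣₁ ≡ 1ℚ
    main≡ = ≡.trans (≡.cong ∣_∣₁ (≡.trans (test-yes (divides (p ℕ.* u′) (lemma ν (p ℕ.* u′)))) (≡.sym (K.*-identityˡ _)))) (∣∣₁-*-minus-one 1ᴳ)
      where
      lemma : ∀ ν x → ν ℕ.* x ℕ.+ x ≡ x ℕ.* (1 ℕ.+ ν)
      lemma = ℕ-Solver.solve-∀
    other≡ : act (scalar (KΣ.Π< p (λ _ → γ)) * shift (p ℕ.* v′) 0) test a₀ 0 ≡ 0ᴳ
    other≡ = ≡.trans (≡.cong (KΣ.Π< p (λ _ → γ) *ᴳ_) (test-no 0 n∤)) (K.zeroʳ _)
    equation : act (shift (p ℕ.* u′) 0) test a₀ 0 +ᴳ act (shift (p ℕ.* u′) 0 * D₂) test a₀ 0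
             ≡ 0ᴳ +ᴳ act D₁ test a₀ 0
    equation = ≡.trans (app products test-admissible a₀ 0) (≡.cong (_+ᴳ act D₁ test a₀ 0) other≡)

  -- ε is fixed before `T`, hence serves every time t; only the truncation depends on `T`. The lower
  -- bound on γ is needed for the reflected entry, whose estimate would otherwise be vacuous.
  rigidity : ∀ C → 0ℚ ℚ.≤ C → ∃[ ε ] 0ℚ ℚ.< ε × (∀ T → 0ℚ ℚ.< T → ∃[ N₀ ] ∀ N → N₀ ℕ.≤ N →
    (a : ColumnApproximation C T ε (suc N)) → ½ ℚ.< ∣ ColumnApproximation.γ a ∣₁ → u ≡ v)
  rigidity C 0≤C = ε , 0<ε , λ T 0<T →
    let c , 0≤c , _ = Π<-expSum p (0<generatorBound 0<T)
        -- Makes the truncation error less than ½; adding 1 to `c` keeps the multiplier positive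
        -- even if `c` is 0.
        N₀ , small  = pow½-small {2ℚ ℚ.* (c ℚ.+ 1ℚ)} {½} (*-pos 0<2 (ℚ.<-≤-trans 0<1 (≤-+ˡ ℚ.≤-refl 0≤c))) 0<½
    in N₀ , λ N N₀≤N a ½<γ → toℕ-injective (congruences⇒≡ ν h p-odd (toℕ<n u) (toℕ<n v)
      -- If p(v - u) were nonzero, 1 would be at most a perturbation error of ½ plus a truncation
      -- error below ½.
      (decidable-stable (n ∣? _) λ n∤ → ℚ.<-irrefl ≡.refl
        (ℚ.≤-<-trans (norm 0≤C 0<T a (≡.subst (0ℚ ℚ.≤_) (≡.sym nε≡η) (ℚ.<⇒≤ 0<η)) (≡.subst (ℚ._≤ 1ℚ) (≡.sym nε≡η) η≤1) n∤)
          (≡.subst (λ η → (η ℚ.* c′) ℚ.* 2ℚ ℚ.+ (pow ½ (suc N) ℚ.* c) ℚ.* 2ℚ ℚ.< 1ℚ) (≡.sym nε≡η)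
            (ℚ.+-mono-≤-< ηc′2≤½ (ℚ.≤-<-trans (truncation c (pow ½ (suc N)) (pow½-nonNeg (suc N))) (small (suc N) (ℕ.m≤n⇒m≤1+n N₀≤N)))))))
      -- If 2(v - u) were nonzero, γ would have norm at most 4η, hence at most ½.
      (decidable-stable (n ∣? _) λ n∤ → ℚ.<-irrefl ≡.refl
        (ℚ.<-≤-trans ½<γ (ℚ.≤-trans (reflection a n∤) (≡.subst (λ η → η ℚ.* 2ℚ ℚ.+ η ℚ.* 2ℚ ℚ.≤ ½) (≡.sym nε≡η) 4η≤½)))))
    where
    c′ = proj₁ (Π<-perturb p C 0≤C)
    0≤c′ = proj₁ (proj₂ (Π<-perturb p C 0≤C))
    0<2 : 0ℚ ℚ.< 2ℚ
    0<2 = ℚ.+-mono-< 0<1 0<1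
    0<8[c′+1] : 0ℚ ℚ.< 8ℚ ℚ.* (c′ ℚ.+ 1ℚ)
    0<8[c′+1] = *-pos (ℚ.positive⁻¹ 8ℚ) (ℚ.<-≤-trans 0<1 (≤-+ˡ ℚ.≤-refl 0≤c′))
    -- η = 1/(8(c′ + 1)) meets all three demands at once: η ≤ 1, 4η ≤ ½ and 2ηc′ ≤ ½.
    η = proj₁ (shrink 0<8[c′+1] 0<1)
    0<η = proj₁ (proj₂ (shrink 0<8[c′+1] 0<1))
    8[c′+1]η≡1 : (8ℚ ℚ.* (c′ ℚ.+ 1ℚ)) ℚ.* η ≡ 1ℚ
    8[c′+1]η≡1 = proj₂ (proj₂ (shrink 0<8[c′+1] 0<1))
    0<n : 0ℚ ℚ.< n ×ℚ 1ℚ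
    0<n = ℚ.<-≤-trans 0<1 (≤-+ʳ ℚ.≤-refl (×ℚ-nonNeg ν (ℚ.<⇒≤ 0<1)))
    -- The n entries of a column add up their errors, so each may have at most η/n.
    ε = proj₁ (shrink 0<n 0<η)
    0<ε = proj₁ (proj₂ (shrink 0<n 0<η))
    nε≡η : n ×ℚ ε ≡ η
    nε≡η = ≡.trans (≡.cong (n ×ℚ_) (≡.sym (ℚ.*-identityˡ ε))) (≡.trans (×ℚ-* n 1ℚ ε) (proj₂ (proj₂ (shrink 0<n 0<η))))
    0≤ηc′ = *-nonNeg (ℚ.<⇒≤ 0<η) 0≤c′
    η≤1 : η ℚ.≤ 1ℚ
    η≤1 = ≡.subst (η ℚ.≤_)
      (≡.trans (ℚS.solve 2 (λ η c → η ℚS.:+ (ℚS.con 8ℚ ℚS.:* (η ℚS.:* c) ℚS.:+ ℚS.con 7ℚ ℚS.:* η) ℚS.:= (ℚS.con 8ℚ ℚS.:* (c ℚS.:+ ℚS.con 1ℚ)) ℚS.:* η) ≡.refl η c′) 8[c′+1]η≡1)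
      (≤-+ʳ ℚ.≤-refl (ℚ.+-mono-≤ (*-nonNeg (ℚ.nonNegative⁻¹ 8ℚ) 0≤ηc′) (*-nonNeg (ℚ.nonNegative⁻¹ 7ℚ) (ℚ.<⇒≤ 0<η))))
    half-identity : ½ ℚ.* ((8ℚ ℚ.* (c′ ℚ.+ 1ℚ)) ℚ.* η) ≡ ½
    half-identity = ≡.trans (≡.cong (½ ℚ.*_) 8[c′+1]η≡1) (ℚ.*-identityʳ ½)
    4η≤½ : η ℚ.* 2ℚ ℚ.+ η ℚ.* 2ℚ ℚ.≤ ½
    4η≤½ = ≡.subst (η ℚ.* 2ℚ ℚ.+ η ℚ.* 2ℚ ℚ.≤_)
      (≡.trans (ℚS.solve 2 (λ η c → (η ℚS.:* ℚS.con 2ℚ ℚS.:+ η ℚS.:* ℚS.con 2ℚ) ℚS.:+ ℚS.con 4ℚ ℚS.:* (η ℚS.:* c) ℚS.:= ℚS.con ½ ℚS.:* ((ℚS.con 8ℚ ℚS.:* (c ℚS.:+ ℚS.con 1ℚ)) ℚS.:* η)) ≡.refl η c′) half-identity)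
      (≤-+ʳ ℚ.≤-refl (*-nonNeg (ℚ.nonNegative⁻¹ 4ℚ) 0≤ηc′))
    ηc′2≤½ : (η ℚ.* c′) ℚ.* 2ℚ ℚ.≤ ½
    ηc′2≤½ = ≡.subst ((η ℚ.* c′) ℚ.* 2ℚ ℚ.≤_)
      (≡.trans (ℚS.solve 2 (λ η c → (η ℚS.:* c) ℚS.:* ℚS.con 2ℚ ℚS.:+ (ℚS.con 2ℚ ℚS.:* (η ℚS.:* c) ℚS.:+ ℚS.con 4ℚ ℚS.:* η) ℚS.:= ℚS.con ½ ℚS.:* ((ℚS.con 8ℚ ℚS.:* (c ℚS.:+ ℚS.con 1ℚ)) ℚS.:* η)) ≡.refl η c′) half-identity)
      (≤-+ʳ ℚ.≤-refl (ℚ.+-mono-≤ (*-nonNeg (ℚ.<⇒≤ 0<2) 0≤ηc′) (*-nonNeg (ℚ.nonNegative⁻¹ 4ℚ) (ℚ.<⇒≤ 0<η))))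
    truncation : ∀ c h → 0ℚ ℚ.≤ h → (h ℚ.* c) ℚ.* 2ℚ ℚ.≤ (2ℚ ℚ.* (c ℚ.+ 1ℚ)) ℚ.* h
    truncation c h 0≤h = ≡.subst ((h ℚ.* c) ℚ.* 2ℚ ℚ.≤_)
      (ℚS.solve 2 (λ c h → (h ℚS.:* c) ℚS.:* ℚS.con 2ℚ ℚS.:+ ℚS.con 2ℚ ℚS.:* h ℚS.:= (ℚS.con 2ℚ ℚS.:* (c ℚS.:+ ℚS.con 1ℚ)) ℚS.:* h) ≡.refl c h)
      (≤-+ʳ ℚ.≤-refl (*-nonNeg (ℚ.<⇒≤ 0<2) 0≤h))

-- From limits of complex numbers to estimates at a single index

open GaussianRationals

eventually-all : ∀ {n} {P : Fin n → ℕ → Set} → (∀ a → Eventually (P a)) → Eventually (λ i → ∀ a → P a i)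
eventually-all {zero}  h = 0 , λ _ _ ()
eventually-all {suc n} h =
  let M , h₀ = h Fin.zero
      N , h₁ = eventually-all (h ∘ Fin.suc)
  in M ℕ.⊔ N , λ i p → λ where
    Fin.zero    → h₀ i (ℕ.m⊔n≤o⇒m≤o M N p)
    (Fin.suc a) → h₁ i (ℕ.m⊔n≤o⇒n≤o M N p) a

opaque
  unfolding _-ᴳ_ _at_

  -- The two thresholds are nested: the index i of the Cauchy sequences is chosen only after the
  -- member j of the sequence.
  ⟶ᶜ-at : ∀ {z w} → z ⟶ᶜ w → ∀ ε → 0ℚ ℚ.< ε → Eventually λ j → Eventually λ i → ∣ z j at i -ᴳ w at i ∣₁ ℚ.< ε
  ⟶ᶜ-at {z} {w} (re⟶ , im⟶) ε 0<ε =
    let M , h = re⟶ (half ε) (half-pos 0<ε)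
        N , k = im⟶ (half ε) (half-pos 0<ε)
    in M ℕ.⊔ N , λ j p →
    let M′ , h′ = <ᴿ-eventually {∣ re (z j) -ᴿ re w ∣ᴿ} {half ε} (h j (ℕ.m⊔n≤o⇒m≤o M N p))
        N′ , k′ = <ᴿ-eventually {∣ im (z j) -ᴿ im w ∣ᴿ} {half ε} (k j (ℕ.m⊔n≤o⇒n≤o M N p))
    in M′ ℕ.⊔ N′ , λ i q → ≡.subst (_ ℚ.<_) (half+half ε)
      (ℚ.+-mono-< (h′ i (ℕ.m⊔n≤o⇒m≤o M′ N′ q)) (k′ i (ℕ.m⊔n≤o⇒n≤o M′ N′ q)))

  triangle₁ : ∀ x y z → ∣ x -ᴳ z ∣₁ ℚ.≤ ∣ x -ᴳ y ∣₁ ℚ.+ ∣ y -ᴳ z ∣₁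
  triangle₁ x y z = ≡.subst (∣ x -ᴳ z ∣₁ ℚ.≤_)
    (solve 4 (λ a b c d → (a :+ c) :+ (b :+ d) := (a :+ b) :+ (c :+ d)) ≡.refl
      (ℚ.∣ Re x ℚ.- Re y ∣) (ℚ.∣ Im x ℚ.- Im y ∣) (ℚ.∣ Re y ℚ.- Re z ∣) (ℚ.∣ Im y ℚ.- Im z ∣))
    (ℚ.+-mono-≤ (∣-∣-tri (Re x) (Re y) (Re z)) (∣-∣-tri (Im x) (Im y) (Im z)))
    where open ℚ-Solver.+-*-Solver using (solve; _:=_; _:+_)

  -- A sum norm of at most ½ would give a squared modulus of at most ¼, which is not within ½ of 1.
  unit-at : ∀ γ → normSq γ ≈ᴿ 1ᴿ → Eventually λ i → ½ ℚ.< ∣ γ at i ∣₁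
  unit-at γ unit =
    let N , h = unit ½ 0<½
    in N , λ i N≤i → ℚ.≰⇒> (λ g≤½ → ℚ.<-irrefl ≡.refl (ℚ.<-≤-trans (h i N≤i) (far (seq (normSq γ) i)
      (ℚ.≤-trans (square≤ (γ at i)) (*-mono-≤ {∣ γ at i ∣₁} {½} {∣ γ at i ∣₁} {½} (∣∣₁-nonNeg (γ at i)) g≤½ (∣∣₁-nonNeg (γ at i)) g≤½)))))
    where
    open ℚ-Solver.+-*-Solver using (solve; _:=_; _:+_; _:-_; con)
    far : ∀ q → q ℚ.≤ ½ ℚ.* ½ → ½ ℚ.≤ ℚ.∣ q ℚ.- 1ℚ ∣
    far q q≤¼ = ℚ.≤-trans ½≤1-q (≡.subst (1ℚ ℚ.- q ℚ.≤_) (∣-∣-sym 1ℚ q) (p≤∣p∣ (1ℚ ℚ.- q)))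
      where
      ½<1 : ½ ℚ.< 1ℚ
      ½<1 = ℚ.+-monoʳ-< ½ 0<½
      ½≤1-q : ½ ℚ.≤ 1ℚ ℚ.- q
      ½≤1-q = ≡.subst (ℚ._≤ 1ℚ ℚ.- q) (solve 1 (λ q → (con ½ :+ q) :- q := con ½) ≡.refl q)
        (ℚ.+-monoˡ-≤ (ℚ.- q) (ℚ.≤-trans (ℚ.+-monoʳ-≤ ½ q≤¼) (ℚ.<⇒≤ (ℚ.+-monoʳ-< ½ (ℚ.*-monoʳ-<-pos ½ ½<1)))))

opaque
  unfolding _at_ _*ᴳ_

  real-at : ∀ q i → fromℝ (fromℚ q) at i ≡ ⟨ q , 0ℚ ⟩
  real-at q i = ≡.refl

  real-* : ∀ p q → ⟨ p ℚ.* q , 0ℚ ⟩ ≡ ⟨ p , 0ℚ ⟩ *ᴳ ⟨ q , 0ℚ ⟩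
  real-* p q = ≡.cong₂ ⟨_,_⟩
    (solve 2 (λ p q → p :* q := p :* q :- con 0ℚ :* con 0ℚ) ≡.refl p q)
    (solve 2 (λ p q → con 0ℚ := p :* con 0ℚ :+ con 0ℚ :* q) ≡.refl p q)
    where open ℚ-Solver.+-*-Solver using (solve; _:=_; _:+_; _:*_; _:-_; con)

  1/!0 : ⟨ 1/! 0 , 0ℚ ⟩ ≡ 1ᴳ
  1/!0 = ≡.refl

module ExpSeries {n} (M : Matrix n) (u : Fin n) (i : ℕ) where
  open CommutativeSemiring gaussian using (*-identityˡ; *-assoc; *-comm)
  open Series gaussian using (Σ<)
  open FinSums gaussian
  open ≡.≡-Reasoning

  column : ℕ → Vector ℚ[i] n
  column k a = expTerm M k a u at i

  private
    factor : ℕ → ℚ[i]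
    factor k = ⟨ 1/! k , 0ℚ ⟩

    column-factor : ∀ k a → column k a ≡ factor k *ᴳ (M ^ᴹ k) a u at i
    column-factor k a = ≡.trans (*-at (fromℝ (fromℚ (1/! k))) ((M ^ᴹ k) a u) i)
      (≡.cong (_*ᴳ (M ^ᴹ k) a u at i) (real-at (1/! k) i))

  column-zero : ∀ a → column 0 a ≡ indicator a u
  column-zero a = begin
    column 0 a                   ≡⟨ column-factor 0 a ⟩
    factor 0 *ᴳ δ a u at i       ≡⟨ ≡.cong₂ _*ᴳ_ 1/!0 (δ-at a u i) ⟩
    1ᴳ *ᴳ indicator a u          ≡⟨ *-identityˡ (indicator a u) ⟩
    indicator a u                ∎

  column-suc : ∀ k a → column (suc k) a ≡ recip k *ᴳ sum (λ c → M a c at i *ᴳ column k c)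
  column-suc k a = begin
    column (suc k) a
      ≡⟨ column-factor (suc k) a ⟩
    factor (suc k) *ᴳ (M *ᴹ (M ^ᴹ k)) a u at i
      ≡⟨ ≡.cong₂ _*ᴳ_ (≡.trans (≡.cong (λ q → ⟨ q , 0ℚ ⟩) (1/!-suc k)) (real-* (inv k) (1/! k))) (*ᴹ-at M (M ^ᴹ k) a u i) ⟩
    (recip k *ᴳ factor k) *ᴳ sum (λ c → M a c at i *ᴳ (M ^ᴹ k) c u at i)
      ≡⟨ *-assoc (recip k) (factor k) _ ⟩
    recip k *ᴳ (factor k *ᴳ sum (λ c → M a c at i *ᴳ (M ^ᴹ k) c u at i))
      ≡⟨ ≡.cong (recip k *ᴳ_) (*-distribˡ-sum (factor k) (λ c → M a c at i *ᴳ (M ^ᴹ k) c u at i)) ⟩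
    recip k *ᴳ sum (λ c → factor k *ᴳ (M a c at i *ᴳ (M ^ᴹ k) c u at i))
      ≡⟨ ≡.cong (recip k *ᴳ_) (sum-cong-≋ entry) ⟩
    recip k *ᴳ sum (λ c → M a c at i *ᴳ column k c) ∎
    where
    entry : ∀ c → factor k *ᴳ (M a c at i *ᴳ (M ^ᴹ k) c u at i) ≡ M a c at i *ᴳ column k c
    entry c = begin
      factor k *ᴳ (M a c at i *ᴳ (M ^ᴹ k) c u at i)  ≡⟨ *-assoc (factor k) _ _ ⟨
      (factor k *ᴳ M a c at i) *ᴳ (M ^ᴹ k) c u at i  ≡⟨ ≡.cong (_*ᴳ (M ^ᴹ k) c u at i) (*-comm (factor k) (M a c at i)) ⟩
      (M a c at i *ᴳ factor k) *ᴳ (M ^ᴹ k) c u at i  ≡⟨ *-assoc (M a c at i) _ _ ⟩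
      M a c at i *ᴳ (factor k *ᴳ (M ^ᴹ k) c u at i)  ≡⟨ ≡.cong (M a c at i *ᴳ_) (column-factor k c) ⟨
      M a c at i *ᴳ column k c                       ∎

  expPartial-at : ∀ N a → expPartial M N a u at i ≡ Σ< N (λ k → column k a)
  expPartial-at N a = go N
    where
    f : ℕ → ℂ
    f k = expTerm M k a u
    go : ∀ N → ∑[< N ] f at i ≡ Σ< N (λ k → f k at i)
    go zero    = 0ᶜ-at i
    go (suc N) = ≡.trans (+-at (∑[< N ] f) (f N) i) (≡.cong (_+ᴳ f N at i) (go N))

odd : ∀ p → ¬ (2 ∣ p) → ∃[ h ] p ≡ 1 ℕ.+ h ℕ.* 2
odd p 2∤p with p % 2 in eq | m%n<n p 2
... | 0 | _ = contradiction (m%n≡0⇒n∣m p 2 eq) 2∤p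
... | 1 | _ = p / 2 , ≡.trans (m≡m%n+[m/n]*n p 2) (≡.cong (ℕ._+ p / 2 ℕ.* 2) eq)
... | suc (suc _) | ℕ.s≤s (ℕ.s≤s ())

-- State transfer on the circulant graph

module ConnectionSet (ν : ℕ) (S : Subset (suc ν)) (-S=S : NegationClosed S) where
  private n = suc ν

  -- The indicator of `S`, extended periodically to ℕ so that indices in character sums can be added
  -- without reduction.
  χ : ℕ → ℚ[i]
  χ c = if does (c mod n ∈? S) then 1ᴳ else 0ᴳ

  toℕ-mod : ∀ c → toℕ (c mod n) ≡ c % n
  toℕ-mod c = toℕ-fromℕ< (m%n<n c n)

  χ-periodic : ∀ c → χ (c ℕ.+ n) ≡ χ c
  χ-periodic c = ≡.cong (λ a → if does (a ∈? S) then 1ᴳ else 0ᴳ)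
    (toℕ-injective (≡.trans (toℕ-mod (c ℕ.+ n)) (≡.trans ([m+n]%n≡m%n c n) (≡.sym (toℕ-mod c)))))

  χ-even : ∀ c → c ℕ.< n → χ (n ℕ.∸ c) ≡ χ c
  -- Here n - c is n, which is not a reduced residue, so periodicity takes the place of closure
  -- under negation.
  χ-even zero      _   = χ-periodic 0
  χ-even c@(suc d) c<n = ≡.cong (λ b → if b then 1ᴳ else 0ᴳ) (does-⇔ (mk⇔ back (negate c c<n)) (_ ∈? S) (_ ∈? S))
    where
    negate : ∀ c → c ℕ.< n → c mod n ∈ S → (n ℕ.∸ c) mod n ∈ S
    negate c c<n c∈S = Equivalence.to (-S=S _) (c mod n , c∈S ,
      ≡.cong (λ x → (n ℕ.∸ x) mod n) (≡.sym (≡.trans (toℕ-mod c) (m<n⇒m%n≡m c<n))))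
    back : (n ℕ.∸ c) mod n ∈ S → c mod n ∈ S
    back n-c∈S = ≡.subst (λ x → x mod n ∈ S) (ℕ.m∸[m∸n]≡n (ℕ.<⇒≤ c<n))
      (negate (n ℕ.∸ c) (ℕ.s≤s (ℕ.m∸n≤m ν d)) n-c∈S)

  -- As p divides n, divisibility of s by p passes to the residue of s modulo n.
  χ-support : ∀ {p} → p ∣ n → (∀ {s} → s ∈ S → ¬ (p ∣ toℕ s)) → ∀ s → χ s ≡ 0ᴳ ⊎ ¬ (p ∣ s)
  χ-support p∣n p∤S s with s mod n ∈? S
  ... | yes s∈S = inj₂ λ p∣s → p∤S s∈S (≡.subst (_ ∣_) (≡.sym (toℕ-mod s)) (%-presˡ-∣ p∣s p∣n))
  ... | no  _   = inj₁ ≡.refl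

  χ-bound : ∀ s → ∣ χ s ∣₁ ℚ.≤ 1ℚ
  χ-bound s with does (s mod n ∈? S)
  ... | true  = ℚ.≤-refl
  ... | false = ℚ.<⇒≤ 0<1

adjacency-at : ∀ {n} (S : Subset n) (0∉S : ∀ {s} → s ∈ S → toℕ s ≢ 0) (-S=S : NegationClosed S) i a c →
  adjacency (Cay S 0∉S -S=S) a c at i ≡ (if does (a ⊖ c ∈? S) then 1ᴳ else 0ᴳ)
adjacency-at S 0∉S -S=S i a c with does (a ⊖ c ∈? S)
... | true  = 1ᶜ-at i
... | false = 0ᶜ-at i

•ᴹ-at : ∀ {n} z (M : Matrix n) i (A : Fin n → Fin n → ℚ[i]) → (∀ a c → M a c at i ≡ A a c) →
  ∀ a c → (z •ᴹ M) a c at i ≡ z at i *ᴳ A a c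
•ᴹ-at z M i A M-at a c = ≡.trans (*-at z (M a c) i) (≡.cong (z at i *ᴳ_) (M-at a c))

•ᵛ𝐞-at : ∀ {n} z (v a : Fin n) i → (z •ᵛ 𝐞 v) a at i ≡ z at i *ᴳ FinSums.indicator gaussian a v
•ᵛ𝐞-at z v a i = ≡.trans (*-at z (𝐞 v a) i) (≡.cong (z at i *ᴳ_) (δ-at a v i))

module Transfer (ν m p : ℕ) (p-prime : Prime p) (2∤p : ¬ (2 ∣ p)) (n≡m*p : suc ν ≡ m ℕ.* p)
  (S : Subset (suc ν)) (-S=S : NegationClosed S)
  (p∤S : ∀ {s} → s ∈ S → ¬ (p ∣ toℕ s)) (u v : Fin (suc ν)) where
  open ConnectionSet ν S -S=S
  open FinSums gaussian using (indicator; sum-cong-≋)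

  A : Fin (suc ν) → Fin (suc ν) → ℚ[i]
  A a c = χ (toℕ a ℕ.+ (suc ν ℕ.∸ toℕ c))

  open CirculantExponential ν m p (proj₁ (odd p 2∤p)) n≡m*p (proj₂ (odd p 2∤p)) p-prime
    χ χ-periodic χ-even (χ-support (divides m n≡m*p) p∤S) χ-bound A (λ a c → ≡.refl) u v

  approximation : ∀ {C T ε} (M : Matrix (suc ν)) (τ γ : ℚ[i]) N i → (∀ a c → M a c at i ≡ τ *ᴳ A a c) →
    ∣ τ ∣₁ ℚ.≤ T → ∣ γ ∣₁ ℚ.≤ C →
    (∀ a → ∣ expPartial M N a u at i -ᴳ γ *ᴳ indicator a v ∣₁ ℚ.≤ ε) → ColumnApproximation C T ε N
  approximation M τ γ N i M-at τ≤T γ≤C close = record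
    { τ      = τ
    ; γ      = γ
    ; x      = column
    ; X      = λ a → expPartial M N a u at i
    ; x-zero = column-zero
    ; x-suc  = λ k a → ≡.trans (column-suc k a)
        (≡.cong (recip k *ᴳ_) (sum-cong-≋ (λ c → ≡.cong (_*ᴳ column k c) (M-at a c))))
    ; X-sum  = expPartial-at N
    ; τ≤T    = τ≤T
    ; γ≤C    = γ≤C
    ; close  = close
    }
    where open ExpSeries M u i

  close-column : ∀ {ε} M N γ i → (∀ a → ∣ expPartial M N a u at i -ᴳ exp M a u at i ∣₁ ℚ.< half ε) →
    (∀ a → ∣ (exp M *ᵛ 𝐞 u) a at i -ᴳ (γ •ᵛ 𝐞 v) a at i ∣₁ ℚ.< half ε) →
    ∀ a → ∣ expPartial M N a u at i -ᴳ γ at i *ᴳ indicator a v ∣₁ ℚ.≤ ε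
  close-column {ε} M N γ i partial≈ limit≈ a = ℚ.≤-trans
    (triangle₁ (expPartial M N a u at i) (exp M a u at i) (γ at i *ᴳ indicator a v))
    (≡.subst (∣ expPartial M N a u at i -ᴳ exp M a u at i ∣₁ ℚ.+ ∣ exp M a u at i -ᴳ γ at i *ᴳ indicator a v ∣₁ ℚ.≤_) (half+half ε)
      (ℚ.+-mono-≤ (ℚ.<⇒≤ (partial≈ a))
        (ℚ.<⇒≤ (≡.subst₂ (λ x y → ∣ x -ᴳ y ∣₁ ℚ.< half ε) (*ᵛ𝐞-at (exp M) a u i) (•ᵛ𝐞-at γ v a i) (limit≈ a)))))

  module _ {C ε : ℚ} (0<ε : 0ℚ ℚ.< ε)
    (rigid : ∀ T → 0ℚ ℚ.< T → ∃[ N₀ ] ∀ N → N₀ ℕ.≤ N →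
      (a : ColumnApproximation C T ε (suc N)) → ½ ℚ.< ∣ ColumnApproximation.γ a ∣₁ → u ≡ v)
    (γ : ℂ) (γ≤C : ∀ i → ∣ γ at i ∣₁ ℚ.≤ C) (unit : Eventually λ i → ½ ℚ.< ∣ γ at i ∣₁) where

    near-transfer : ∀ (M : Matrix (suc ν)) (τ : ℕ → ℚ[i]) {T} → 0ℚ ℚ.< T → (∀ i → ∣ τ i ∣₁ ℚ.≤ T) →
      (∀ i a c → M a c at i ≡ τ i *ᴳ A a c) →
      (Eventually λ i → ∀ a → ∣ (exp M *ᵛ 𝐞 u) a at i -ᴳ (γ •ᵛ 𝐞 v) a at i ∣₁ ℚ.< half ε) → u ≡ v
    near-transfer M τ 0<T τ≤T M-at (I₁ , limit≈) =
      -- First `N`, large enough for rigidity and for the exponential series to be near its limit;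
      -- then an index `i` late enough for the truncation at that `N`, for the transfer estimate and
      -- for the size of γ.
      let N₀ , conclude = rigid _ 0<T
          N₁ , partial  = eventually-all (λ a → ⟶ᶜ-at {λ N → expPartial M N a u} {exp M a u} (exp-limit M a u) (half ε) (half-pos 0<ε))
          N = N₀ ℕ.⊔ N₁
          I₂ , partial≈ = eventually-all (partial (suc N) (ℕ.m≤n⇒m≤1+n (ℕ.m≤n⊔m N₀ N₁)))
          I₃ , ½<γ      = unit
          i = I₁ ℕ.⊔ (I₂ ℕ.⊔ I₃)
      in conclude N (ℕ.m≤m⊔n N₀ N₁)
           (approximation M (τ i) (γ at i) (suc N) i (M-at i) (τ≤T i) (γ≤C i)
             (close-column M (suc N) γ i
               (partial≈ i (ℕ.≤-trans (ℕ.m≤m⊔n I₂ I₃) (ℕ.m≤n⊔m I₁ (I₂ ℕ.⊔ I₃))))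
               (limit≈ i (ℕ.m≤m⊔n I₁ (I₂ ℕ.⊔ I₃)))))
           (½<γ i (ℕ.≤-trans (ℕ.m≤n⊔m I₂ I₃) (ℕ.m≤n⊔m I₁ (I₂ ℕ.⊔ I₃))))

    -- A single j within the tolerance suffices. Its bound `T` may be arbitrarily large, since ε was
    -- fixed before it.
    limit⇒≡ : ∀ (M : ℕ → Matrix (suc ν)) (τ : ℕ → ℕ → ℚ[i]) →
      (∀ j → ∃[ T ] 0ℚ ℚ.< T × (∀ i → ∣ τ j i ∣₁ ℚ.≤ T)) → (∀ j i a c → M j a c at i ≡ τ j i *ᴳ A a c) →
      ((λ j → exp (M j) *ᵛ 𝐞 u) ⟶ᵛ γ •ᵛ 𝐞 v) → u ≡ v
    limit⇒≡ M τ τ-bounded M-at lim =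
      let j , near = eventually-all (λ a → ⟶ᶜ-at {λ j → (exp (M j) *ᵛ 𝐞 u) a} {(γ •ᵛ 𝐞 v) a} (lim a) (half ε) (half-pos 0<ε))
          T , 0<T , τ≤T = τ-bounded j
      in near-transfer (M j) (τ j) 0<T τ≤T (M-at j) (eventually-all (near j ℕ.≤-refl))

  transfer⇒≡ : (G : Graph (suc ν)) → (∀ i a c → adjacency G a c at i ≡ A a c) → PrettyGoodStateTransfer G u v → u ≡ v
  transfer⇒≡ G G-at (t , γ , unit , lim) =
    let C , 0<C , γ≤C   = at-bounded γ
        ε , 0<ε , rigid = rigidity C (ℚ.<⇒≤ 0<C)
        z : ℕ → ℂ
        z j = -ᶜ (𝕚 *ᶜ fromℝ (t j))
    in limit⇒≡ 0<ε rigid γ γ≤C (unit-at γ unit) (λ j → z j •ᴹ adjacency G) (λ j i → z j at i)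
         (λ j → at-bounded (z j)) (λ j i → •ᴹ-at (z j) (adjacency G) i A (G-at i)) lim

-- Matching n with a successor lets `a ⊖ c` reduce to the residue at which `χ` is evaluated, so the
-- hypothesis on the entries of `G` is literally the circulant form.
circulant-transfer⇒≡ : ∀ m n p → Prime p → ¬ (2 ∣ p) → n ≡ m ℕ.* p →
  (S : Subset n) → NegationClosed S → (∀ {s} → s ∈ S → ¬ (p ∣ toℕ s)) →
  (G : Graph n) → (∀ i a c → adjacency G a c at i ≡ (if does (a ⊖ c ∈? S) then 1ᴳ else 0ᴳ)) →
  (u v : Fin n) → PrettyGoodStateTransfer G u v → u ≡ v
circulant-transfer⇒≡ m (suc ν) p p-prime 2∤p n≡m*p S -S=S p∤S G G-at u v =
  Transfer.transfer⇒≡ ν m p p-prime 2∤p n≡m*p S -S=S p∤S u v G G-at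

open import Data.Nat using (_*_)

-- The body mentions Cay S 0∉S -S=S in the context of the module parameters:
-- under pattern variables 0∉S would be η-contracted in the type only, and the
-- conversion checker would then compare the exponentials by unfolding them.
module NoTransfer (m n p : ℕ) .{{_ : NonZero m}} (p-prime : Prime p) (2∤p : ¬ (2 ∣ p)) (n≡m*p : n ≡ m * p)
  (S : Subset n) (0∉S : ∀ {s} → s ∈ S → toℕ s ≢ 0) (-S=S : NegationClosed S)
  (p∤S : ∀ {s} → s ∈ S → ¬ (p ∣ toℕ s))
  (u v : Fin n) (u≢v : u ≢ v) where

  no-transfer : ¬ PrettyGoodStateTransfer (Cay S 0∉S -S=S) u v
  no-transfer = u≢v ∘ circulant-transfer⇒≡ m n p p-prime 2∤p n≡m*p S -S=S p∤S
    (Cay S 0∉S -S=S) (adjacency-at S 0∉S -S=S) u v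

theorem2p6 : (m n p : ℕ) → .{{_ : NonZero m}} → Prime p → ¬ (2 ∣ p) → n ≡ m * p →
    (S : Subset n) (0∉S : ∀ {s} → s ∈ S → toℕ s ≢ 0) (-S=S : NegationClosed S) →
    (∀ {s} → s ∈ S → ¬ (p ∣ toℕ s)) →
    (u v : Fin n) → u ≢ v → ¬ PrettyGoodStateTransfer (Cay S 0∉S -S=S) u v
theorem2p6 = NoTransfer.no-transfer
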